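{- For any $k\ge 2$ and $k/2\ge d\ge 1$, with $t=\frac{1}{2x}$, $$I_{[k,d]}(x)=\frac{1}{x\,(U_d(t)-U_{d-1}(t))}\left[U_{d-1}(t)+\frac{U_{k-2d-1}(t)}{U_{k-d}(t)\,U_{k-d-1}(t)}\sum_{j=0}^{k-d-1}U_j(t)\right],$$ where $[k,d]$ denotes the permutation $(d+1,d+2,\dots,k,1,2,\dots,d)\in S_k$, $I_{[k,d]}(x)=\sum_{n\ge0}I_{[k,d]}(n)x^n$, and $I_{[k,d]}(n)$ is the number of involutions in $S_n$ avoiding both $132$ and $[k,d]$.
   Context: $S_n$ is the set of permutations of $\{1,\dots,n\}$. A permutation $\alpha\in S_n$ contains a pattern $\tau\in S_k$ if there are $1\le i_1<\dots<i_k\le n$ such that $(\alpha_{i_1},\dots,\alpha_{i_k})$ is order-isomorphic to $\tau$; otherwise $\alpha$ avoids $\tau$. An involution is a permutation equal to its own inverse; the empty permutation is counted for $n=0$. $U_r$ denotes the Chebyshev polynomial of the second kind, $U_r(\cos\theta)=\sin((r+1)\theta)/\sin\theta$; in particular $U_{ -1}=0$. The identity is one of rational functions, expanded as power series in $x$. -}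

module Defs where

open import Algebra.Definitions using (Involutive)
open import Data.Fin as Fin using (Fin; toℕ)
import Data.Fin.Properties as Fin
open import Data.Integer as ℤ using (ℤ; +_; -[1+_]; 0ℤ; 1ℤ)
import Data.Integer.Properties as ℤ
open import Data.Integer.Solver using (module +-*-Solver)
open import Data.List as List using (List; []; _∷_)
open import Data.Nat as ℕ using (ℕ; zero; suc; _∸_)
open import Data.Product using (∃; _×_; _,_)
open import Data.Sum using ([_,_]′)
open import Data.Vec as Vec using (Vec; []; _∷_; lookup; tabulate)
open import Function using (_∘_; _⇔_; mk⇔; Equivalence)
open import Level using (0ℓ)
open import Relation.Binary.PropositionalEquality
  using (_≡_; _≢_; refl; sym; trans; cong; cong₂)
open import Relation.Nullary using (¬_; Dec; yes; no; contradiction)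
open import Relation.Nullary.Decidable using (map′; ¬?; _×-dec_; _→-dec_)
open import Relation.Unary using (Pred; Decidable)

------------------------------------------------------------------------
-- Pattern-avoiding involutions

-- Words are in one-line notation.  A permutation of n letters is a word in
-- Vec (Fin n) n, its letters running over 0, …, n - 1 rather than 1, …, n.
-- Patterns keep their usual letters: only the relative order matters.

IsInvolution : ∀ {n} → Vec (Fin n) n → Set
IsInvolution α = Involutive _≡_ (lookup α)

Increasing : ∀ {n k} → Vec (Fin n) k → Set
Increasing i = ∀ a b → a Fin.< b → lookup i a Fin.< lookup i b

-- The letters of α at the positions i are in the same relative order as
-- those of τ.
OrderIsomorphicAt : ∀ {n k} → Vec (Fin n) n → Vec ℕ k → Vec (Fin n) k → Set
OrderIsomorphicAt α τ i = ∀ a b →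
  (lookup α (lookup i a) Fin.< lookup α (lookup i b)) ⇔
  (lookup τ a ℕ.< lookup τ b)

Contains : ∀ {n k} → Vec (Fin n) n → Vec ℕ k → Set
Contains {n} {k} α τ =
  ∃ λ (i : Vec (Fin n) k) → Increasing i × OrderIsomorphicAt α τ i

Avoids : ∀ {n k} → Vec (Fin n) n → Vec ℕ k → Set
Avoids α τ = ¬ Contains α τ

⟨132⟩ : Vec ℕ 3
⟨132⟩ = 1 ∷ 3 ∷ 2 ∷ []

-- (d + 1, …, k, 1, …, d); the length is k as soon as d ≤ k.
[_,_] : (k d : ℕ) → Vec ℕ (k ∸ d ℕ.+ d)
[ k , d ] = tabulate {n = k ∸ d} (λ i → d ℕ.+ suc (toℕ i))
     Vec.++ tabulate {n = d} (λ i → suc (toℕ i))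

private
  anyVec? : ∀ {n} k {P : Pred (Vec (Fin n) k) 0ℓ} → Decidable P → Dec (∃ P)
  anyVec? zero    P? = map′ ([] ,_) (λ { ([] , p) → p }) (P? [])
  anyVec? (suc k) P? = map′
    (λ { (i , is , p) → i ∷ is , p })
    (λ { (i ∷ is , p) → i , is , p })
    (Fin.any? λ i → anyVec? k λ is → P? (i ∷ is))

  _⇔-dec_ : {A B : Set} → Dec A → Dec B → Dec (A ⇔ B)
  a? ⇔-dec b? = map′ (λ (f , g) → mk⇔ f g)
    (λ e → Equivalence.to e , Equivalence.from e)
    ((a? →-dec b?) ×-dec (b? →-dec a?))

isInvolution? : ∀ {n} → Decidable (IsInvolution {n})
isInvolution? α = Fin.all? λ i → lookup α (lookup α i) Fin.≟ i

contains? : ∀ {n k} (α : Vec (Fin n) n) (τ : Vec ℕ k) → Dec (Contains α τ)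
contains? {k = k} α τ = anyVec? k λ i →
  (Fin.all? λ a → Fin.all? λ b →
    (a Fin.<? b) →-dec (lookup i a Fin.<? lookup i b))
  ×-dec
  (Fin.all? λ a → Fin.all? λ b →
    (lookup α (lookup i a) Fin.<? lookup α (lookup i b))
    ⇔-dec (lookup τ a ℕ.<? lookup τ b))

-- Each word of length m over Fin n, exactly once.
words : ∀ n m → List (Vec (Fin n) m)
words n zero    = [] ∷ []
words n (suc m) = List.cartesianProductWith _∷_ (List.allFin n) (words n m)

-- All self-maps of Fin n can be enumerated here, since those that are
-- involutive are automatically permutations.
Counted : ∀ {k} → Vec ℕ k → (n : ℕ) → Pred (Vec (Fin n) n) 0ℓ
Counted τ n α = IsInvolution α × Avoids α ⟨132⟩ × Avoids α τ

counted? : ∀ {k} (τ : Vec ℕ k) n → Decidable (Counted τ n)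
counted? τ n α =
  isInvolution? α ×-dec ¬? (contains? α ⟨132⟩) ×-dec ¬? (contains? α τ)

-- The number of involutions of n letters avoiding both 132 and τ.
I : ∀ {k} → Vec ℕ k → ℕ → ℕ
I τ n = List.length (List.filter (counted? τ n) (words n n))

------------------------------------------------------------------------
-- Polynomials in x over ℤ

-- Coefficients from the constant term up; trailing zeros are allowed.
Poly : Set
Poly = List ℤ

coeff : Poly → ℕ → ℤ
coeff []      n       = 0ℤ
coeff (a ∷ p) zero    = a
coeff (a ∷ p) (suc n) = coeff p n

infixl 6 _+ᵖ_
infixl 7 _*ᵖ_

_+ᵖ_ : Poly → Poly → Poly
[]      +ᵖ q       = q
(a ∷ p) +ᵖ []      = a ∷ p
(a ∷ p) +ᵖ (b ∷ q) = a ℤ.+ b ∷ p +ᵖ q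

-ᵖ_ : Poly → Poly
-ᵖ p = List.map (λ a → ℤ.- a) p

_*ᵖ_ : Poly → Poly → Poly
[]      *ᵖ q = []
(a ∷ p) *ᵖ q = List.map (a ℤ.*_) q +ᵖ (0ℤ ∷ p *ᵖ q)

NonZeroᵖ : Poly → Set
NonZeroᵖ p = ∃ λ n → coeff p n ≢ 0ℤ

coeff-+ : ∀ p q n → coeff (p +ᵖ q) n ≡ coeff p n ℤ.+ coeff q n
coeff-+ []      q       n       = sym (ℤ.+-identityˡ _)
coeff-+ (a ∷ p) []      n       = sym (ℤ.+-identityʳ _)
coeff-+ (a ∷ p) (b ∷ q) zero    = refl
coeff-+ (a ∷ p) (b ∷ q) (suc n) = coeff-+ p q n

coeff-map : ∀ a q n → coeff (List.map (a ℤ.*_) q) n ≡ a ℤ.* coeff q n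
coeff-map a []      n       = sym (ℤ.*-zeroʳ a)
coeff-map a (b ∷ q) zero    = refl
coeff-map a (b ∷ q) (suc n) = coeff-map a q n

coeff-* : ∀ a p q n → coeff ((a ∷ p) *ᵖ q) n ≡
          a ℤ.* coeff q n ℤ.+ coeff (0ℤ ∷ p *ᵖ q) n
coeff-* a p q n = trans (coeff-+ (List.map (a ℤ.*_) q) _ n)
  (cong (ℤ._+ coeff (0ℤ ∷ p *ᵖ q) n) (coeff-map a q n))

coeff-*-0∷ : ∀ p q n → coeff (p *ᵖ (0ℤ ∷ q)) n ≡ coeff (0ℤ ∷ p *ᵖ q) n
coeff-*-0∷ []      q zero    = refl
coeff-*-0∷ []      q (suc n) = refl
coeff-*-0∷ (a ∷ p) q zero    = trans (ℤ.+-identityʳ _) (ℤ.*-zeroʳ a)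
coeff-*-0∷ (a ∷ p) q (suc n) = trans (coeff-* a p (0ℤ ∷ q) (suc n))
  (trans (cong (ℤ._+_ (a ℤ.* coeff q n)) (coeff-*-0∷ p q n))
         (sym (coeff-* a p q n)))

-- The lowest nonzero coefficients multiply to a nonzero coefficient.
*ᵖ-nonZero : ∀ p q → NonZeroᵖ p → NonZeroᵖ q → NonZeroᵖ (p *ᵖ q)
*ᵖ-nonZero []      q (_ , 0≢0) _ = contradiction refl 0≢0
*ᵖ-nonZero (a ∷ p) q nzp nzq with a ℤ.≟ 0ℤ
*ᵖ-nonZero (a ∷ p) q (zero  , a≢0) nzq | yes a≡0  = contradiction a≡0 a≢0
*ᵖ-nonZero (a ∷ p) q (suc m , p≢0) nzq | yes refl =
  let (n , pq≢0) = *ᵖ-nonZero p q (m , p≢0) nzq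
  in suc n , pq≢0 ∘ trans (sym (trans (coeff-* a p q (suc n)) (ℤ.+-identityˡ _)))
*ᵖ-nonZero (a ∷ p) q nzp (n , q≢0) | no a≢0 = go q n q≢0
  where
  go : ∀ q n → coeff q n ≢ 0ℤ → NonZeroᵖ ((a ∷ p) *ᵖ q)
  go []      n       0≢0 = contradiction refl 0≢0
  go (b ∷ q) zero    b≢0 = zero ,
    [ a≢0 , b≢0 ]′ ∘ ℤ.i*j≡0⇒i≡0∨j≡0 a ∘ trans (sym (ℤ.+-identityʳ _))
  go (b ∷ q) (suc n) q≢0 with b ℤ.≟ 0ℤ
  ... | no  b≢0  = go (b ∷ q) zero b≢0
  ... | yes refl = let (m , pq≢0) = go q n q≢0
    in suc m , pq≢0 ∘ trans (sym (coeff-*-0∷ (a ∷ p) q (suc m)))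

------------------------------------------------------------------------
-- Rational functions in x, as unnormalised fractions

record RatFun : Set where
  no-eta-equality
  constructor mkRatFun
  field
    num   : Poly
    den   : Poly
    den≢0 : NonZeroᵖ den

open RatFun public

record NonZero (f : RatFun) : Set where
  constructor mkNonZero
  field nonZero : NonZeroᵖ (num f)

open NonZero public

infixl 6 _+_ _-_
infixl 7 _*_ _/_

_+_ : RatFun → RatFun → RatFun
num   (f + g) = num f *ᵖ den g +ᵖ num g *ᵖ den f
den   (f + g) = den f *ᵖ den g
den≢0 (f + g) = *ᵖ-nonZero (den f) (den g) (den≢0 f) (den≢0 g)

_-_ : RatFun → RatFun → RatFun
num   (f - g) = num f *ᵖ den g +ᵖ (-ᵖ (num g *ᵖ den f))
den   (f - g) = den f *ᵖ den g
den≢0 (f - g) = *ᵖ-nonZero (den f) (den g) (den≢0 f) (den≢0 g)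

_*_ : RatFun → RatFun → RatFun
num   (f * g) = num f *ᵖ num g
den   (f * g) = den f *ᵖ den g
den≢0 (f * g) = *ᵖ-nonZero (den f) (den g) (den≢0 f) (den≢0 g)

_/_ : (f g : RatFun) {{_ : NonZero g}} → RatFun
num   (f / g) = num f *ᵖ den g
den   (f / g) = den f *ᵖ num g
den≢0 ((f / g) {{nz}}) =
  *ᵖ-nonZero (den f) (num g) (den≢0 f) (nonZero nz)

polynomial : Poly → RatFun
polynomial p = mkRatFun p (1ℤ ∷ []) (0 , λ ())

0# 1# 2# x : RatFun
0# = polynomial []
1# = polynomial (1ℤ ∷ [])
2# = polynomial (+ 2 ∷ [])
x  = polynomial (0ℤ ∷ 1ℤ ∷ [])

-- Σ[ m ] f is f 0 + … + f (m - 1).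
Σ[_] : ℕ → (ℕ → RatFun) → RatFun
Σ[ zero ] f = 0#
Σ[ suc m ] f = Σ[ m ] f + f m

instance
  x-nonZero : NonZero x
  x-nonZero = mkNonZero (1 , λ ())

  2#-nonZero : NonZero 2#
  2#-nonZero = mkNonZero (0 , λ ())

  *-nonZero : ∀ {f g} {{_ : NonZero f}} {{_ : NonZero g}} → NonZero (f * g)
  *-nonZero {f} {g} {{nf}} {{ng}} =
    mkNonZero (*ᵖ-nonZero (num f) (num g) (nonZero nf) (nonZero ng))

t : RatFun
t = 1# / (2# * x)

-- The product of the polynomial p and the power series F.
_⊛_ : Poly → (ℕ → ℤ) → (ℕ → ℤ)
([]      ⊛ F) n       = 0ℤ
((a ∷ p) ⊛ F) zero    = a ℤ.* F zero
((a ∷ p) ⊛ F) (suc n) = a ℤ.* F (suc n) ℤ.+ (p ⊛ F) n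

-- The power series F is the expansion of f = P / Q when Q F = P.  As Q ≢ 0,
-- there is at most one such F.
_IsExpansionOf_ : (ℕ → ℤ) → RatFun → Set
F IsExpansionOf f = ∀ n → (den f ⊛ F) n ≡ coeff (num f) n

-- Σ aₙ xⁿ for a sequence of natural numbers
generatingFunction : (ℕ → ℕ) → (ℕ → ℤ)
generatingFunction a n = + a n

------------------------------------------------------------------------
-- Chebyshev polynomials of the second kind

-- The recurrence U r + U (r - 2) = 2 cos θ · U (r - 1) is the addition
-- formula sin ((r + 1) θ) + sin ((r - 1) θ) = 2 cos θ sin (r θ).  It holds for
-- all integers r, and sin (- θ) = - sin θ gives U (- r - 2) = - U r.
chebyshev₊ : ℕ → RatFun → RatFun
chebyshev₊ zero          z = 1#
chebyshev₊ (suc zero)    z = 2# * z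
chebyshev₊ (suc (suc r)) z = 2# * z * chebyshev₊ (suc r) z - chebyshev₊ r z

chebyshev : ℤ → RatFun → RatFun
chebyshev (+ r)        z = chebyshev₊ r z
chebyshev -[1+ zero ]  z = 0#
chebyshev -[1+ suc r ] z = 0# - chebyshev₊ r z

-- The same fraction as chebyshev r z; U r z does not reduce unless projected
-- from, which lets instance search read r off NonZero (U r z).
U : ℤ → RatFun → RatFun
num   (U r z) = num (chebyshev r z)
den   (U r z) = den (chebyshev r z)
den≢0 (U r z) = den≢0 (chebyshev r z)

-- At x = 2, 2ʳ U r t is an integer congruent to 1 modulo 4, so that neither
-- U r t nor U r t - U (r - 1) t vanishes when r ≥ 0.
private
  eval : Poly → ℤ
  eval []      = 0ℤ
  eval (a ∷ p) = a ℤ.+ + 2 ℤ.* eval p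

  open +-*-Solver

  eval-+ : ∀ p q → eval (p +ᵖ q) ≡ eval p ℤ.+ eval q
  eval-+ []      q       = sym (ℤ.+-identityˡ _)
  eval-+ (a ∷ p) []      = sym (ℤ.+-identityʳ _)
  eval-+ (a ∷ p) (b ∷ q) rewrite eval-+ p q = solve 4
    (λ a b p q → a :+ b :+ con (+ 2) :* (p :+ q) :=
                 (a :+ con (+ 2) :* p) :+ (b :+ con (+ 2) :* q))
    refl a b (eval p) (eval q)

  eval-neg : ∀ p → eval (-ᵖ p) ≡ ℤ.- eval p
  eval-neg []      = refl
  eval-neg (a ∷ p) rewrite eval-neg p = solve 2
    (λ a p → :- a :+ con (+ 2) :* (:- p) := :- (a :+ con (+ 2) :* p))
    refl a (eval p)

  eval-map : ∀ a q → eval (List.map (a ℤ.*_) q) ≡ a ℤ.* eval q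
  eval-map a []      = sym (ℤ.*-zeroʳ a)
  eval-map a (b ∷ q) rewrite eval-map a q = solve 3
    (λ a b q → a :* b :+ con (+ 2) :* (a :* q) := a :* (b :+ con (+ 2) :* q))
    refl a b (eval q)

  eval-* : ∀ p q → eval (p *ᵖ q) ≡ eval p ℤ.* eval q
  eval-* []      q = refl
  eval-* (a ∷ p) q
    rewrite eval-+ (List.map (a ℤ.*_) q) (0ℤ ∷ p *ᵖ q)
          | eval-map a q | eval-* p q = solve 3
    (λ a p q → a :* q :+ (con 0ℤ :+ con (+ 2) :* (p :* q)) :=
               (a :+ con (+ 2) :* p) :* q)
    refl a (eval p) (eval q)

  eval-nonZero : ∀ p → eval p ≢ 0ℤ → NonZeroᵖ p
  eval-nonZero []      ≢0 = contradiction refl ≢0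
  eval-nonZero (a ∷ p) ≢0 with a ℤ.≟ 0ℤ
  ... | no  a≢0  = zero , a≢0
  ... | yes refl = let (n , p≢0) = eval-nonZero p λ eq →
                         ≢0 (cong (λ z → 0ℤ ℤ.+ + 2 ℤ.* z) eq)
                   in suc n , p≢0

  *-≢0 : ∀ {i j} → i ≢ 0ℤ → j ≢ 0ℤ → i ℤ.* j ≢ 0ℤ
  *-≢0 {i} i≢0 j≢0 = [ i≢0 , j≢0 ]′ ∘ ℤ.i*j≡0⇒i≡0∨j≡0 i

  -- f takes the value v / e at x = 2.
  record Value (f : RatFun) (v e : ℤ) : Set where
    constructor mkValue
    field
      value : eval (num f) ℤ.* e ≡ v ℤ.* eval (den f)
      den₂  : eval (den f) ≢ 0ℤ

  value-nonZero : ∀ {f v e} → Value f v e → v ≢ 0ℤ → NonZero f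
  value-nonZero {f} {v} {e} (mkValue eq d≢0) v≢0 = mkNonZero
    (eval-nonZero (num f) λ n≡0 → *-≢0 v≢0 d≢0
      (trans (sym eq) (cong (ℤ._* e) n≡0)))

  value-* : ∀ {f g v w e h} → Value f v e → Value g w h →
            Value (f * g) (v ℤ.* w) (e ℤ.* h)
  value-* {f} {g} {v} {w} {e} {h} (mkValue p d) (mkValue q d′) = mkValue eq
    (λ z → *-≢0 d d′ (trans (sym (eval-* (den f) (den g))) z))
    where
    eq : eval (num f *ᵖ num g) ℤ.* (e ℤ.* h) ≡
         v ℤ.* w ℤ.* eval (den f *ᵖ den g)
    eq rewrite eval-* (num f) (num g) | eval-* (den f) (den g) = trans
      (solve 4 (λ a b c d → a :* b :* (c :* d) := a :* c :* (b :* d)) refl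
        (eval (num f)) (eval (num g)) e h)
      (trans (cong₂ ℤ._*_ p q)
      (solve 4 (λ a b c d → a :* b :* (c :* d) := a :* c :* (b :* d)) refl
        v (eval (den f)) w (eval (den g))))

  value-- : ∀ {f g v w e} → Value f v e → Value g w e →
            Value (f - g) (v ℤ.- w) e
  value-- {f} {g} {v} {w} {e} (mkValue p d) (mkValue q d′) = mkValue eq
    (λ z → *-≢0 d d′ (trans (sym (eval-* (den f) (den g))) z))
    where
    eq : eval (num f *ᵖ den g +ᵖ (-ᵖ (num g *ᵖ den f))) ℤ.* e ≡
         (v ℤ.- w) ℤ.* eval (den f *ᵖ den g)
    eq rewrite eval-+ (num f *ᵖ den g) (-ᵖ (num g *ᵖ den f))
             | eval-neg (num g *ᵖ den f) | eval-* (num f) (den g)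
             | eval-* (num g) (den f) | eval-* (den f) (den g) = trans
      (solve 5 (λ a b c d e → (a :* d :+ (:- (c :* b))) :* e :=
                              a :* e :* d :+ (:- (c :* e :* b))) refl
        (eval (num f)) (eval (den f)) (eval (num g)) (eval (den g)) e)
      (trans (cong₂ (λ y z → y ℤ.* eval (den g) ℤ.- z ℤ.* eval (den f)) p q)
      (solve 4 (λ v b w d → v :* b :* d :+ (:- (w :* d :* b)) :=
                            (v :+ (:- w)) :* (b :* d)) refl
        v (eval (den f)) w (eval (den g))))

  value-scale : ∀ {f v e} c → Value f v e → Value f (c ℤ.* v) (c ℤ.* e)
  value-scale {f} {v} {e} c (mkValue p d) = mkValue
    (trans (solve 3 (λ a c e → a :* (c :* e) := c :* (a :* e)) refl
             (eval (num f)) c e)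
    (trans (cong (c ℤ.*_) p) (sym (ℤ.*-assoc c v (eval (den f)))))) d

  value-cong : ∀ {f v w e h} → v ≡ w → e ≡ h → Value f v e → Value f w h
  value-cong refl refl val = val

  pow : ℕ → ℤ
  pow zero    = 1ℤ
  pow (suc r) = + 2 ℤ.* pow r

  -- U r t = (1 + 4 uᵣ) / 2ʳ at x = 2.
  u : ℕ → ℤ
  u zero          = 0ℤ
  u (suc zero)    = 0ℤ
  u (suc (suc r)) = u (suc r) ℤ.- (1ℤ ℤ.+ + 4 ℤ.* u r)

  value-2t : Value (2# * t) 1ℤ (+ 2)
  value-2t = mkValue refl λ ()

  value-U : ∀ r → Value (chebyshev₊ r t) (1ℤ ℤ.+ + 4 ℤ.* u r) (pow r)
  value-U zero          = mkValue refl λ ()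
  value-U (suc zero)    = mkValue refl λ ()
  value-U (suc (suc r)) = value-cong
    (solve 2 (λ a b → con 1ℤ :* (con 1ℤ :+ con (+ 4) :* a)
                      :+ (:- (con (+ 4) :* (con 1ℤ :+ con (+ 4) :* b)))
             := con 1ℤ :+ con (+ 4) :*
                  (a :+ (:- (con 1ℤ :+ con (+ 4) :* b)))) refl
      (u (suc r)) (u r))
    refl
    (value-- (value-* value-2t (value-U (suc r)))
      (value-cong refl
        (solve 1 (λ a → con (+ 4) :* a := con (+ 2) :* (con (+ 2) :* a)) refl
          (pow r))
        (value-scale (+ 4) (value-U r))))

  odd≢0 : ∀ c → 1ℤ ℤ.+ + 2 ℤ.* c ≢ 0ℤ
  odd≢0 (+ zero)     ()
  odd≢0 (+ suc c)    ()
  odd≢0 -[1+ zero ]  ()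
  odd≢0 -[1+ suc c ] ()

  value-odd : ∀ {f v e} c → v ≡ 1ℤ ℤ.+ + 2 ℤ.* c → Value f v e → NonZero f
  value-odd c eq val = value-nonZero val (odd≢0 c ∘ trans (sym eq))

instance
  U-nonZero : ∀ {r} → NonZero (U (+ r) t)
  U-nonZero {r} = mkNonZero (nonZero (value-odd (+ 2 ℤ.* u r)
    (solve 1 (λ a → con 1ℤ :+ con (+ 4) :* a :=
                    con 1ℤ :+ con (+ 2) :* (con (+ 2) :* a)) refl (u r))
    (value-U r)))

  U-U-nonZero : ∀ {r} → NonZero (U (+ r) t - U (+ r ℤ.- 1ℤ) t)
  U-U-nonZero {zero}  = mkNonZero (0 , λ ())
  U-U-nonZero {suc r} = mkNonZero (nonZero (value-odd
    (+ 2 ℤ.* u (suc r) ℤ.- (1ℤ ℤ.+ + 4 ℤ.* u r))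
    (solve 2 (λ a b → con 1ℤ :+ con (+ 4) :* a
                      :+ (:- (con (+ 2) :* (con 1ℤ :+ con (+ 4) :* b)))
             := con 1ℤ :+ con (+ 2) :* (con (+ 2) :* a
                  :+ (:- (con 1ℤ :+ con (+ 4) :* b)))) refl
      (u (suc r)) (u r))
    (value-- (value-U (suc r)) (value-scale (+ 2) (value-U r)))))

{-# OPTIONS --safe #-}

-- Cutting a permutation at its maximum shows that the permutations avoiding 132
-- are built from the empty one by (l, r) ↦ (l ⊕ 1) ⊖ r.  An involution avoiding
-- 132 is empty, or γ ⊕ 1, or (β ⊕ 1) ⊖ γ ⊖ (β⁻¹ ⊕ 1) with γ another such
-- involution and β any permutation avoiding 132.
--
-- Let c = k - d ≥ d, and let h be the length of the longest increasing
-- subsequence of β ⊕ 1.  The third involution avoids [k, d] if and only if h < c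
-- and either h < d and γ avoids [k, d], or h ≥ d and γ avoids 1 2 … c; the first
-- two do so if γ does.  With Aₘ and Bₘ the series of the permutations (in x²) and
-- the involutions (in x) that avoid 132 and 1 2 … m, this gives
--
--   Aₘ₊₁ = 1 + x² Aₘ Aₘ₊₁,   Bₘ₊₁ = 1 + x Bₘ + x² Aₘ Bₘ₊₁,
--   G = 1 + x G + x² (A_{d-1} G + (A_{c-1} - A_{d-1}) B_c)
--
-- for the series G of the theorem.  The first two equations are solved by
-- Aₘ = Uₘ₋₁ / (x Uₘ) and Bₘ = (U₀ + … + Uₘ₋₁) / (x Uₘ) at t = 1 / 2x, and then the
-- third one is linear in G.
module Submission where

open import Data.Integer as ℤ using (ℤ; 0ℤ; 1ℤ)
import Data.Integer.Properties as ℤ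
open import Data.Nat as ℕ using (ℕ; zero; suc; _∸_; _≤_)
import Data.Nat.Properties as ℕ
open import Data.Product using (_,_)
open import Function using (_∘_)
open import Level using (0ℓ)
open import Relation.Binary.PropositionalEquality
  using (_≡_; refl; sym; trans; cong; cong₂; subst; subst₂)
import Defs

-- The criterion for the third involution rests on one fact: an increasing subsequence of a skew sum
-- stays inside one summand. The two outer summands are inverse to each other, so their longest
-- increasing subsequences have the same length h. If h ≥ c, they hold both runs of [k, d], since d
-- ≤ c. If h < c, the run of length c must lie in γ; the run of length d then lies in γ too, or in
-- the last summand, which has room for it exactly when h ≥ d. The point added in γ ⊕ 1 belongs to
-- no occurrence, because it has nothing above it or to its right.
--
-- The obstacle on the algebraic side is that Uᵣ(t) is not a power series in x. The computation
-- therefore takes place among the polynomials xʳ Uᵣ(t), and a quotient is replaced by a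
-- multiplied-out equation. The factors to be cancelled are then only powers of x and series with
-- constant term 1.

-- Formal power series over ℤ.

module PowerSeries where
  open import Data.Integer using (+_)
  open import Algebra.Bundles using (CommutativeRing)
  open import Data.Integer.Solver using (module +-*-Solver)
  import Data.Nat.Induction as ℕ
  open import Algebra.Solver.Ring.AlmostCommutativeRing
    using (fromCommutativeRing; _-Raw-AlmostCommutative⟶_)
  import Algebra.Solver.Ring
  open import Data.Maybe as Maybe using (Maybe)
  open import Relation.Nullary.Decidable using (dec⇒maybe)
  open import Algebra.Properties.AbelianGroup ℤ.+-0-abelianGroup using (∙-cancelʳ)
  open +-*-Solver renaming (solve to solveℤ)
    using (_:+_; _:*_; _:=_)

  Series : Set
  Series = ℕ → ℤ

  infix 4 _≈_
  -- A record and not a bare family of equations, so that unification can recover `F` and `G` from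
  -- the type of a proof.
  record _≈_ (F G : Series) : Set where
    constructor pointwise
    field at : ∀ n → F n ≡ G n
  open _≈_ public

  infixl 6 _+_
  infixl 7 _*_
  infix  8 -_

  -- The Cauchy product, by recursion on `F = F 0 + x (F ∘ suc)`. `_*ᵖ_` and `_⊛_` recurse in the
  -- same way on coefficient lists, and `convolution` on listings, so each is compared with `_*_` by
  -- a direct induction.
  _+_ _*_ : Series → Series → Series
  (F + G) n       = F n ℤ.+ G n
  (F * G) zero    = F 0 ℤ.* G 0
  (F * G) (suc n) = F 0 ℤ.* G (suc n) ℤ.+ ((F ∘ suc) * G) n

  -_ : Series → Series
  (- F) n = ℤ.- F n

  constant : ℤ → Series
  constant a zero    = a
  constant a (suc n) = 0ℤ

  *-cong : ∀ {F F′ G G′} → F ≈ F′ → G ≈ G′ → F * G ≈ F′ * G′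
  *-cong p q = pointwise (go p q)
    where
    go : ∀ {F F′ G G′} → F ≈ F′ → G ≈ G′ → ∀ n → (F * G) n ≡ (F′ * G′) n
    go p q zero    = cong₂ ℤ._*_ (at p 0) (at q 0)
    go p q (suc n) = cong₂ ℤ._+_ (cong₂ ℤ._*_ (at p 0) (at q (suc n)))
                                 (go (pointwise (at p ∘ suc)) q n)

  *-distribʳ : ∀ F G H n → ((F + G) * H) n ≡ (F * H + G * H) n
  *-distribʳ F G H zero    = ℤ.*-distribʳ-+ (H 0) (F 0) (G 0)
  *-distribʳ F G H (suc n)
    rewrite *-distribʳ (F ∘ suc) (G ∘ suc) H n = solveℤ 5
    (λ f g h a b → (f :+ g) :* h :+ (a :+ b) :=
                   (f :* h :+ a) :+ (g :* h :+ b)) refl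
    (F 0) (G 0) (H (suc n)) (((F ∘ suc) * H) n) (((G ∘ suc) * H) n)

  -- The definition peels off the left factor, this lemma the right one. Commutativity holds because
  -- the two expansions mirror each other.
  *-sucʳ : ∀ F G n → (F * G) (suc n) ≡ (F * (G ∘ suc)) n ℤ.+ F (suc n) ℤ.* G 0
  *-sucʳ F G zero    = refl
  *-sucʳ F G (suc n) rewrite *-sucʳ (F ∘ suc) G n = sym (ℤ.+-assoc
    (F 0 ℤ.* G (2 ℕ.+ n)) (((F ∘ suc) * (G ∘ suc)) n) (F (2 ℕ.+ n) ℤ.* G 0))

  *-comm : ∀ F G n → (F * G) n ≡ (G * F) n
  *-comm F G zero    = ℤ.*-comm (F 0) (G 0)
  *-comm F G (suc n)
    rewrite *-sucʳ G F n | *-comm (F ∘ suc) G n =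
    trans (cong (ℤ._+ (G * (F ∘ suc)) n) (ℤ.*-comm (F 0) (G (suc n))))
          (ℤ.+-comm (G (suc n) ℤ.* F 0) _)

  *-distribˡ : ∀ F G H n → (F * (G + H)) n ≡ (F * G + F * H) n
  *-distribˡ F G H n
    rewrite *-comm F (G + H) n | *-comm F G n | *-comm F H n =
    *-distribʳ G H F n

  scale-* : ∀ a F G n → ((λ i → a ℤ.* F i) * G) n ≡ a ℤ.* (F * G) n
  scale-* a F G zero    = ℤ.*-assoc a (F 0) (G 0)
  scale-* a F G (suc n) rewrite scale-* a (F ∘ suc) G n = solveℤ 4
    (λ a f g h → a :* f :* g :+ a :* h := a :* (f :* g :+ h)) refl
    a (F 0) (G (suc n)) (((F ∘ suc) * G) n)

  *-assoc : ∀ F G H n → ((F * G) * H) n ≡ (F * (G * H)) n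
  *-assoc F G H zero    = ℤ.*-assoc (F 0) (G 0) (H 0)
  *-assoc F G H (suc n)
    rewrite *-distribʳ (λ i → F 0 ℤ.* G (suc i)) ((F ∘ suc) * G) H n
          | scale-* (F 0) (G ∘ suc) H n | *-assoc (F ∘ suc) G H n = solveℤ 5
    (λ f g h a b → f :* g :* h :+ (f :* a :+ b) := f :* (g :* h :+ a) :+ b) refl
    (F 0) (G 0) (H (suc n)) (((G ∘ suc) * H) n) (((F ∘ suc) * (G * H)) n)

  *-zeroˡ : ∀ F G → (∀ n → F n ≡ 0ℤ) → ∀ n → (F * G) n ≡ 0ℤ
  *-zeroˡ F G F≡0 zero    rewrite F≡0 0 = refl
  *-zeroˡ F G F≡0 (suc n)
    rewrite F≡0 0 | *-zeroˡ (F ∘ suc) G (F≡0 ∘ suc) n = refl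

  constant-* : ∀ a F n → (constant a * F) n ≡ a ℤ.* F n
  constant-* a F zero    = refl
  constant-* a F (suc n) rewrite *-zeroˡ (λ _ → 0ℤ) F (λ _ → refl) n =
    ℤ.+-identityʳ _

  *-identityˡ : ∀ F n → (constant 1ℤ * F) n ≡ F n
  *-identityˡ F n = trans (constant-* 1ℤ F n) (ℤ.*-identityˡ (F n))

  constant-0 : ∀ n → constant 0ℤ n ≡ 0ℤ
  constant-0 zero    = refl
  constant-0 (suc n) = refl

  commutativeRing : CommutativeRing 0ℓ 0ℓ
  commutativeRing = record
    { Carrier = Series ; _≈_ = _≈_ ; _+_ = _+_ ; _*_ = _*_ ; -_ = -_
    ; 0# = constant 0ℤ ; 1# = constant 1ℤ
    ; isCommutativeRing = record
      { isRing = record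
        { +-isAbelianGroup = record
          { isGroup = record
            { isMonoid = record
              { isSemigroup = record
                { isMagma = record
                  { isEquivalence = record
                    { refl  = pointwise λ _ → refl
                    ; sym   = λ p → pointwise λ n → sym (at p n)
                    ; trans = λ p q → pointwise λ n → trans (at p n) (at q n)
                    }
                  ; ∙-cong = λ p q → pointwise λ n →
                      cong₂ ℤ._+_ (at p n) (at q n)
                  }
                ; assoc = λ F G H → pointwise λ n → ℤ.+-assoc (F n) (G n) (H n)
                }
              ; identity =
                  (λ F → pointwise λ n → trans
                    (cong (ℤ._+ F n) (constant-0 n)) (ℤ.+-identityˡ (F n)))
                , (λ F → pointwise λ n → trans
                    (cong (ℤ._+_ (F n)) (constant-0 n)) (ℤ.+-identityʳ (F n)))
              }
            ; inverse =
                (λ F → pointwise λ n → trans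
                  (ℤ.+-inverseˡ (F n)) (sym (constant-0 n)))
              , (λ F → pointwise λ n → trans
                  (ℤ.+-inverseʳ (F n)) (sym (constant-0 n)))
            ; ⁻¹-cong = λ p → pointwise λ n → cong (ℤ.-_) (at p n)
            }
          ; comm = λ F G → pointwise λ n → ℤ.+-comm (F n) (G n)
          }
        ; *-cong = *-cong
        ; *-assoc = λ F G H → pointwise (*-assoc F G H)
        ; *-identity =
            (λ F → pointwise (*-identityˡ F))
          , (λ F → pointwise λ n →
              trans (*-comm F (constant 1ℤ) n) (*-identityˡ F n))
        ; distrib = (λ F G H → pointwise (*-distribˡ F G H))
                  , (λ F G H → pointwise (*-distribʳ G H F))
        }
      ; *-comm = λ F G → pointwise (*-comm F G)
      }
    }

  constant-homomorphism :
    ℤ.+-*-rawRing -Raw-AlmostCommutative⟶ fromCommutativeRing commutativeRing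
  constant-homomorphism = record
    { ⟦_⟧ = constant
    ; +-homo = λ a b → pointwise λ { zero → refl ; (suc n) → refl }
    ; *-homo = λ a b → pointwise λ
        { zero → refl
        ; (suc n) → sym (trans (constant-* a (constant b) (suc n)) (ℤ.*-zeroʳ a)) }
    ; -‿homo = λ a → pointwise λ { zero → refl ; (suc n) → refl }
    ; 0-homo = pointwise λ _ → refl
    ; 1-homo = pointwise λ _ → refl
    }

  constant-≟ : ∀ a b → Maybe (constant a ≈ constant b)
  constant-≟ a b = Maybe.map (λ { refl → pointwise λ _ → refl }) (dec⇒maybe (a ℤ.≟ b))

  -- The scalars are integers embedded by `constant`, so numerals and vanishing terms are settled by
  -- computation in ℤ.
  module Solver = Algebra.Solver.Ring ℤ.+-*-rawRing
    (fromCommutativeRing commutativeRing) constant-homomorphism constant-≟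

  -- Takes the place of being nonzero: it is closed under products and easy to establish for the few
  -- factors that occur.
  Cancellable : Series → Set
  Cancellable Q = ∀ F G → Q * F ≈ Q * G → F ≈ G

  X : Series
  X zero          = 0ℤ
  X (suc zero)    = 1ℤ
  X (suc (suc n)) = 0ℤ

  X*-suc : ∀ F n → (X * F) (suc n) ≡ F n
  X*-suc F n = trans (ℤ.+-identityˡ _) (trans
    (at (*-cong {X ∘ suc} {constant 1ℤ} {F}
           (pointwise λ { zero → refl ; (suc _) → refl })
           (pointwise λ _ → refl)) n)
    (*-identityˡ F n))

  cancellable-X : Cancellable X
  cancellable-X F G p = pointwise λ n →
    trans (sym (X*-suc F n)) (trans (at p (suc n)) (X*-suc G n))

  cancellable-* : ∀ {P Q} → Cancellable P → Cancellable Q → Cancellable (P * Q)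
  cancellable-* {P} {Q} cP cQ F G p = cQ F G (cP (Q * F) (Q * G)
    (pointwise λ n → trans (sym (*-assoc P Q F n))
                    (trans (at p n) (*-assoc P Q G n))))

  -- Coefficient `n` of `Q * F` is `F n` plus a combination of the earlier coefficients of `F`, so
  -- strong induction recovers `F`.
  cancellable-unit : ∀ {Q} → Q 0 ≡ 1ℤ → Cancellable Q
  cancellable-unit {Q} Q₀≡1 F G p = pointwise (ℕ.<-rec _ step)
    where
    agree-below : ∀ R n → (∀ i → i ℕ.≤ n → F i ≡ G i) → (R * F) n ≡ (R * G) n
    agree-below R zero    h = cong (ℤ._*_ (R 0)) (h 0 ℕ.z≤n)
    agree-below R (suc n) h = cong₂ ℤ._+_
      (cong (ℤ._*_ (R 0)) (h (suc n) ℕ.≤-refl))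
      (agree-below (R ∘ suc) n λ i i≤n → h i (ℕ.m≤n⇒m≤1+n i≤n))

    one* : ∀ a → Q 0 ℤ.* a ≡ a
    one* a rewrite Q₀≡1 = ℤ.*-identityˡ a

    step : ∀ n → (∀ {i} → i ℕ.< n → F i ≡ G i) → F n ≡ G n
    step zero    h = trans (sym (one* (F 0))) (trans (at p 0) (one* (G 0)))
    step (suc n) h = trans (sym (one* _)) (trans
      (∙-cancelʳ _ (Q 0 ℤ.* F (suc n)) (Q 0 ℤ.* G (suc n)) (trans
        (at p (suc n))
        (cong (ℤ._+_ (Q 0 ℤ.* G (suc n)))
              (sym (agree-below (Q ∘ suc) n λ i i≤n → h (ℕ.s≤s i≤n))))))
      (one* _))

-- Chebyshev polynomials at 1/2x without denominators, and the solution of the functional equations.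

module ReducedChebyshev where
  open PowerSeries
  open import Algebra.Bundles using (CommutativeRing)
  open CommutativeRing commutativeRing
    using (setoid; +-cong; +-congˡ; +-congʳ; *-congˡ; *-congʳ; -‿cong; semiring; zeroʳ)
    renaming (refl to ≈-refl; trans to ≈-trans)
  open import Algebra.Properties.Semiring.Exp semiring using (_^_)
  open import Relation.Binary.Reasoning.Setoid setoid
  open Solver using (solve; con; _:+_; _:*_; _:-_; _:=_)

  -- p (r + 1) = xʳ U r (1 / 2x)
  p : ℕ → Series
  p zero          = constant 0ℤ
  p (suc zero)    = constant 1ℤ
  p (suc (suc r)) = p (suc r) + - (X * X * p r)

  -- s m = x^(m - 1) times the sum of U j (1 / 2x) over j < m
  s : ℕ → Series
  s zero    = constant 0ℤ
  s (suc m) = X * s m + p (suc m)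

  -- The constant term of `xʳ U r (1 / 2x)` is the leading coefficient `2ʳ` of `U r` divided by
  -- `2ʳ`. It makes every denominator below cancellable.
  p₀≡1 : ∀ r → p (suc r) 0 ≡ 1ℤ
  p₀≡1 zero    = refl
  p₀≡1 (suc r) = trans (ℤ.+-identityʳ _) (p₀≡1 r)

  -- The identity U d U (d + e - 1) - U (d - 1) U (d + e) = U (e - 1).
  p-determinant : ∀ d e → p (suc d) * p (d ℕ.+ e) + - (p d * p (suc (d ℕ.+ e))) ≈
                  X ^ d * X ^ d * p e
  p-determinant zero    e = solve 2 (λ a b →
    con 1ℤ :* a :- con 0ℤ :* b := con 1ℤ :* con 1ℤ :* a)
    ≈-refl (p e) (p (suc e))
  p-determinant (suc d) e = begin
    (b + - (X * X * a)) * b′ + - (b * (b′ + - (X * X * a′)))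
      ≈⟨ solve 5 (λ x a b a′ b′ →
           (b :- x :* x :* a) :* b′ :- b :* (b′ :- x :* x :* a′) :=
           x :* x :* (b :* a′ :- a :* b′)) ≈-refl X a b a′ b′ ⟩
    X * X * (b * a′ + - (a * b′))
      ≈⟨ *-congˡ {X * X} (p-determinant d e) ⟩
    X * X * (X ^ d * X ^ d * p e)
      ≈⟨ solve 3 (λ x y z → x :* x :* (y :* y :* z) := x :* y :* (x :* y) :* z)
           ≈-refl X (X ^ d) (p e) ⟩
    X ^ suc d * X ^ suc d * p e ∎
    where a = p d ; b = p (suc d) ; a′ = p (d ℕ.+ e) ; b′ = p (suc (d ℕ.+ e))

  module _ {A : ℕ → Series} (A₀ : A 0 ≈ constant 0ℤ)
           (A₊ : ∀ m → A (suc m) ≈ constant 1ℤ + X * X * (A m * A (suc m)))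
    where

    -- `A₊` is linear in `A (suc m)`. Substituting it once, in the product with `p (suc m)`, leaves
    -- `p (suc m)` plus a multiple of `p (suc m) * A m - p m`, which vanishes by induction.
    p*A : ∀ m → p (suc m) * A m ≈ p m
    p*A zero    = ≈-trans (*-congˡ {p 1} A₀) (zeroʳ (p 1))
    p*A (suc m) = begin
      (p₁ + - (X * X * p m)) * A′
        ≈⟨ solve 4 (λ x a b c → (b :- x :* x :* a) :* c := b :* c :- x :* x :* a :* c)
             ≈-refl X (p m) p₁ A′ ⟩
      p₁ * A′ + - (X * X * p m * A′)
        ≈⟨ +-congʳ (*-congˡ {p₁} (A₊ m)) ⟩
      p₁ * (constant 1ℤ + X * X * (A m * A′)) + - (X * X * p m * A′)
        ≈⟨ solve 5 (λ x a b c d →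
             b :* (con 1ℤ :+ x :* x :* (d :* c)) :- x :* x :* a :* c :=
             b :+ x :* x :* c :* (b :* d :- a))
             ≈-refl X (p m) p₁ A′ (A m) ⟩
      p₁ + X * X * A′ * (p₁ * A m + - p m)
        ≈⟨ +-congˡ {p₁} (*-congˡ {X * X * A′} (+-congʳ (p*A m))) ⟩
      p₁ + X * X * A′ * (p m + - p m)
        ≈⟨ solve 4 (λ x a b c → b :+ x :* x :* c :* (a :- a) := b)
             ≈-refl X (p m) p₁ A′ ⟩
      p₁ ∎
      where p₁ = p (suc m) ; A′ = A (suc m)

    module _ {B : ℕ → Series} (B₀ : B 0 ≈ constant 0ℤ)
             (B₊ : ∀ m → B (suc m) ≈
                   constant 1ℤ + X * B m + X * X * (A m * B (suc m)))
      where

      -- The same substitution as for `p*A`. The additional term `X * B m` contributes `X * s m` by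
      -- induction, which is the recursion for `s`, and `p*A` removes the rest.
      p*B : ∀ m → p (suc m) * B m ≈ s m
      p*B zero    = ≈-trans (*-congˡ {p 1} B₀) (zeroʳ (p 1))
      p*B (suc m) = begin
        (p₁ + - (X * X * p m)) * B′
          ≈⟨ solve 4 (λ x a b c → (b :- x :* x :* a) :* c := b :* c :- x :* x :* a :* c)
               ≈-refl X (p m) p₁ B′ ⟩
        p₁ * B′ + - (X * X * p m * B′)
          ≈⟨ +-congʳ (*-congˡ {p₁} (B₊ m)) ⟩
        p₁ * (constant 1ℤ + X * B m + X * X * (A m * B′)) + - (X * X * p m * B′)
          ≈⟨ solve 6 (λ x a b c d e →
               b :* (con 1ℤ :+ x :* e :+ x :* x :* (d :* c)) :- x :* x :* a :* c :=
               x :* (b :* e) :+ b :+ x :* x :* c :* (b :* d :- a))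
               ≈-refl X (p m) p₁ B′ (A m) (B m) ⟩
        X * (p₁ * B m) + p₁ + X * X * B′ * (p₁ * A m + - p m)
          ≈⟨ +-cong (+-congʳ (*-congˡ {X} (p*B m)))
               (*-congˡ {X * X * B′} (+-congʳ (p*A m))) ⟩
        X * s m + p₁ + X * X * B′ * (p m + - p m)
          ≈⟨ solve 5 (λ x a b c e → x :* e :+ b :+ x :* x :* c :* (a :- a) :=
                                    x :* e :+ b)
               ≈-refl X (p m) p₁ B′ (s m) ⟩
        X * s m + p₁ ∎
        where p₁ = p (suc m) ; B′ = B (suc m)

      -- Here c = d + e + 1; in the paper, d is d + 1 and k is c + d + 1.
      closed-form : ∀ d e {G D} → let c = suc (d ℕ.+ e) in
        A d + D ≈ A (d ℕ.+ e) →
        G ≈ constant 1ℤ + X * G + X * X * (A d * G + D * B c) →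
        p c * p (suc c) * (p (2 ℕ.+ d) + - (X * p (suc d))) * G ≈
        p (suc d) * p c * p (suc c) + X ^ suc d * X ^ suc d * p e * s c
      closed-form d e {G} {D} AD G₊ = begin
        p c * p (suc c) * (p₁ + - (X * X * p d) + - (X * p₁)) * G
          ≈⟨ solve 6 (λ x a b c c′ g →
               c :* c′ :* (b :- x :* x :* a :- x :* b) :* g :=
               c :* c′ :* (b :* g :- x :* x :* a :* g :- x :* b :* g))
               ≈-refl X (p d) p₁ (p c) (p (suc c)) G ⟩
        p c * p (suc c) * (p₁ * G + - (X * X * p d * G) + - (X * p₁ * G))
          ≈⟨ *-congˡ {p c * p (suc c)} (+-congʳ (+-congʳ (*-congˡ {p₁} G₊))) ⟩
        p c * p (suc c) * (p₁ * (constant 1ℤ + X * G + X * X * (A d * G + D * B c))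
          + - (X * X * p d * G) + - (X * p₁ * G))
          -- `D` is rewritten as `(A d + D) - A d`, so that `AD` applies to the first part and `p*A`
          -- to the second. The coefficient of `G` that remains is `p₁ * A d - p d`, which is zero.
          ≈⟨ solve 9 (λ x a b c c′ g y z w →
               c :* c′ :* (b :* (con 1ℤ :+ x :* g :+ x :* x :* (y :* g :+ z :* w))
                 :- x :* x :* a :* g :- x :* b :* g) :=
               b :* c :* c′ :+ x :* x :* (
                 c :* c′ :* g :* (b :* y :- a) :+
                 (c :* b :* (y :+ z) :- c :* (b :* y)) :* (c′ :* w)))
               ≈-refl X (p d) p₁ (p c) (p (suc c)) G (A d) D (B c) ⟩
        p₁ * p c * p (suc c) + X * X * (
          p c * p (suc c) * G * (p₁ * A d + - p d) +
          (p c * p₁ * (A d + D) + - (p c * (p₁ * A d))) * (p (suc c) * B c))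
          ≈⟨ +-congˡ {p₁ * p c * p (suc c)} (*-congˡ {X * X} (+-cong
               (*-congˡ {p c * p (suc c) * G} (+-congʳ (p*A d)))
               (*-cong (+-cong (*-congˡ {p c * p₁} AD) (-‿cong (*-congˡ {p c} (p*A d))))
                       (p*B c)))) ⟩
        p₁ * p c * p (suc c) + X * X * (
          p c * p (suc c) * G * (p d + - p d) +
          (p c * p₁ * A (d ℕ.+ e) + - (p c * p d)) * s c)
          ≈⟨ solve 8 (λ x a b c c′ g f s →
               b :* c :* c′ :+ x :* x :* (
                 c :* c′ :* g :* (a :- a) :+
                 (c :* b :* f :- c :* a) :* s) :=
               b :* c :* c′ :+ x :* x :* (b :* (c :* f) :- a :* c) :* s)
               ≈-refl X (p d) p₁ (p c) (p (suc c)) G (A (d ℕ.+ e)) (s c) ⟩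
        p₁ * p c * p (suc c) +
          X * X * (p₁ * (p c * A (d ℕ.+ e)) + - (p d * p c)) * s c
          -- Over the common denominator `p₁ * p c`, the difference of `A (d + e)` and `A d` has the
          -- determinant as its numerator.
          ≈⟨ +-congˡ {p₁ * p c * p (suc c)} (*-congʳ {s c} (*-congˡ {X * X} (≈-trans
               (+-congʳ (*-congˡ {p₁} (p*A (d ℕ.+ e)))) (p-determinant d e)))) ⟩
        p₁ * p c * p (suc c) + X * X * (X ^ d * X ^ d * p e) * s c
          ≈⟨ +-congˡ {p₁ * p c * p (suc c)}
               (solve 4 (λ x y z s → x :* x :* (y :* y :* z) :* s :=
                                     x :* y :* (x :* y) :* z :* s)
               ≈-refl X (X ^ d) (p e) (s c)) ⟩
        p₁ * p c * p (suc c) + X ^ suc d * X ^ suc d * p e * s c ∎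
        where c = suc (d ℕ.+ e) ; p₁ = p (suc d)

-- Rational functions as quotients of power series.

module Fractions where
  open import Data.Integer using (+_)
  open import Data.List using ([]; _∷_)
  open import Defs
    using (RatFun; num; den; NonZero; coeff; coeff-*; coeff-+; _*ᵖ_; -ᵖ_; _⊛_; _IsExpansionOf_;
           1#; 2#; x; t; chebyshev₊; U; Σ[_])
  open PowerSeries
  open ReducedChebyshev
  open import Algebra.Bundles using (CommutativeRing)
  open CommutativeRing commutativeRing
    using (setoid; +-cong; *-congˡ; *-congʳ; -‿cong; semiring)
    renaming (refl to ≈-refl; sym to ≈-sym; trans to ≈-trans)
  open import Algebra.Properties.Semiring.Exp semiring using (_^_; ^-homo-*)
  open import Relation.Binary.Reasoning.Setoid setoid
  open Solver using (solve; con; _:+_; _:*_; _:-_; _:=_; :-_)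

  coeff-*ᵖ : ∀ f g → coeff (f *ᵖ g) ≈ coeff f * coeff g
  coeff-*ᵖ f g = pointwise (go f)
    where
    go : ∀ f n → coeff (f *ᵖ g) n ≡ (coeff f * coeff g) n
    go []      n       = sym (*-zeroˡ (coeff []) (coeff g) (λ _ → refl) n)
    go (a ∷ f) zero    = trans (coeff-* a f g 0) (ℤ.+-identityʳ _)
    go (a ∷ f) (suc n) =
      trans (coeff-* a f g (suc n)) (cong (ℤ._+_ (a ℤ.* coeff g (suc n))) (go f n))

  coeff-+ᵖ : ∀ f g → coeff (f Defs.+ᵖ g) ≈ coeff f + coeff g
  coeff-+ᵖ f g = pointwise (coeff-+ f g)

  coeff-neg : ∀ f → coeff (-ᵖ f) ≈ - coeff f
  coeff-neg f = pointwise (go f)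
    where
    go : ∀ f n → coeff (-ᵖ f) n ≡ ℤ.- coeff f n
    go []      n       = refl
    go (a ∷ f) zero    = refl
    go (a ∷ f) (suc n) = go f n

  ⊛-* : ∀ f F → f ⊛ F ≈ coeff f * F
  ⊛-* f F = pointwise (go f)
    where
    go : ∀ f n → (f ⊛ F) n ≡ (coeff f * F) n
    go []      n       = sym (*-zeroˡ (coeff []) F (λ _ → refl) n)
    go (a ∷ f) zero    = refl
    go (a ∷ f) (suc n) = cong (ℤ._+_ (a ℤ.* F (suc n))) (go f n)

  -- f = P / Q; that Q is nonzero is left to the users.
  infix 4 _is_÷_
  record _is_÷_ (f : RatFun) (P Q : Series) : Set where
    constructor cross
    field cross-multiplied : coeff (num f) * Q ≈ P * coeff (den f)
  open _is_÷_

  private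
    variable
      f g : RatFun
      P Q R S : Series

  is-+ : f is P ÷ Q → g is R ÷ S → f Defs.+ g is P * S + R * Q ÷ Q * S
  is-+ {f} {P} {Q} {g} {R} {S} (cross fPQ) (cross gRS) = cross (begin
    coeff (num f *ᵖ den g Defs.+ᵖ num g *ᵖ den f) * (Q * S)
      ≈⟨ *-congʳ (≈-trans (coeff-+ᵖ (num f *ᵖ den g) (num g *ᵖ den f))
           (+-cong (coeff-*ᵖ (num f) (den g)) (coeff-*ᵖ (num g) (den f)))) ⟩
    (a * d + c * b) * (Q * S)
      ≈⟨ solve 6 (λ a b c d q s →
           (a :* d :+ c :* b) :* (q :* s) := a :* q :* (d :* s) :+ c :* s :* (b :* q))
           ≈-refl a b c d Q S ⟩
    a * Q * (d * S) + c * S * (b * Q)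
      ≈⟨ +-cong (*-congʳ fPQ) (*-congʳ gRS) ⟩
    P * b * (d * S) + R * d * (b * Q)
      ≈⟨ solve 6 (λ p q r s b d →
           p :* b :* (d :* s) :+ r :* d :* (b :* q) := (p :* s :+ r :* q) :* (b :* d))
           ≈-refl P Q R S b d ⟩
    (P * S + R * Q) * (b * d)
      ≈⟨ *-congˡ {P * S + R * Q} (≈-sym (coeff-*ᵖ (den f) (den g))) ⟩
    (P * S + R * Q) * coeff (den f *ᵖ den g) ∎)
    where a = coeff (num f) ; b = coeff (den f) ; c = coeff (num g) ; d = coeff (den g)

  is-* : f is P ÷ Q → g is R ÷ S → f Defs.* g is P * R ÷ Q * S
  is-* {f} {P} {Q} {g} {R} {S} (cross fPQ) (cross gRS) = cross (begin
    coeff (num f *ᵖ num g) * (Q * S)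
      ≈⟨ *-congʳ (coeff-*ᵖ (num f) (num g)) ⟩
    a * c * (Q * S)
      ≈⟨ solve 4 (λ a c q s → a :* c :* (q :* s) := a :* q :* (c :* s))
           ≈-refl a c Q S ⟩
    a * Q * (c * S)
      ≈⟨ *-cong fPQ gRS ⟩
    P * b * (R * d)
      ≈⟨ solve 4 (λ a c q s → a :* c :* (q :* s) := a :* q :* (c :* s))
           ≈-refl P b R d ⟩
    P * R * (b * d)
      ≈⟨ *-congˡ {P * R} (≈-sym (coeff-*ᵖ (den f) (den g))) ⟩
    P * R * coeff (den f *ᵖ den g) ∎)
    where a = coeff (num f) ; b = coeff (den f) ; c = coeff (num g) ; d = coeff (den g)

  is-minus : f is P ÷ Q → g is R ÷ S → f Defs.- g is P * S + - (R * Q) ÷ Q * S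
  is-minus {f} {P} {Q} {g} {R} {S} (cross fPQ) (cross gRS) = cross (begin
    coeff (num f *ᵖ den g Defs.+ᵖ (-ᵖ (num g *ᵖ den f))) * (Q * S)
      ≈⟨ *-congʳ (≈-trans (coeff-+ᵖ (num f *ᵖ den g) (-ᵖ (num g *ᵖ den f)))
           (+-cong (coeff-*ᵖ (num f) (den g)) (≈-trans (coeff-neg (num g *ᵖ den f))
             (-‿cong (coeff-*ᵖ (num g) (den f)))))) ⟩
    (a * d + - (c * b)) * (Q * S)
      ≈⟨ solve 6 (λ a b c d q s →
           (a :* d :- c :* b) :* (q :* s) := a :* q :* (d :* s) :- c :* s :* (b :* q))
           ≈-refl a b c d Q S ⟩
    a * Q * (d * S) + - (c * S * (b * Q))
      ≈⟨ +-cong (*-congʳ fPQ) (-‿cong (*-congʳ gRS)) ⟩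
    P * b * (d * S) + - (R * d * (b * Q))
      ≈⟨ solve 6 (λ p q r s b d →
           p :* b :* (d :* s) :- r :* d :* (b :* q) := (p :* s :- r :* q) :* (b :* d))
           ≈-refl P Q R S b d ⟩
    (P * S + - (R * Q)) * (b * d)
      ≈⟨ *-congˡ {P * S + - (R * Q)} (≈-sym (coeff-*ᵖ (den f) (den g))) ⟩
    (P * S + - (R * Q)) * coeff (den f *ᵖ den g) ∎)
    where a = coeff (num f) ; b = coeff (den f) ; c = coeff (num g) ; d = coeff (den g)

  is-/ : {{_ : NonZero g}} → f is P ÷ Q → g is R ÷ S → f Defs./ g is P * S ÷ Q * R
  is-/ {g} {f} {P} {Q} {R} {S} (cross fPQ) (cross gRS) = cross (begin
    coeff (num f *ᵖ den g) * (Q * R)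
      ≈⟨ *-congʳ (coeff-*ᵖ (num f) (den g)) ⟩
    a * d * (Q * R)
      ≈⟨ solve 4 (λ a d q r → a :* d :* (q :* r) := a :* q :* (r :* d))
           ≈-refl a d Q R ⟩
    a * Q * (R * d)
      ≈⟨ *-cong fPQ (≈-sym gRS) ⟩
    P * b * (c * S)
      ≈⟨ solve 4 (λ p b c s → p :* b :* (c :* s) := p :* s :* (b :* c))
           ≈-refl P b c S ⟩
    P * S * (b * c)
      ≈⟨ *-congˡ {P * S} (≈-sym (coeff-*ᵖ (den f) (num g))) ⟩
    P * S * coeff (den f *ᵖ num g) ∎)
    where a = coeff (num f) ; b = coeff (den f) ; c = coeff (num g) ; d = coeff (den g)

  is-simplify : Cancellable R → f is P * R ÷ Q * R → f is P ÷ Q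
  is-simplify {R} {f} {P} {Q} cR (cross e) = cross (cR _ _ (begin
    R * (a * Q) ≈⟨ solve 3 (λ r a q → r :* (a :* q) := a :* (q :* r)) ≈-refl R a Q ⟩
    a * (Q * R) ≈⟨ e ⟩
    P * R * b   ≈⟨ solve 3 (λ r p b → p :* r :* b := r :* (p :* b)) ≈-refl R P b ⟩
    R * (P * b) ∎))
    where a = coeff (num f) ; b = coeff (den f)

  is-cong : P ≈ R → Q ≈ S → f is P ÷ Q → f is R ÷ S
  is-cong {f = f} PR QS (cross e) =
    cross (≈-trans (*-congˡ {coeff (num f)} (≈-sym QS)) (≈-trans e (*-congʳ PR)))

  is-scale : ∀ R → f is P ÷ Q → f is R * P ÷ R * Q
  is-scale {f} {P} {Q} R (cross e) = cross (begin
    a * (R * Q) ≈⟨ solve 3 (λ r a q → a :* (r :* q) := r :* (a :* q)) ≈-refl R a Q ⟩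
    R * (a * Q) ≈⟨ *-congˡ {R} e ⟩
    R * (P * b) ≈⟨ solve 3 (λ r p b → r :* (p :* b) := r :* p :* b) ≈-refl R P b ⟩
    R * P * b   ∎)
    where a = coeff (num f) ; b = coeff (den f)

  -- Multiplied by `Q`, both `den f * F` and `num f` become `P * den f`. Cancelling `Q` compares
  -- them although `f` itself is not in lowest terms.
  expansion : ∀ {F} → Cancellable Q → f is P ÷ Q → Q * F ≈ P → F IsExpansionOf f
  expansion {Q} {f} {P} {F} cQ (cross e) QF n =
    trans (at (⊛-* (den f) F) n) (at (cQ (b * F) a (begin
      Q * (b * F) ≈⟨ solve 3 (λ q b f → q :* (b :* f) := q :* f :* b) ≈-refl Q b F ⟩
      Q * F * b   ≈⟨ *-congʳ QF ⟩
      P * b       ≈⟨ ≈-sym e ⟩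
      a * Q       ≈⟨ solve 2 (λ a q → a :* q := q :* a) ≈-refl a Q ⟩
      Q * a       ∎)) n)
    where a = coeff (num f) ; b = coeff (den f)

  coeff-1 : coeff (1ℤ ∷ []) ≈ constant 1ℤ
  coeff-1 = pointwise λ { zero → refl ; (suc n) → refl }

  cancellable-1 : Cancellable (constant 1ℤ)
  cancellable-1 = cancellable-unit refl

  cancellable-X^ : ∀ n → Cancellable (X ^ n)
  cancellable-X^ zero    = cancellable-1
  cancellable-X^ (suc n) = cancellable-* cancellable-X (cancellable-X^ n)

  1#-is : 1# is constant 1ℤ ÷ constant 1ℤ
  1#-is = cross (*-cong coeff-1 (≈-sym coeff-1))

  x-is : x is X ÷ constant 1ℤ
  x-is = cross (*-cong (pointwise λ { 0 → refl ; 1 → refl ; (suc (suc n)) → refl })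
                       (≈-sym coeff-1))

  0#-is : Defs.0# is constant 0ℤ ÷ constant 1ℤ
  0#-is = cross (*-cong (pointwise λ { zero → refl ; (suc n) → refl }) (≈-sym coeff-1))

  2t-is : 2# Defs.* t is constant 1ℤ ÷ X
  2t-is = cross (begin
    coeff (num (2# Defs.* t)) * X
      ≈⟨ *-congʳ {X} (pointwise λ { 0 → refl ; (suc n) → refl }) ⟩
    constant (+ 2) * X
      ≈⟨ solve 1 (λ x → con (+ 2) :* x := x :* con (+ 2)) ≈-refl X ⟩
    X * constant (+ 2)
      ≈⟨ pointwise (λ { 0 → refl ; 1 → refl
                    ; (suc (suc n)) → X*-suc (constant (+ 2)) (suc n) }) ⟩
    coeff (den (2# Defs.* t))
      ≈⟨ solve 1 (λ f → f := con 1ℤ :* f) ≈-refl (coeff (den (2# Defs.* t))) ⟩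
    constant 1ℤ * coeff (den (2# Defs.* t)) ∎)

  U-is′ : ∀ r → chebyshev₊ r t is p (suc r) ÷ X ^ r
  U-is′ zero          = 1#-is
  U-is′ (suc zero)    = is-cong
    (solve 1 (λ x → con 1ℤ := con 1ℤ :- x :* x :* con 0ℤ) ≈-refl X)
    (solve 1 (λ x → x := x :* con 1ℤ) ≈-refl X) 2t-is
  -- The fractions are not normalised: the subtraction leaves the product of both denominators, with
  -- `X ^ r` in excess.
  U-is′ (suc (suc r)) = is-simplify (cancellable-X^ r) (is-cong
    (solve 4 (λ x y a b → con 1ℤ :* b :* y :- a :* (x :* (x :* y)) :=
                          (b :- x :* x :* a) :* y)
      ≈-refl X (X ^ r) (p (suc r)) (p (suc (suc r))))
    ≈-refl
    (is-minus (is-* 2t-is (U-is′ (suc r))) (U-is′ r)))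

  -- `U r t` and `chebyshev r t` share numerator and denominator but are different records, so only
  -- the equation between these is carried over.
  U-is : ∀ r → U (+ r) t is p (suc r) ÷ X ^ r
  U-is r = cross (cross-multiplied (U-is′ r))

  -- The denominator is that of `U r t`, which makes the formula uniform: at `r = 0` it says that
  -- `U (-1)` vanishes, through `p 0`.
  U-1-is : ∀ r → U (+ r ℤ.- 1ℤ) t is X * p r ÷ X ^ r
  U-1-is zero    = cross (cross-multiplied (is-cong
    (solve 1 (λ x → con 0ℤ := x :* con 0ℤ) ≈-refl X) ≈-refl 0#-is))
  U-1-is (suc r) = is-scale X (U-is r)

  -- `s m` belongs over `x^(m - 1)`; the additional factor `X` avoids a negative exponent at
  -- `m = 0`.
  Σ-is : ∀ m → Σ[ m ] (λ j → U (+ j) t) is X * s m ÷ X ^ m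
  Σ-is zero    = is-cong
    (solve 1 (λ x → con 0ℤ := x :* con 0ℤ) ≈-refl X) ≈-refl 0#-is
  Σ-is (suc m) = is-simplify (cancellable-X^ m) (is-cong
    (solve 4 (λ x y s p → x :* s :* (x :* y) :+ x :* p :* y :=
                          x :* (x :* s :+ p) :* y)
      ≈-refl X (X ^ m) (s m) (p (suc m)))
    (solve 2 (λ x y → y :* (x :* y) := x :* y :* y) ≈-refl X (X ^ m))
    (is-+ (Σ-is m) (U-1-is (suc m))))

  -- The two equations let the indices keep the form they have in the theorem. The resulting
  -- numerator and denominator are those of `closed-form`.
  right-hand-side : ∀ d e {c z} → c ≡ suc (d ℕ.+ e) → z ≡ + e ℤ.- 1ℤ →
    (1# Defs./ (x Defs.* (U (+ suc d) t Defs.- U (+ suc d ℤ.- 1ℤ) t))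
     Defs.* (U (+ suc d ℤ.- 1ℤ) t
        Defs.+ U z t
          Defs./ (U (+ c) t Defs.* U (+ (c ∸ 1)) t)
          Defs.* Σ[ c ] (λ j → U (+ j) t)))
    is p (suc d) * p c * p (suc c) + X ^ suc d * X ^ suc d * p e * s c
    ÷  p c * p (suc c) * (p (2 ℕ.+ d) + - (X * p (suc d)))
  right-hand-side d e refl refl = is-simplify (cancellable-X^ d) (is-cong
    (solve 7 (λ x y a b f g s →
      y :* (a :* (g :* f) :+ x :* x :* y :* b :* s :* y) :=
      (a :* f :* g :+ x :* y :* (x :* y) :* b :* s) :* y)
      ≈-refl X D p₁ (p e) (p c) (p (suc c)) (s c))
    (solve 4 (λ y v f g → v :* (y :* (g :* f)) := f :* g :* v :* y)
      ≈-refl D v (p c) (p (suc c)))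
    (is-* first (is-+ (U-is d) second)))
    where
    c = suc (d ℕ.+ e)
    D = X ^ d
    p₁ = p (suc d)
    v = p (2 ℕ.+ d) + - (X * p₁)

    first : 1# Defs./ (x Defs.* (U (+ suc d) t Defs.- U (+ suc d ℤ.- 1ℤ) t)) is D ÷ v
    first = is-simplify cancellable-X (is-simplify (cancellable-X^ (suc d)) (is-cong
      (solve 2 (λ x y → con 1ℤ :* (con 1ℤ :* (x :* y :* (x :* y))) :=
                        y :* x :* (x :* y)) ≈-refl X D)
      (solve 4 (λ x y a b →
         con 1ℤ :* (x :* (b :* (x :* y) :- x :* a :* (x :* y))) :=
         (b :- x :* a) :* x :* (x :* y)) ≈-refl X D p₁ (p (2 ℕ.+ d)))
      (is-/ 1#-is (is-* x-is (is-minus (U-is (suc d)) (U-1-is (suc d)))))))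

    second : U (+ e ℤ.- 1ℤ) t Defs./ (U (+ c) t Defs.* U (+ (c ∸ 1)) t)
             Defs.* Σ[ c ] (λ j → U (+ j) t)
             is X * X * D * p e * s c ÷ p (suc c) * p c
    second = is-simplify (cancellable-* (cancellable-X^ c) (cancellable-X^ e)) (is-cong
      (≈-trans
        -- The denominator `X ^ (d + e)` of `U (c - 1) t` is split, because its factor `X ^ e`
        -- cancels against the denominator of `U (e - 1) t`.
        (*-congʳ {X * s c} (*-congˡ {X * p e} (*-congˡ {X ^ c} (^-homo-* X d e))))
        (solve 6 (λ x y w z b s →
          x :* b :* (z :* (y :* w)) :* (x :* s) := x :* x :* y :* b :* s :* (z :* w))
          ≈-refl X D (X ^ e) (X ^ c) (p e) (s c)))
      (solve 4 (λ w z f g → w :* (g :* f) :* z := g :* f :* (z :* w))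
        ≈-refl (X ^ e) (X ^ c) (p c) (p (suc c)))
      (is-* (is-/ (U-1-is e) (is-* (U-is c) (U-is (c ∸ 1)))) (Σ-is c)))

  -- Each factor has constant term 1. For `p c` this requires `c` to be positive, as `p 0` is zero.
  cancellable-denominator : ∀ d {b c} → c ≡ suc b →
    Cancellable (p c * p (suc c) * (p (2 ℕ.+ d) + - (X * p (suc d))))
  cancellable-denominator d {c} refl = cancellable-*
    (cancellable-* (cancellable-unit (p₀≡1 c)) (cancellable-unit (p₀≡1 (suc c))))
    (cancellable-unit (trans (ℤ.+-identityʳ _) (p₀≡1 (suc d))))

-- Weighted classes, their listings and their generating functions.

module Counting where
  open import Data.Integer using (+_)
  open import Data.Empty using (⊥)
  import Data.Fin as Fin
  import Data.Fin.Properties as Fin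
  open import Data.List as List
    using (List; []; _∷_; _++_; length; map; cartesianProduct; filter)
  open import Data.List.Membership.Propositional using (_∈_)
  open import Data.List.Membership.Propositional.Properties
    using (∈-map⁺; ∈-map⁻; ∈-++⁺ˡ; ∈-++⁺ʳ; ∈-++⁻; ∈-lookup; ∈-filter⁺; ∈-filter⁻;
           ∈-cartesianProduct⁺; ∈-cartesianProduct⁻)
  open import Data.List.Properties using (length-++; length-map)
  open import Data.List.Relation.Unary.All as All using (All)
  open import Data.List.Relation.Unary.AllPairs using ([]; _∷_)
  open import Data.List.Relation.Unary.Any as Any using (here)
  import Data.List.Relation.Unary.Any.Properties as Any
  open import Data.List.Relation.Unary.Unique.Propositional using (Unique)
  import Data.List.Relation.Unary.Unique.Propositional.Properties as Unique
  open import Data.Product using (∃; ∃₂; _×_; _,_; proj₁; proj₂)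
  open import Data.Sum using (_⊎_; inj₁; inj₂; [_,_])
  open import Data.Sum.Properties using (inj₁-injective; inj₂-injective)
  open import Data.Unit using (⊤; tt)
  open import Function using (_∘_; Injective)
  open import Relation.Nullary using (¬_; contradiction)
  open import Relation.Unary using (Pred; Decidable; ∅; U; _∩_; _⟨×⟩_; _⟨⊎⟩_)

  private
    variable
      A B : Set

  lookup-unique : ∀ {xs : List A} → Unique xs →
                  Injective _≡_ _≡_ (List.lookup xs)
  lookup-unique (_  ∷ _) {Fin.zero}  {Fin.zero}  _  = refl
  lookup-unique {xs = _ ∷ xs} (x≢ ∷ _) {Fin.zero}  {Fin.suc j} eq =
    contradiction eq (All.lookup x≢ (∈-lookup {xs = xs} j))
  lookup-unique {xs = _ ∷ xs} (x≢ ∷ _) {Fin.suc i} {Fin.zero}  eq =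
    contradiction (sym eq) (All.lookup x≢ (∈-lookup {xs = xs} i))
  lookup-unique (_ ∷ u) {Fin.suc i} {Fin.suc j} eq =
    cong Fin.suc (lookup-unique u eq)

  -- Each position in `xs` is sent to the position in `ys` of a related element, an injection of
  -- finite sets. A relation suits `Encodes`, whose partners are only known to exist for elements of
  -- the lists.
  length-≤ : {xs : List A} {ys : List B} (R : A → B → Set) → Unique xs →
             (∀ {a} → a ∈ xs → ∃ λ b → b ∈ ys × R a b) →
             (∀ {a a′ b} → R a b → R a′ b → a ≡ a′) →
             length xs ℕ.≤ length ys
  length-≤ {xs = xs} {ys} R u total R-injective =
    Fin.injective⇒≤ {f = Any.index ∘ b∈} λ {i} {j} eq →
      lookup-unique u (R-injective (proj₂ (proj₂ (image i)))
        (subst (R _) (sym (same-index i j eq)) (proj₂ (proj₂ (image j)))))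
    where
    image : ∀ i → ∃ λ b → b ∈ ys × R (List.lookup xs i) b
    image i = total (∈-lookup i)

    b∈ : ∀ i → proj₁ (image i) ∈ ys
    b∈ i = proj₁ (proj₂ (image i))

    same-index : ∀ i j → Any.index (b∈ i) ≡ Any.index (b∈ j) →
                 proj₁ (image i) ≡ proj₁ (image j)
    same-index i j eq = trans (Any.lookup-index (b∈ i))
      (trans (cong (List.lookup ys) eq) (sym (Any.lookup-index (b∈ j))))

  length-cartesianProduct : ∀ (xs : List A) (ys : List B) →
    length (cartesianProduct xs ys) ≡ length xs ℕ.* length ys
  length-cartesianProduct []       ys = refl
  length-cartesianProduct (x ∷ xs) ys = trans (length-++ (map (x ,_) ys))
    (cong₂ ℕ._+_ (length-map (x ,_) ys) (length-cartesianProduct xs ys))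

  convolution : (ℕ → List A) → (ℕ → List B) → ℕ → List (A × B)
  convolution F G zero    = cartesianProduct (F 0) (G 0)
  convolution F G (suc n) =
    cartesianProduct (F 0) (G (suc n)) ++ convolution (F ∘ suc) G n

  ∈-convolution⁺ : ∀ (F : ℕ → List A) (G : ℕ → List B) {a b} i j →
                   a ∈ F i → b ∈ G j → (a , b) ∈ convolution F G (i ℕ.+ j)
  ∈-convolution⁺ F G zero    zero    a∈ b∈ = ∈-cartesianProduct⁺ a∈ b∈
  ∈-convolution⁺ F G zero    (suc j) a∈ b∈ = ∈-++⁺ˡ (∈-cartesianProduct⁺ a∈ b∈)
  ∈-convolution⁺ F G (suc i) j       a∈ b∈ =
    ∈-++⁺ʳ (cartesianProduct (F 0) (G (suc (i ℕ.+ j))))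
           (∈-convolution⁺ (F ∘ suc) G i j a∈ b∈)

  ∈-convolution⁻ : ∀ (F : ℕ → List A) (G : ℕ → List B) {a b} n →
                   (a , b) ∈ convolution F G n →
                   ∃₂ λ i j → a ∈ F i × b ∈ G j × i ℕ.+ j ≡ n
  ∈-convolution⁻ F G zero    ab∈ =
    let a∈ , b∈ = ∈-cartesianProduct⁻ (F 0) (G 0) ab∈ in 0 , 0 , a∈ , b∈ , refl
  ∈-convolution⁻ F G (suc n) ab∈
    with ∈-++⁻ (cartesianProduct (F 0) (G (suc n))) ab∈
  ... | inj₁ ab∈₀ = let a∈ , b∈ = ∈-cartesianProduct⁻ (F 0) (G (suc n)) ab∈₀
                    in 0 , suc n , a∈ , b∈ , refl
  ... | inj₂ ab∈₁ = let i , j , a∈ , b∈ , eq = ∈-convolution⁻ (F ∘ suc) G n ab∈₁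
                    in suc i , j , a∈ , b∈ , cong suc eq

  -- Pairs from different splittings of `n` differ, because the first component determines its own
  -- index.
  unique-convolution : ∀ (F : ℕ → List A) (G : ℕ → List B) →
    (∀ i → Unique (F i)) → (∀ j → Unique (G j)) →
    (∀ {i i′ a} → a ∈ F i → a ∈ F i′ → i ≡ i′) →
    ∀ n → Unique (convolution F G n)
  unique-convolution F G uF uG F-disjoint zero =
    Unique.cartesianProduct⁺ (uF 0) (uG 0)
  unique-convolution F G uF uG F-disjoint (suc n) = Unique.++⁺
    (Unique.cartesianProduct⁺ (uF 0) (uG (suc n)))
    (unique-convolution (F ∘ suc) G (uF ∘ suc) uG
      (λ p q → ℕ.suc-injective (F-disjoint p q)) n)
    λ (ab∈₀ , ab∈₁) → let i , _ , a∈ , _ = ∈-convolution⁻ (F ∘ suc) G n ab∈₁ in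
      ℕ.0≢1+n (F-disjoint (proj₁ (∈-cartesianProduct⁻ (F 0) (G (suc n)) ab∈₀)) a∈)

  -- A combinatorial class in the sense of the symbolic method, with finitely many objects of each
  -- weight. Disjoint union, product and a unit of weight turn into sum, product and multiplication
  -- by `X` of the series.
  record Listing {A : Set} (P : Pred A 0ℓ) (weight : A → ℕ) : Set where
    field
      list     : ℕ → List A
      unique   : ∀ n → Unique (list n)
      complete : ∀ {a} → P a → a ∈ list (weight a)
      sound    : ∀ {n a} → a ∈ list n → P a × weight a ≡ n

    series : PowerSeries.Series
    series n = + length (list n)

  open Listing public

  private
    variable
      P Q : Pred A 0ℓ
      w v : A → ℕ

  ∅-listing : Listing {A} ∅ w
  ∅-listing = record
    { list = λ _ → [] ; unique = λ _ → [] ; complete = λ () ; sound = λ () }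

  ⊤-listing : Listing {⊤} U (λ _ → 0)
  ⊤-listing = record
    { list     = λ { zero → tt ∷ [] ; (suc _) → [] }
    ; unique   = λ { zero → All.[] ∷ [] ; (suc _) → [] }
    ; complete = λ _ → here refl
    ; sound    = λ { {zero} _ → tt , refl }
    }

  shift : Listing P w → Listing P (suc ∘ w)
  shift L = record
    { list     = λ { zero → [] ; (suc n) → list L n }
    ; unique   = λ { zero → [] ; (suc n) → unique L n }
    ; complete = complete L
    ; sound    = λ { {suc n} a∈ → let p , eq = sound L a∈ in p , cong suc eq }
    }

  infixr 2 _⊗_
  infixr 1 _⊕_

  _⊕_ : Listing P w → Listing Q v → Listing (P ⟨⊎⟩ Q) [ w , v ]
  L ⊕ M = record
    { list     = λ n → map inj₁ (list L n) ++ map inj₂ (list M n)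
    ; unique   = λ n → Unique.++⁺ (Unique.map⁺ inj₁-injective (unique L n))
                                  (Unique.map⁺ inj₂-injective (unique M n))
        λ (∈₁ , ∈₂) → case₂ (∈-map⁻ inj₁ ∈₁) (∈-map⁻ inj₂ ∈₂)
    ; complete = λ
        { {inj₁ a} p → ∈-++⁺ˡ (∈-map⁺ inj₁ (complete L p))
        ; {inj₂ b} q → ∈-++⁺ʳ (map inj₁ (list L _)) (∈-map⁺ inj₂ (complete M q)) }
    ; sound    = λ {n} ∈₁₂ → sound-⊕ n (∈-++⁻ (map inj₁ (list L n)) ∈₁₂)
    }
    where
    case₂ : ∀ {c : A ⊎ B} {xs ys} → (∃ λ a → a ∈ xs × c ≡ inj₁ a) →
            (∃ λ b → b ∈ ys × c ≡ inj₂ b) → ⊥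
    case₂ (_ , _ , refl) (_ , _ , ())

    sound-⊕ : ∀ n {c} → c ∈ map inj₁ (list L n) ⊎ c ∈ map inj₂ (list M n) → _ × _ ≡ n
    sound-⊕ n (inj₁ c∈) with a , a∈ , refl ← ∈-map⁻ inj₁ c∈ = sound L a∈
    sound-⊕ n (inj₂ c∈) with b , b∈ , refl ← ∈-map⁻ inj₂ c∈ = sound M b∈

  _⊗_ : Listing P w → Listing Q v → Listing (P ⟨×⟩ Q) (λ (a , b) → w a ℕ.+ v b)
  L ⊗ M = record
    { list     = convolution (list L) (list M)
    ; unique   = unique-convolution (list L) (list M) (unique L) (unique M)
        λ a∈ a∈′ → trans (sym (proj₂ (sound L a∈))) (proj₂ (sound L a∈′))
    ; complete = λ (p , q) →
        ∈-convolution⁺ (list L) (list M) _ _ (complete L p) (complete M q)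
    ; sound    = λ {n} ab∈ →
        let i , j , a∈ , b∈ , eq = ∈-convolution⁻ (list L) (list M) n ab∈
            p , i≡ = sound L a∈
            q , j≡ = sound M b∈
        in (p , q) , trans (cong₂ ℕ._+_ i≡ j≡) eq
    }

  restrict : Decidable Q → Listing P w → Listing (P ∩ Q) w
  restrict Q? L = record
    { list     = filter Q? ∘ list L
    ; unique   = λ n → Unique.filter⁺ Q? (unique L n)
    ; complete = λ (p , q) → ∈-filter⁺ Q? (complete L p) q
    ; sound    = λ {n} a∈ → let a∈L , q = ∈-filter⁻ Q? {xs = list L n} a∈
                                p , eq = sound L a∈L
                            in (p , q) , eq
    }

  mapListing : (f : A → B) → Injective _≡_ _≡_ f → (∀ {a} → v (f a) ≡ w a) →
               (∀ {a} → P a → Q (f a)) → (∀ {b} → Q b → ∃ λ a → P a × f a ≡ b) →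
               Listing {A} P w → Listing {B} Q v
  mapListing {v = v} f f-injective weights to from L = record
    { list     = map f ∘ list L
    ; unique   = λ n → Unique.map⁺ f-injective (unique L n)
    ; complete = λ q → complete′ (from q)
    ; sound    = sound′
    }
    where
    complete′ : ∀ {b} → (∃ λ a → _ × f a ≡ b) → b ∈ map f (list L (v b))
    complete′ (a , p , refl) rewrite weights {a} = ∈-map⁺ f (complete L p)

    sound′ : ∀ {n b} → b ∈ map f (list L n) → _ × v b ≡ n
    sound′ b∈ with a , a∈ , refl ← ∈-map⁻ f b∈ =
      let p , eq = sound L a∈ in to p , trans weights eq

  open PowerSeries

  module _ {A B : Set} {P : Pred A 0ℓ} {Q : Pred B 0ℓ} {w : A → ℕ} {v : B → ℕ} where

    series-⊕ : (L : Listing P w) (M : Listing Q v) →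
               series (L ⊕ M) ≈ series L + series M
    series-⊕ L M = pointwise λ n → cong +_ (trans
      (length-++ (map inj₁ (list L n)))
      (cong₂ ℕ._+_ (length-map inj₁ (list L n)) (length-map inj₂ (list M n))))

    series-⊗ : (L : Listing P w) (M : Listing Q v) →
               series (L ⊗ M) ≈ series L * series M
    series-⊗ L M = pointwise (go (list L))
      where
      +-× : (xs : List A) (ys : List B) → + length (cartesianProduct xs ys) ≡
            + length xs ℤ.* + length ys
      +-× xs ys = trans (cong +_ (length-cartesianProduct xs ys))
                        (ℤ.pos-* (length xs) (length ys))

      go : ∀ F n → + length (convolution F (list M) n) ≡
                   ((λ i → + length (F i)) * series M) n
      go F zero    = +-× (F 0) (list M 0)
      go F (suc n) = trans
        (cong +_ (length-++ (cartesianProduct (F 0) (list M (suc n)))))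
        (cong₂ ℤ._+_ (+-× (F 0) (list M (suc n))) (go (F ∘ suc) n))

    -- Injectivity is asked on `P` only. When a class is cut into ranges of height, two summands are
    -- mapped by the same function and only their height conditions keep them apart.
    series-bijection : (L : Listing P w) (M : Listing Q v) (f : A → B) →
      (∀ {a a′} → P a → P a′ → f a ≡ f a′ → a ≡ a′) → (∀ {a} → v (f a) ≡ w a) →
      (∀ {a} → P a → Q (f a)) → (∀ {b} → Q b → ∃ λ a → P a × f a ≡ b) →
      series L ≈ series M
    series-bijection L M f f-injective weights to from = pointwise λ n →
      cong +_ (ℕ.≤-antisym
        (length-≤ (λ a b → P a × f a ≡ b) (unique L n)
          (λ {a} a∈ → let p , eq = sound L a∈ in
            f a , subst (λ m → f a ∈ list M m) (trans weights eq) (complete M (to p))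
            , p , refl)
          (λ (p , eq) (p′ , eq′) → f-injective p p′ (trans eq (sym eq′))))
        (length-≤ (λ b a → f a ≡ b) (unique M n)
          (λ b∈ → preimage (sound M b∈))
          (λ eq eq′ → trans (sym eq) eq′)))
      where
      preimage : ∀ {n b} → Q b × v b ≡ n → ∃ λ a → a ∈ list L n × f a ≡ b
      preimage (q , refl) with a , p , refl ← from q =
        a , subst (λ m → a ∈ list L m) (sym weights) (complete L p) , refl

  series-shift : (L : Listing P w) → series (shift L) ≈ X * series L
  series-shift L = pointwise λ
    { zero → refl ; (suc n) → sym (X*-suc (series L) n) }

  series-∅ : (L : Listing P w) → (∀ {a} → ¬ P a) → series L ≈ constant 0ℤ
  series-∅ L ¬P = pointwise λ n → trans (empty (list L n) (λ a∈ → ¬P (proj₁ (sound L a∈))))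
                                     (sym (constant-0 n))
    where
    empty : ∀ xs → (∀ {a} → ¬ a ∈ xs) → + length xs ≡ 0ℤ
    empty []       h = refl
    empty (x ∷ xs) h = contradiction (here refl) h

  series-⊤ : series ⊤-listing ≈ constant 1ℤ
  series-⊤ = pointwise λ { zero → refl ; (suc n) → refl }

-- Codes for the permutations and involutions avoiding 132, and the equations between their series.

module Trees where
  open import Data.Empty using (⊥)
  open import Data.Nat using (_⊔_; _<_; _≤_; _<?_; _≤?_; s≤s)
  open import Data.Nat.Solver using (module +-*-Solver)
  open import Data.Product using (∃; _×_; _,_; proj₂)
  open import Data.Sum using (_⊎_; inj₁; inj₂; [_,_])
  open import Data.Unit using (⊤; tt)
  open import Function using (id)
  open import Relation.Nullary using (Dec; yes; no; contradiction)
  open import Relation.Nullary.Decidable using (_×-dec_; _⊎-dec_)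
  open import Relation.Unary using (Pred; Decidable; U; _∩_)
  open Counting
  open PowerSeries using (_≈_; constant; X; _+_; _*_; module Solver)
  open import Algebra.Bundles using (CommutativeRing)
  open CommutativeRing PowerSeries.commutativeRing
    using (+-cong; *-congˡ)
    renaming (refl to ≈-refl; sym to ≈-sym; trans to ≈-trans)

  -- node l r stands for the permutation (l ⊕ 1) ⊖ r, and in Involution,
  -- fix γ for γ ⊕ 1 and nest β γ for (β ⊕ 1) ⊖ γ ⊖ (β⁻¹ ⊕ 1).
  data Tree : Set where
    leaf : Tree
    node : (l r : Tree) → Tree

  data Involution : Set where
    ε    : Involution
    fix  : (γ : Involution) → Involution
    nest : (β : Tree) (γ : Involution) → Involution

  -- A tree β occurs twice in nest β γ, hence the weight.
  size weight : Tree → ℕ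
  size leaf       = 0
  size (node l r) = suc (size l ℕ.+ size r)
  weight T = size T ℕ.+ size T

  sizeᴵ : Involution → ℕ
  sizeᴵ ε          = 0
  sizeᴵ (fix γ)    = suc (sizeᴵ γ)
  sizeᴵ (nest β γ) = suc (size β) ℕ.+ (sizeᴵ γ ℕ.+ suc (size β))

  -- The length of the longest increasing subsequence.
  height : Tree → ℕ
  height leaf       = 0
  height (node l r) = suc (height l) ⊔ height r

  heightᴵ : Involution → ℕ
  heightᴵ ε          = 0
  heightᴵ (fix γ)    = suc (heightᴵ γ)
  heightᴵ (nest β γ) = suc (height β) ⊔ heightᴵ γ

  -- Avoidance of [ c ℕ.+ d , d ], for 1 ≤ d ≤ c.
  Good : ℕ → ℕ → Pred Involution 0ℓ
  Good c d ε          = ⊤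
  Good c d (fix γ)    = Good c d γ
  Good c d (nest β γ) = suc (height β) < c ×
    (suc (height β) < d × Good c d γ ⊎ d ≤ suc (height β) × heightᴵ γ < c)

  good? : ∀ c d → Decidable (Good c d)
  good? c d ε          = yes tt
  good? c d (fix γ)    = good? c d γ
  good? c d (nest β γ) = suc (height β) <? c ×-dec
    (suc (height β) <? d ×-dec good? c d γ ⊎-dec d ≤? suc (height β) ×-dec heightᴵ γ <? c)

  weight-node : ∀ l r → weight (node l r) ≡ suc (suc (weight l ℕ.+ weight r))
  weight-node l r = solve 2 (λ a b →
    con 1 :+ (a :+ b) :+ (con 1 :+ (a :+ b)) := con 2 :+ (a :+ a :+ (b :+ b)))
    refl (size l) (size r)
    where open +-*-Solver

  size-nest : ∀ β γ → sizeᴵ (nest β γ) ≡ suc (suc (weight β ℕ.+ sizeᴵ γ))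
  size-nest β γ = solve 2 (λ a b →
    con 1 :+ a :+ (b :+ (con 1 :+ a)) := con 2 :+ (a :+ a :+ b))
    refl (size β) (sizeᴵ γ)
    where open +-*-Solver

  treeCase : ⊤ ⊎ Tree × Tree → Tree
  treeCase (inj₁ _)       = leaf
  treeCase (inj₂ (l , r)) = node l r

  involutionCase : ⊤ ⊎ Involution ⊎ Tree × Involution → Involution
  involutionCase (inj₁ _)              = ε
  involutionCase (inj₂ (inj₁ γ))       = fix γ
  involutionCase (inj₂ (inj₂ (β , γ))) = nest β γ

  treeCase-injective : ∀ {a b} → treeCase a ≡ treeCase b → a ≡ b
  treeCase-injective {inj₁ _} {inj₁ _} refl = refl
  treeCase-injective {inj₂ _} {inj₂ _} refl = refl

  involutionCase-injective : ∀ {a b} → involutionCase a ≡ involutionCase b → a ≡ b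
  involutionCase-injective {inj₁ _}        {inj₁ _}        refl = refl
  involutionCase-injective {inj₁ _}        {inj₂ (inj₁ _)} ()
  involutionCase-injective {inj₁ _}        {inj₂ (inj₂ _)} ()
  involutionCase-injective {inj₂ (inj₁ _)} {inj₂ (inj₁ _)} refl = refl
  involutionCase-injective {inj₂ (inj₂ _)} {inj₂ (inj₂ _)} refl = refl

  -- Trees of depth below f, which can be listed by recursion on f.
  Shallow : ℕ → Pred Tree 0ℓ
  Shallow zero    _          = ⊥
  Shallow (suc f) leaf       = ⊤
  Shallow (suc f) (node l r) = Shallow f l × Shallow f r

  Shallowᴵ : ℕ → Pred Involution 0ℓ
  Shallowᴵ zero    _          = ⊥
  Shallowᴵ (suc f) ε          = ⊤
  Shallowᴵ (suc f) (fix γ)    = Shallowᴵ f γ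
  -- No bound on `β`: it is drawn from the complete listing `trees`.
  Shallowᴵ (suc f) (nest β γ) = Shallowᴵ f γ

  shallow : ∀ {f} T → size T < f → Shallow f T
  shallow leaf       (s≤s _)     = tt
  shallow (node l r) (s≤s l+r<f) =
    shallow l (ℕ.≤-trans (s≤s (ℕ.m≤m+n _ _)) l+r<f) ,
    shallow r (ℕ.≤-trans (s≤s (ℕ.m≤n+m _ _)) l+r<f)

  shallowᴵ : ∀ {f} δ → sizeᴵ δ < f → Shallowᴵ f δ
  shallowᴵ ε          (s≤s _)   = tt
  shallowᴵ (fix γ)    (s≤s γ<f) = shallowᴵ γ γ<f
  shallowᴵ (nest β γ) (s≤s γ<f) = shallowᴵ γ
    (ℕ.≤-trans (s≤s (ℕ.≤-trans (ℕ.m≤m+n _ _) (ℕ.m≤n+m _ (size β)))) γ<f)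

  shallowTrees : ∀ f → Listing (Shallow f) weight
  shallowTrees zero    = ∅-listing
  shallowTrees (suc f) = mapListing treeCase treeCase-injective
    (λ { {inj₁ _} → refl ; {inj₂ (l , r)} → weight-node l r })
    (λ { {inj₁ _} _ → tt ; {inj₂ _} p → p })
    (λ { {leaf} _ → inj₁ tt , tt , refl ; {node l r} p → inj₂ (l , r) , p , refl })
    (⊤-listing ⊕ shift (shift (shallowTrees f ⊗ shallowTrees f)))

  -- All objects of weight `n` satisfy `P (suc n)`, so the diagonal of the bounded listings misses
  -- nothing.
  union : ∀ {A : Set} {P : ℕ → Pred A 0ℓ} {w} → (∀ {a f} → w a < f → P f a) →
          (∀ f → Listing (P f) w) → Listing U w
  union P-bound L = record
    { list     = λ n → list (L (suc n)) n
    ; unique   = λ n → unique (L (suc n)) n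
    ; complete = λ {a} _ → complete (L _) (P-bound ℕ.≤-refl)
    ; sound    = λ {n} a∈ → tt , proj₂ (sound (L (suc n)) a∈)
    }

  trees : Listing U weight
  trees = union (λ {T} w<f → shallow T (ℕ.≤-trans (s≤s (ℕ.m≤m+n (size T) (size T))) w<f))
                shallowTrees

  shallowInvolutions : ∀ f → Listing (Shallowᴵ f) sizeᴵ
  shallowInvolutions zero    = ∅-listing
  shallowInvolutions (suc f) = mapListing involutionCase involutionCase-injective
    (λ { {inj₁ _} → refl ; {inj₂ (inj₁ _)} → refl
       ; {inj₂ (inj₂ (β , γ))} → size-nest β γ })
    (λ { {inj₁ _} _ → tt ; {inj₂ (inj₁ _)} p → p ; {inj₂ (inj₂ _)} (_ , p) → p })
    (λ { {ε} _ → inj₁ tt , tt , refl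
       ; {fix γ} p → inj₂ (inj₁ γ) , p , refl
       ; {nest β γ} p → inj₂ (inj₂ (β , γ)) , (tt , p) , refl })
    (⊤-listing ⊕ shift (shallowInvolutions f)
               ⊕ shift (shift (trees ⊗ shallowInvolutions f)))

  involutions : Listing U sizeᴵ
  involutions = union (λ {δ} → shallowᴵ δ) shallowInvolutions

  -- The series of `treesBelow m`, `involutionsBelow m` and `goodInvolutions c d` are `Aₘ`, `Bₘ` and
  -- `G`. The difference of two `A`s in the equation for `G` is realised as a class of its own,
  -- `treesBetween`.
  treesBelow : ∀ m → Listing (U ∩ (λ T → height T < m)) weight
  treesBelow m = restrict (λ T → height T <? m) trees

  treesBetween : ∀ a b → Listing (U ∩ (λ T → a ≤ height T × height T < b)) weight
  treesBetween a b = restrict (λ T → a ≤? height T ×-dec height T <? b) trees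

  involutionsBelow : ∀ m → Listing (U ∩ (λ δ → heightᴵ δ < m)) sizeᴵ
  involutionsBelow m = restrict (λ δ → heightᴵ δ <? m) involutions

  goodInvolutions : ∀ c d → Listing (U ∩ Good c d) sizeᴵ
  goodInvolutions c d = restrict (good? c d) involutions

  private
    X²* : ∀ {A B : Set} {P Q w v} (L : Listing {A} P w) (M : Listing {B} Q v) →
          series (shift (shift (L ⊗ M))) ≈ X * X * (series L * series M)
    X²* L M = ≈-trans (series-shift (shift (L ⊗ M))) (≈-trans
      (*-congˡ {X} (≈-trans (series-shift (L ⊗ M)) (*-congˡ {X} (series-⊗ L M))))
      (solve 3 (λ x a b → x :* (x :* (a :* b)) := x :* x :* (a :* b))
        ≈-refl X (series L) (series M)))
      where open Solver

  treesBelow-0 : series (treesBelow 0) ≈ constant 0ℤ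
  treesBelow-0 = series-∅ (treesBelow 0) λ ()

  -- The maximum prolongs every increasing subsequence of `l`, whereas `r` is skew to it; hence the
  -- bound `m` for `l` and `suc m` for `r`.
  treesBelow-suc : ∀ m → series (treesBelow (suc m)) ≈
    constant 1ℤ + X * X * (series (treesBelow m) * series (treesBelow (suc m)))
  treesBelow-suc m = ≈-trans
    (≈-sym (series-bijection cases (treesBelow (suc m)) treeCase
      (λ _ _ → treeCase-injective)
      (λ { {inj₁ _} → refl ; {inj₂ (l , r)} → weight-node l r })
      (λ { {inj₁ _} _ → tt , s≤s ℕ.z≤n
         ; {inj₂ _} ((_ , l<) , (_ , r<)) → tt , ℕ.⊔-lub (s≤s l<) r< })
      (λ { {leaf} _ → inj₁ tt , tt , refl
         ; {node l r} (_ , s≤s lr<) → inj₂ (l , r) ,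
             ((tt , ℕ.m⊔n≤o⇒m≤o _ (height r) lr<) ,
              (tt , s≤s (ℕ.m⊔n≤o⇒n≤o (suc (height l)) _ lr<))) , refl })))
    (≈-trans (series-⊕ ⊤-listing (shift (shift (treesBelow m ⊗ treesBelow (suc m)))))
             (+-cong series-⊤ (X²* (treesBelow m) (treesBelow (suc m)))))
    where
    cases = ⊤-listing ⊕ shift (shift (treesBelow m ⊗ treesBelow (suc m)))

  treesBelow-Between : ∀ {a b} → a ≤ b →
    series (treesBelow a) + series (treesBetween a b) ≈ series (treesBelow b)
  treesBelow-Between {a} {b} a≤b = ≈-trans
    (≈-sym (series-⊕ (treesBelow a) (treesBetween a b)))
    (series-bijection (treesBelow a ⊕ treesBetween a b) (treesBelow b) [ id , id ]
      (λ { {inj₁ _} {inj₁ _} _ _ refl → refl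
         ; {inj₁ _} {inj₂ _} (_ , h<a) (_ , a≤h , _) refl → contradiction h<a (ℕ.≤⇒≯ a≤h)
         ; {inj₂ _} {inj₁ _} (_ , a≤h , _) (_ , h<a) refl → contradiction h<a (ℕ.≤⇒≯ a≤h)
         ; {inj₂ _} {inj₂ _} _ _ refl → refl })
      (λ { {inj₁ _} → refl ; {inj₂ _} → refl })
      (λ { {inj₁ _} (_ , h<a) → tt , ℕ.<-≤-trans h<a a≤b
         ; {inj₂ _} (_ , _ , h<b) → tt , h<b })
      (λ {T} (_ , h<b) → split T h<b (height T <? a)))
    where
    split : ∀ T → height T < b → Dec (height T < a) → ∃ λ s → _ × [ id , id ] s ≡ T
    split T h<b (yes h<a) = inj₁ T , (tt , h<a) , refl
    split T h<b (no  h≮a) = inj₂ T , (tt , ℕ.≮⇒≥ h≮a , h<b) , refl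

  involutionsBelow-0 : series (involutionsBelow 0) ≈ constant 0ℤ
  involutionsBelow-0 = series-∅ (involutionsBelow 0) λ ()

  -- `fix` adds one to the height, so its argument has bound `m`. In `nest β γ` only `β` is
  -- prolonged, and `γ` keeps the bound `suc m`.
  involutionsBelow-suc : ∀ m → series (involutionsBelow (suc m)) ≈
    constant 1ℤ + X * series (involutionsBelow m) +
      X * X * (series (treesBelow m) * series (involutionsBelow (suc m)))
  involutionsBelow-suc m = ≈-trans
    (≈-sym (series-bijection cases (involutionsBelow (suc m)) involutionCase
      (λ _ _ → involutionCase-injective)
      (λ { {inj₁ _} → refl ; {inj₂ (inj₁ _)} → refl
         ; {inj₂ (inj₂ (β , γ))} → size-nest β γ })
      (λ { {inj₁ _} _ → tt , s≤s ℕ.z≤n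
         ; {inj₂ (inj₁ _)} (_ , γ<) → tt , s≤s γ<
         ; {inj₂ (inj₂ _)} ((_ , β<) , (_ , γ<)) → tt , ℕ.⊔-lub (s≤s β<) γ< })
      (λ { {ε} _ → inj₁ tt , tt , refl
         ; {fix γ} (_ , s≤s γ<) → inj₂ (inj₁ γ) , (tt , γ<) , refl
         ; {nest β γ} (_ , s≤s βγ<) → inj₂ (inj₂ (β , γ)) ,
             ((tt , ℕ.m⊔n≤o⇒m≤o _ (heightᴵ γ) βγ<) ,
              (tt , s≤s (ℕ.m⊔n≤o⇒n≤o (suc (height β)) _ βγ<))) , refl })))
    (≈-trans (series-⊕ ⊤-listing (fixed ⊕ nested)) (≈-trans
      (+-cong series-⊤ (≈-trans (series-⊕ fixed nested)
        (+-cong (series-shift (involutionsBelow m))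
                (X²* (treesBelow m) (involutionsBelow (suc m))))))
      (solve 3 (λ a b c → a :+ (b :+ c) := a :+ b :+ c) ≈-refl
        (constant 1ℤ) (X * series (involutionsBelow m))
        (X * X * (series (treesBelow m) * series (involutionsBelow (suc m)))))))
    where
    open Solver
    fixed  = shift (involutionsBelow m)
    nested = shift (shift (treesBelow m ⊗ involutionsBelow (suc m)))
    cases  = ⊤-listing ⊕ fixed ⊕ nested

  -- `suc c` and `suc d` are compared with the height of `β ⊕ 1`, hence `c` and `d` with that of
  -- `β`. The codes `nest β γ` form two disjoint classes, according to the side of `d` on which the
  -- height of `β` lies.
  goodInvolutions-suc : ∀ {c d} → d ≤ c → let G = series (goodInvolutions (suc c) (suc d)) in
    G ≈ constant 1ℤ + X * G + X * X * (series (treesBelow d) * G +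
          series (treesBetween d c) * series (involutionsBelow (suc c)))
  goodInvolutions-suc {c} {d} d≤c = ≈-trans
    (≈-sym (series-bijection cases good goodCase
      (λ { {inj₁ _} {inj₁ _} _ _ refl → refl
         ; {inj₁ _} {inj₂ (inj₁ _)} _ _ ()
         ; {inj₁ _} {inj₂ (inj₂ (inj₁ _))} _ _ ()
         ; {inj₁ _} {inj₂ (inj₂ (inj₂ _))} _ _ ()
         ; {inj₂ (inj₁ _)} {inj₂ (inj₁ _)} _ _ refl → refl
         ; {inj₂ (inj₁ _)} {inj₂ (inj₂ (inj₁ _))} _ _ ()
         ; {inj₂ (inj₁ _)} {inj₂ (inj₂ (inj₂ _))} _ _ ()
         ; {inj₂ (inj₂ (inj₁ _))} {inj₂ (inj₂ (inj₁ _))} _ _ refl → refl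
         ; {inj₂ (inj₂ (inj₁ _))} {inj₂ (inj₂ (inj₂ _))}
             ((_ , β<d) , _) ((_ , d≤β , _) , _) refl →
             contradiction β<d (ℕ.≤⇒≯ d≤β)
         ; {inj₂ (inj₂ (inj₂ _))} {inj₂ (inj₂ (inj₁ _))}
             ((_ , d≤β , _) , _) ((_ , β<d) , _) refl →
             contradiction β<d (ℕ.≤⇒≯ d≤β)
         ; {inj₂ (inj₂ (inj₂ _))} {inj₂ (inj₂ (inj₂ _))} _ _ refl → refl })
      (λ { {inj₁ _} → refl ; {inj₂ (inj₁ _)} → refl
         ; {inj₂ (inj₂ (inj₁ (β , γ)))} → size-nest β γ
         ; {inj₂ (inj₂ (inj₂ (β , γ)))} → size-nest β γ })
      (λ { {inj₁ _} _ → tt , tt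
         ; {inj₂ (inj₁ _)} (_ , γ-good) → tt , γ-good
         -- In the low class `d ≤ c` supplies the first condition of `Good`.
         ; {inj₂ (inj₂ (inj₁ _))} ((_ , β<d) , (_ , γ-good)) →
             tt , s≤s (ℕ.<-≤-trans β<d d≤c) , inj₁ (s≤s β<d , γ-good)
         ; {inj₂ (inj₂ (inj₂ _))} ((_ , d≤β , β<c) , (_ , γ<c)) →
             tt , s≤s β<c , inj₂ (s≤s d≤β , γ<c) })
      (λ { {ε} _ → inj₁ tt , tt , refl
         ; {fix γ} (_ , γ-good) → inj₂ (inj₁ γ) , (tt , γ-good) , refl
         ; {nest β γ} (_ , _ , inj₁ (s≤s β<d , γ-good)) →
             inj₂ (inj₂ (inj₁ (β , γ))) , ((tt , β<d) , (tt , γ-good)) , refl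
         ; {nest β γ} (_ , s≤s β<c , inj₂ (s≤s d≤β , γ<c)) →
             inj₂ (inj₂ (inj₂ (β , γ))) , ((tt , d≤β , β<c) , (tt , γ<c)) , refl })))
    (≈-trans (series-⊕ ⊤-listing (fixed ⊕ low ⊕ high)) (≈-trans
      (+-cong series-⊤ (≈-trans (series-⊕ fixed (low ⊕ high)) (+-cong
        (series-shift good)
        (≈-trans (series-⊕ low high)
          (+-cong (X²* (treesBelow d) good)
                  (X²* (treesBetween d c) (involutionsBelow (suc c))))))))
      (solve 5 (λ x g a b i →
        con 1ℤ :+ (x :* g :+ (x :* x :* (a :* g) :+ x :* x :* (b :* i))) :=
        con 1ℤ :+ x :* g :+ x :* x :* (a :* g :+ b :* i)) ≈-refl
        X (series good) (series (treesBelow d)) (series (treesBetween d c))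
        (series (involutionsBelow (suc c))))))
    where
    open Solver
    good  = goodInvolutions (suc c) (suc d)
    fixed = shift good
    low   = shift (shift (treesBelow d ⊗ good))
    high  = shift (shift (treesBetween d c ⊗ involutionsBelow (suc c)))
    cases = ⊤-listing ⊕ fixed ⊕ low ⊕ high

    goodCase : ⊤ ⊎ Involution ⊎ Tree × Involution ⊎ Tree × Involution → Involution
    goodCase (inj₁ _)                     = ε
    goodCase (inj₂ (inj₁ γ))              = fix γ
    goodCase (inj₂ (inj₂ (inj₁ (β , γ)))) = nest β γ
    goodCase (inj₂ (inj₂ (inj₂ (β , γ)))) = nest β γ

-- Plots of the codes.

module Plots where
  open import Data.Empty using (⊥)
  open import Data.Nat using (_+_; _<_; _≤_; _⊔_; _<?_; s≤s; z≤n)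
  open import Data.Fin as Fin using (Fin; zero; suc)
  import Data.Fin.Properties as Fin
  open import Data.Fin.Relation.Unary.Top using (View; view; ‵fromℕ; ‵inject₁)
  open import Data.Product using (∃; _×_; _,_; proj₁; proj₂)
  open import Data.Sum using (_⊎_; inj₁; inj₂)
  open import Data.Unit using (tt)
  open import Function using (_∘_; id; flip)
  open import Relation.Nullary using (¬_; Dec; yes; no; contradiction)
  open Trees

  -- Working with plots rather than functions makes the inverse of a
  -- permutation the flip of its plot.
  Plot : Set₁
  Plot = ℕ → ℕ → Set

  private
    variable
      P Q P′ Q′ S : Plot
      a b m n c d x y : ℕ

  infix 4 _⊆_
  _⊆_ : Plot → Plot → Set
  P ⊆ Q = ∀ {x y} → P x y → Q x y

  -- For P of size n, this is P ⊕ 1; Skew a b P Q is P ⊖ Q, for P of size a and Q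
  -- of size b.
  data Append (n : ℕ) (P : Plot) (x y : ℕ) : Set where
    old : P x y → Append n P x y
    new : x ≡ n → y ≡ n → Append n P x y

  data Skew (a b : ℕ) (P Q : Plot) (x y : ℕ) : Set where
    hi : ∀ {y′} → y ≡ b + y′ → P x y′ → Skew a b P Q x y
    lo : ∀ {x′} → x ≡ a + x′ → Q x′ y → Skew a b P Q x y

  plot : Tree → Plot
  plot leaf       _ _ = ⊥
  plot (node l r) =
    Skew (suc (size l)) (size r) (Append (size l) (plot l)) (plot r)

  plotᴵ : Involution → Plot
  plotᴵ ε _ _      = ⊥
  plotᴵ (fix γ)    = Append (sizeᴵ γ) (plotᴵ γ)
  plotᴵ (nest β γ) =
    Skew (suc (size β)) (sizeᴵ γ + suc (size β)) (Append (size β) (plot β))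
      (Skew (sizeᴵ γ) (suc (size β)) (plotᴵ γ) (Append (size β) (flip (plot β))))

  append-mono : P ⊆ Q → Append n P ⊆ Append n Q
  append-mono f (old p)     = old (f p)
  append-mono f (new x≡ y≡) = new x≡ y≡

  skew-mono : P ⊆ P′ → Q ⊆ Q′ → Skew a b P Q ⊆ Skew a b P′ Q′
  skew-mono f g (hi y≡ p) = hi y≡ (f p)
  skew-mono f g (lo x≡ q) = lo x≡ (g q)

  -- The fields come in pairs that `flip` exchanges.
  record IsPermutation (n : ℕ) (P : Plot) : Set where
    field
      x<n        : P x y → x < n
      y<n        : P x y → y < n
      row        : x < n → ∃ λ y → P x y
      column     : y < n → ∃ λ x → P x y
      functional : ∀ {y′} → P x y → P x y′ → y ≡ y′
      injective  : ∀ {x′} → P x y → P x′ y → x ≡ x′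

  open IsPermutation

  flip-permutation : IsPermutation n P → IsPermutation n (flip P)
  flip-permutation π = record
    { x<n = y<n π ; y<n = x<n π ; row = column π ; column = row π
    ; functional = injective π ; injective = functional π }

  ⊥-permutation : IsPermutation 0 (λ _ _ → ⊥)
  ⊥-permutation = record
    { x<n = λ () ; y<n = λ () ; row = λ () ; column = λ ()
    ; functional = λ () ; injective = λ () }

  append-permutation : IsPermutation n P → IsPermutation (suc n) (Append n P)
  append-permutation {n} {P} π = record
    { x<n = λ { (old p) → ℕ.m<n⇒m<1+n (x<n π p) ; (new refl refl) → ℕ.≤-refl }
    ; y<n = λ { (old p) → ℕ.m<n⇒m<1+n (y<n π p) ; (new refl refl) → ℕ.≤-refl }
    ; row = row′
    ; column = column′
    ; functional = λ
        { (old p) (old p′) → functional π p p′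
        ; (old p) (new refl _) → contradiction (x<n π p) (ℕ.n≮n _)
        ; (new refl _) (old p) → contradiction (x<n π p) (ℕ.n≮n _)
        ; (new _ y≡) (new _ y′≡) → trans y≡ (sym y′≡) }
    ; injective = λ
        { (old p) (old p′) → injective π p p′
        ; (old p) (new _ refl) → contradiction (y<n π p) (ℕ.n≮n _)
        ; (new _ refl) (old p) → contradiction (y<n π p) (ℕ.n≮n _)
        ; (new x≡ _) (new x′≡ _) → trans x≡ (sym x′≡) }
    }
    where
    row′ : x < suc n → ∃ λ y → Append n P x y
    row′ (s≤s x≤n) with ℕ.m≤n⇒m<n∨m≡n x≤n
    ... | inj₁ x<n = let y , p = row π x<n in y , old p
    ... | inj₂ x≡n = n , new x≡n refl

    column′ : y < suc n → ∃ λ x → Append n P x y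
    column′ (s≤s y≤n) with ℕ.m≤n⇒m<n∨m≡n y≤n
    ... | inj₁ y<n = let x , p = column π y<n in x , old p
    ... | inj₂ y≡n = n , new refl y≡n

  skew-permutation : IsPermutation a P → IsPermutation b Q →
                     IsPermutation (a + b) (Skew a b P Q)
  skew-permutation {a} {P} {b} {Q} π ρ = record
    { x<n = λ { (hi _ p) → ℕ.<-≤-trans (x<n π p) (ℕ.m≤m+n a b)
              ; (lo refl q) → ℕ.+-monoʳ-< a (x<n ρ q) }
    ; y<n = λ { (hi {y′} refl p) → subst (b + y′ <_) (ℕ.+-comm b a) (ℕ.+-monoʳ-< b (y<n π p))
              ; (lo _ q) → ℕ.<-≤-trans (y<n ρ q) (ℕ.m≤n+m b a) }
    ; row = row′
    ; column = column′
    ; functional = λ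
        { (hi refl p) (hi refl p′) → cong (b +_) (functional π p p′)
        ; (hi _ p) (lo refl _) → contradiction (x<n π p) (ℕ.m+n≮m a _)
        ; (lo refl _) (hi _ p) → contradiction (x<n π p) (ℕ.m+n≮m a _)
        ; (lo x≡ q) (lo x≡′ q′) → functional ρ q
            (subst (λ x → Q x _) (ℕ.+-cancelˡ-≡ a _ _ (trans (sym x≡′) x≡)) q′) }
    ; injective = λ
        { (hi y≡ p) (hi y≡′ p′) → injective π p
            (subst (P _) (ℕ.+-cancelˡ-≡ b _ _ (trans (sym y≡′) y≡)) p′)
        ; (hi refl _) (lo _ q) → contradiction (y<n ρ q) (ℕ.m+n≮m b _)
        ; (lo _ q) (hi refl _) → contradiction (y<n ρ q) (ℕ.m+n≮m b _)
        ; (lo refl q) (lo refl q′) → cong (a +_) (injective ρ q q′) }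
    }
    where
    row′ : ∀ {x} → x < a + b → ∃ λ y → Skew a b P Q x y
    row′ {x} x<a+b with x <? a
    ... | yes x<a = let y , p = row π x<a in b + y , hi refl p
    ... | no  x≮a with z , refl ← ℕ.m≤n⇒∃[o]m+o≡n (ℕ.≮⇒≥ x≮a) =
      let y , q = row ρ (ℕ.+-cancelˡ-< a z b x<a+b) in y , lo refl q

    column′ : ∀ {y} → y < a + b → ∃ λ x → Skew a b P Q x y
    column′ {y} y<a+b with y <? b
    ... | yes y<b = let x , q = column ρ y<b in a + x , lo refl q
    ... | no  y≮b with z , refl ← ℕ.m≤n⇒∃[o]m+o≡n (ℕ.≮⇒≥ y≮b) =
      let x , p = column π (ℕ.+-cancelˡ-< b z a (subst (b + z <_) (ℕ.+-comm a b) y<a+b))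
      in x , hi refl p

  plot-permutation : ∀ T → IsPermutation (size T) (plot T)
  plot-permutation leaf       = ⊥-permutation
  plot-permutation (node l r) =
    skew-permutation (append-permutation (plot-permutation l)) (plot-permutation r)

  plotᴵ-permutation : ∀ δ → IsPermutation (sizeᴵ δ) (plotᴵ δ)
  plotᴵ-permutation ε          = ⊥-permutation
  plotᴵ-permutation (fix γ)    = append-permutation (plotᴵ-permutation γ)
  plotᴵ-permutation (nest β γ) =
    skew-permutation (append-permutation (plot-permutation β))
      (skew-permutation (plotᴵ-permutation γ)
        (append-permutation (flip-permutation (plot-permutation β))))

  append-flip : Append n P x y → Append n (flip P) y x
  append-flip (old p)     = old p
  append-flip (new x≡ y≡) = new y≡ x≡

  -- Reflecting `nest β γ` in the diagonal exchanges the first and the last block, which are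
  -- transposes of each other, and preserves the middle one. The equations only reassociate the
  -- offsets.
  plotᴵ-symmetric : ∀ δ → plotᴵ δ x y → plotᴵ δ y x
  plotᴵ-symmetric (fix γ) (old p)     = old (plotᴵ-symmetric γ p)
  plotᴵ-symmetric (fix γ) (new x≡ y≡) = new y≡ x≡
  plotᴵ-symmetric (nest β γ) (hi {y′} y≡ p) = lo
    {x′ = sizeᴵ γ + y′}
    (trans y≡ (trans (cong (_+ y′) (ℕ.+-comm (sizeᴵ γ) (suc (size β))))
                     (ℕ.+-assoc (suc (size β)) (sizeᴵ γ) y′)))
    (lo refl (append-flip p))
  plotᴵ-symmetric (nest β γ) (lo x≡ (hi y≡ p)) =
    lo y≡ (hi x≡ (plotᴵ-symmetric γ p))
  plotᴵ-symmetric (nest β γ) (lo x≡ (lo {x″} x′≡ p)) = hi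
    (trans x≡ (trans (cong (suc (size β) +_) x′≡) (trans
      (sym (ℕ.+-assoc (suc (size β)) (sizeᴵ γ) x″))
      (cong (_+ x″) (ℕ.+-comm (suc (size β)) (sizeᴵ γ))))))
    (append-flip p)

  -- Increasing subsequences.

  record Chain (P : Plot) (m : ℕ) : Set where
    field
      xs ys  : Fin m → ℕ
      on     : ∀ i → P (xs i) (ys i)
      x-mono : ∀ {i j} → i Fin.< j → xs i < xs j
      y-mono : ∀ {i j} → i Fin.< j → ys i < ys j

  open Chain

  chain-mono : P ⊆ Q → Chain P m → Chain Q m
  chain-mono f κ = record
    { xs = xs κ ; ys = ys κ ; on = f ∘ on κ ; x-mono = x-mono κ ; y-mono = y-mono κ }

  chain-flip : Chain P m → Chain (flip P) m
  chain-flip κ = record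
    { xs = ys κ ; ys = xs κ ; on = on κ ; x-mono = y-mono κ ; y-mono = x-mono κ }

  chain-[] : Chain P 0
  chain-[] = record
    { xs = λ () ; ys = λ () ; on = λ ()
    ; x-mono = λ { {()} } ; y-mono = λ { {()} } }

  chain-hi : Chain P m → Chain (Skew a b P Q) m
  chain-hi {b = b} κ = record
    { xs = xs κ ; ys = λ i → b + ys κ i ; on = λ i → hi refl (on κ i)
    ; x-mono = x-mono κ ; y-mono = λ i<j → ℕ.+-monoʳ-< b (y-mono κ i<j) }

  chain-lo : Chain Q m → Chain (Skew a b P Q) m
  chain-lo {a = a} κ = record
    { xs = λ i → a + xs κ i ; ys = ys κ ; on = λ i → lo refl (on κ i)
    ; x-mono = λ i<j → ℕ.+-monoʳ-< a (x-mono κ i<j) ; y-mono = y-mono κ }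

  chain-append : IsPermutation n P → Chain P m → Chain (Append n P) (suc m)
  chain-append {n} {P} {m} π κ = record
    { xs = λ i → at (xs κ) (view i)
    ; ys = λ i → at (ys κ) (view i)
    ; on = λ i → on′ (view i)
    ; x-mono = λ {i} {j} → mono (xs κ) (x<n π ∘ on κ) (x-mono κ) (view i) (view j)
    ; y-mono = λ {i} {j} → mono (ys κ) (y<n π ∘ on κ) (y-mono κ) (view i) (view j)
    }
    where
    at : (Fin m → ℕ) → {i : Fin (suc m)} → View i → ℕ
    at f ‵fromℕ       = n
    at f (‵inject₁ i) = f i

    on′ : {i : Fin (suc m)} (v : View i) → Append n P (at (xs κ) v) (at (ys κ) v)
    on′ ‵fromℕ       = new refl refl
    on′ (‵inject₁ i) = old (on κ i)

    mono : (f : Fin m → ℕ) → (∀ i → f i < n) → (∀ {i j} → i Fin.< j → f i < f j) →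
           ∀ {i j} (v : View i) (w : View j) → i Fin.< j → at f v < at f w
    mono f f<n f-mono {j = j} ‵fromℕ w i<j =
      contradiction (subst (ℕ._< Fin.toℕ j) (Fin.toℕ-fromℕ m) i<j) (ℕ.≤⇒≯ (Fin.toℕ≤pred[n] j))
    mono f f<n f-mono (‵inject₁ i) ‵fromℕ i<j = f<n i
    mono f f<n f-mono (‵inject₁ i) (‵inject₁ j) i<j =
      f-mono (ℕ.≤-trans (ℕ.≤-trans (s≤s (ℕ.≤-reflexive (sym (Fin.toℕ-inject₁ i)))) i<j)
                        (ℕ.≤-reflexive (Fin.toℕ-inject₁ j)))

  -- Only the last point of a chain can be the new one, since nothing lies to the right of it.
  -- Dropping the last point, new or not, leaves a chain of `P`.
  chain-unappend : IsPermutation n P → Chain (Append n P) (suc m) → Chain P m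
  chain-unappend {n} {P} {m} π κ = record
    { xs = xs κ ∘ Fin.inject₁ ; ys = ys κ ∘ Fin.inject₁
    ; on = λ i → old′ i (on κ (Fin.inject₁ i))
    ; x-mono = λ {i} {j} i<j → x-mono κ (inject₁-mono i j i<j)
    ; y-mono = λ {i} {j} i<j → y-mono κ (inject₁-mono i j i<j)
    }
    where
    inject₁-mono : ∀ (i j : Fin m) → i Fin.< j → Fin.inject₁ i Fin.< Fin.inject₁ j
    inject₁-mono i j i<j rewrite Fin.toℕ-inject₁ i | Fin.toℕ-inject₁ j = i<j

    old′ : ∀ i → Append n P (xs κ (Fin.inject₁ i)) (ys κ (Fin.inject₁ i)) →
           P (xs κ (Fin.inject₁ i)) (ys κ (Fin.inject₁ i))
    old′ i (old p)     = p
    old′ i (new x≡n _) = contradiction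
      (x<n (append-permutation π) (on κ (Fin.fromℕ m)))
      (ℕ.≤⇒≯ (subst (_< xs κ (Fin.fromℕ m)) x≡n (x-mono κ
        (subst (Fin.inject₁ i Fin.<_) refl
          (subst (Fin.toℕ (Fin.inject₁ i) <_) (sym (Fin.toℕ-fromℕ m))
            (Fin.inject₁ℕ< i))))))

  -- A skew sum has no increasing pair with a point in each summand.
  chain-split : IsPermutation a P → IsPermutation b Q → S ⊆ Skew a b P Q → Chain S m →
    Chain (λ x y → P x y × S x (b + y)) m ⊎ Chain (λ x y → Q x y × S (a + x) y) m
  chain-split {m = zero} π ρ f κ = inj₁ chain-[]
  chain-split {a} {P} {b} {Q} {S} {m = suc m} π ρ f κ with f (on κ zero)
  -- The first point decides for the whole chain: later points in `Q` would lie below it. In the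
  -- other case, later points in `P` would lie to its left.
  ... | hi y₀≡ p = inj₁ (record
    { xs = xs κ ; ys = proj₁ ∘ all-hi
    ; on = λ i → let y , y≡ , p = all-hi i in p , subst (S (xs κ i)) y≡ (on κ i)
    ; x-mono = x-mono κ
    ; y-mono = λ {i} {j} i<j → ℕ.+-cancelˡ-< b _ _
        (subst₂ _<_ (proj₁ (proj₂ (all-hi i))) (proj₁ (proj₂ (all-hi j))) (y-mono κ i<j))
    })
    where
    all-hi : ∀ i → ∃ λ y → ys κ i ≡ b + y × P (xs κ i) y
    all-hi zero    = _ , y₀≡ , p
    all-hi (suc i) with f (on κ (suc i))
    ... | hi y≡ p = _ , y≡ , p
    ... | lo _ q  = contradiction
      (subst (_< ys κ (suc i)) y₀≡ (y-mono κ {zero} {suc i} (s≤s z≤n)))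
      (ℕ.<-asym (ℕ.<-≤-trans (y<n ρ q) (ℕ.m≤m+n b _)))
  ... | lo x₀≡ q = inj₂ (record
    { xs = proj₁ ∘ all-lo ; ys = ys κ
    ; on = λ i → let x , x≡ , q = all-lo i in q , subst (λ x → S x (ys κ i)) x≡ (on κ i)
    ; x-mono = λ {i} {j} i<j → ℕ.+-cancelˡ-< a _ _
        (subst₂ _<_ (proj₁ (proj₂ (all-lo i))) (proj₁ (proj₂ (all-lo j))) (x-mono κ i<j))
    ; y-mono = y-mono κ
    })
    where
    all-lo : ∀ i → ∃ λ x → xs κ i ≡ a + x × Q x (ys κ i)
    all-lo zero    = _ , x₀≡ , q
    all-lo (suc i) with f (on κ (suc i))
    ... | lo x≡ q = _ , x≡ , q
    ... | hi _ p  = contradiction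
      (subst (_< xs κ (suc i)) x₀≡ (x-mono κ {zero} {suc i} (s≤s z≤n)))
      (ℕ.<-asym (ℕ.<-≤-trans (x<n π p) (ℕ.m≤m+n a _)))

  append-chain-≤ : IsPermutation n P → (∀ {m} → Chain P m → m ≤ c) →
                   Chain (Append n P) m → m ≤ suc c
  append-chain-≤ {m = zero}  π h κ = z≤n
  append-chain-≤ {m = suc m} π h κ = s≤s (h (chain-unappend π κ))

  append-chain-≥ : IsPermutation n P → (∀ {m} → m ≤ c → Chain P m) →
                   m ≤ suc c → Chain (Append n P) m
  append-chain-≥ {m = zero}  π h _         = chain-[]
  append-chain-≥ {m = suc m} π h (s≤s m≤c) = chain-append π (h m≤c)

  height-≤ : ∀ T → Chain (plot T) m → m ≤ height T
  append-height-≤ : ∀ T → Chain (Append (size T) (plot T)) m → m ≤ suc (height T)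

  height-≤ {m = zero}  leaf κ = z≤n
  height-≤ {m = suc m} leaf κ = contradiction (on κ zero) λ ()
  height-≤ (node l r) κ
    with chain-split (append-permutation (plot-permutation l)) (plot-permutation r) id κ
  ... | inj₁ κˡ = ℕ.m≤n⇒m≤n⊔o (height r) (append-height-≤ l (chain-mono proj₁ κˡ))
  ... | inj₂ κʳ = ℕ.m≤n⇒m≤o⊔n (suc (height l)) (height-≤ r (chain-mono proj₁ κʳ))

  append-height-≤ T = append-chain-≤ (plot-permutation T) (height-≤ T)

  height-≥ : ∀ T → m ≤ height T → Chain (plot T) m
  append-height-≥ : ∀ T → m ≤ suc (height T) → Chain (Append (size T) (plot T)) m

  height-≥ leaf z≤n = chain-[]
  height-≥ {m} (node l r) m≤ with ℕ.⊔-sel (suc (height l)) (height r)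
  ... | inj₁ eq = chain-hi (append-height-≥ l (subst (m ≤_) eq m≤))
  ... | inj₂ eq = chain-lo (height-≥ r (subst (m ≤_) eq m≤))

  append-height-≥ T = append-chain-≥ (plot-permutation T) (height-≥ T)

  -- `S` carries the position of the points relative to the corner of an occurrence through the
  -- splitting. The two outer blocks give the same bound, because the transpose of a chain is a
  -- chain.
  nest-split : ∀ β γ → S ⊆ plotᴵ (nest β γ) → Chain S m → m ≤ suc (height β) ⊎
    Chain (λ x y → plotᴵ γ x y × S (suc (size β) + x) (suc (size β) + y)) m
  nest-split {S} β γ f κ
    with chain-split (append-permutation (plot-permutation β))
           (skew-permutation (plotᴵ-permutation γ)
             (append-permutation (flip-permutation (plot-permutation β)))) f κ
  ... | inj₁ κ′ = inj₁ (append-height-≤ β (chain-mono proj₁ κ′))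
  ... | inj₂ κ′
    with chain-split (plotᴵ-permutation γ)
           (append-permutation (flip-permutation (plot-permutation β))) proj₁ κ′
  ...   | inj₁ κ″ = inj₂ (chain-mono (λ (p , _ , s) → p , s) κ″)
  ...   | inj₂ κ″ = inj₁ (append-height-≤ β
    (chain-mono append-flip (chain-flip (chain-mono proj₁ κ″))))

  heightᴵ-≤ : ∀ δ → Chain (plotᴵ δ) m → m ≤ heightᴵ δ
  heightᴵ-≤ {m = zero}  ε κ = z≤n
  heightᴵ-≤ {m = suc m} ε κ = contradiction (on κ zero) λ ()
  heightᴵ-≤ (fix γ) κ = append-chain-≤ (plotᴵ-permutation γ) (heightᴵ-≤ γ) κ
  heightᴵ-≤ (nest β γ) κ with nest-split β γ id κ
  ... | inj₁ m≤ = ℕ.m≤n⇒m≤n⊔o (heightᴵ γ) m≤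
  ... | inj₂ κ′ = ℕ.m≤n⇒m≤o⊔n (suc (height β)) (heightᴵ-≤ γ (chain-mono proj₁ κ′))

  heightᴵ-≥ : ∀ δ → m ≤ heightᴵ δ → Chain (plotᴵ δ) m
  heightᴵ-≥ ε z≤n = chain-[]
  heightᴵ-≥ (fix γ) m≤ = append-chain-≥ (plotᴵ-permutation γ) (heightᴵ-≥ γ) m≤
  heightᴵ-≥ {m} (nest β γ) m≤ with ℕ.⊔-sel (suc (height β)) (heightᴵ γ)
  ... | inj₁ eq = chain-hi (append-height-≥ β (subst (m ≤_) eq m≤))
  ... | inj₂ eq = chain-lo (chain-hi (heightᴵ-≥ γ (subst (m ≤_) eq m≤)))

  -- An occurrence of the pattern [ c + d , d ]: increasing subsequences of
  -- lengths c and d, the second lying below and to the right of the first.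
  record Occurrence (P : Plot) (c d : ℕ) : Set where
    field
      x₀ y₀ : ℕ
      upper : Chain (λ x y → P x y × x < x₀ × y₀ ≤ y) c
      lower : Chain (λ x y → P x y × x₀ ≤ x × y < y₀) d

  open Occurrence

  occurrence-mono : P ⊆ Q → Occurrence P c d → Occurrence Q c d
  occurrence-mono f o = record
    { x₀ = x₀ o ; y₀ = y₀ o
    ; upper = chain-mono (λ (p , r) → f p , r) (upper o)
    ; lower = chain-mono (λ (p , r) → f p , r) (lower o) }

  good-avoids : 1 ≤ d → d ≤ c → ∀ δ → Good c d δ → ¬ Occurrence (plotᴵ δ) c d
  good-avoids (s≤s _) (s≤s _) ε g o = proj₁ (on (upper o) zero)
  -- Both runs being nonempty, neither coordinate of the corner exceeds `sizeᴵ γ`; so the new point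
  -- is neither left of the corner nor below it.
  good-avoids {suc d} {suc c} 1≤d d≤c (fix γ) g o = good-avoids 1≤d d≤c γ g record
    { x₀ = x₀ o ; y₀ = y₀ o
    ; upper = chain-mono (λ
        { (old p , r) → p , r
        ; (new refl _ , x<x₀ , _) → contradiction x₀≤n (ℕ.<⇒≱ x<x₀) }) (upper o)
    ; lower = chain-mono (λ
        { (old p , r) → p , r
        ; (new _ refl , _ , y<y₀) → contradiction y₀≤n (ℕ.<⇒≱ y<y₀) }) (lower o)
    }
    where
    π = plotᴵ-permutation (fix γ)
    x₀≤n : x₀ o ≤ sizeᴵ γ
    x₀≤n = let q , x₀≤x , _ = on (lower o) zero in ℕ.≤-trans x₀≤x (ℕ.≤-pred (x<n π q))
    y₀≤n : y₀ o ≤ sizeᴵ γ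
    y₀≤n = let p , _ , y₀≤y = on (upper o) zero in ℕ.≤-trans y₀≤y (ℕ.≤-pred (y<n π p))
  good-avoids {d} {c} 1≤d d≤c (nest β γ) (β<c , g) o with nest-split β γ proj₁ (upper o)
  ... | inj₁ c≤β = contradiction c≤β (ℕ.<⇒≱ β<c)
  ... | inj₂ κ with g
  ...   | inj₂ (_ , γ<c) =
    contradiction (heightᴵ-≤ γ (chain-mono proj₁ κ)) (ℕ.<⇒≱ γ<c)
  ...   | inj₁ (β<d , γ-good) with nest-split β γ proj₁ (lower o)
  ...     | inj₁ d≤β = contradiction d≤β (ℕ.<⇒≱ β<d)
  ...     | inj₂ κ′ = good-avoids 1≤d d≤c γ γ-good record
    -- Both runs lie in the middle block, whose coordinates start at `s`; the corner is moved along
    -- with them.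
    { x₀ = x₀ o ∸ s ; y₀ = y₀ o ∸ s
    ; upper = chain-mono (λ (p , _ , x<x₀ , y₀≤y) →
        p , <-∸ x<x₀ , ℕ.m≤n+o⇒m∸n≤o (y₀ o) s y₀≤y) κ
    ; lower = chain-mono (λ (p , _ , x₀≤x , y<y₀) →
        p , ℕ.m≤n+o⇒m∸n≤o (x₀ o) s x₀≤x , <-∸ y<y₀) κ′
    }
    where
    s = suc (size β)
    <-∸ : ∀ {x z} → s + x < z → x < z ∸ s
    <-∸ {x} {z} s+x<z =
      ℕ.m+n≤o⇒m≤o∸n (suc x) (subst (_≤ z) (cong suc (ℕ.+-comm s x)) s+x<z)

  -- A disjunction, so that a failure of `Good` comes with an explicit occurrence. The comparisons
  -- of heights with `c` and `d` determine which blocks provide its runs.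
  good-or-occurrence : d ≤ c → ∀ δ → Good c d δ ⊎ Occurrence (plotᴵ δ) c d
  good-or-occurrence d≤c ε = inj₁ tt
  good-or-occurrence d≤c (fix γ) with good-or-occurrence d≤c γ
  ... | inj₁ g = inj₁ g
  ... | inj₂ o = inj₂ (occurrence-mono old o)
  good-or-occurrence {d} {c} d≤c (nest β γ) = cases
    (suc (height β) <? c) (suc (height β) <? d) (heightᴵ γ <? c) (good-or-occurrence d≤c γ)
    where
    s = suc (size β)
    k = sizeᴵ γ
    π = append-permutation (plot-permutation β)

    top : ∀ {e} → e ≤ suc (height β) →
          Chain (λ x y → plotᴵ (nest β γ) x y × x < s × k + s ≤ y) e
    top e≤ = record
      { xs = xs κ ; ys = λ i → k + s + ys κ i
      ; on = λ i → hi refl (on κ i) , x<n π (on κ i) , ℕ.m≤m+n (k + s) (ys κ i)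
      ; x-mono = x-mono κ ; y-mono = λ i<j → ℕ.+-monoʳ-< (k + s) (y-mono κ i<j) }
      where κ = append-height-≥ β e≤

    bottom : ∀ {e} → e ≤ suc (height β) →
             Chain (λ x y → plotᴵ (nest β γ) x y × s + k ≤ x × y < s) e
    bottom e≤ = record
      { xs = λ i → s + (k + ys κ i) ; ys = xs κ
      ; on = λ i → lo refl (lo refl (append-flip (on κ i))) ,
          ℕ.≤-trans (ℕ.m≤m+n (s + k) (ys κ i)) (ℕ.≤-reflexive (ℕ.+-assoc s k (ys κ i))) ,
          x<n π (on κ i)
      ; x-mono = λ i<j → ℕ.+-monoʳ-< s (ℕ.+-monoʳ-< k (y-mono κ i<j)) ; y-mono = x-mono κ }
      where κ = append-height-≥ β e≤

    middle : ∀ {e} → e ≤ heightᴵ γ →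
             Chain (λ x y → plotᴵ (nest β γ) x y × x < s + k × s ≤ y) e
    middle e≤ = record
      { xs = λ i → s + xs κ i ; ys = λ i → s + ys κ i
      ; on = λ i → lo refl (hi refl (on κ i)) ,
          ℕ.+-monoʳ-< s (x<n (plotᴵ-permutation γ) (on κ i)) , ℕ.m≤m+n s (ys κ i)
      ; x-mono = λ i<j → ℕ.+-monoʳ-< s (x-mono κ i<j)
      ; y-mono = λ i<j → ℕ.+-monoʳ-< s (y-mono κ i<j) }
      where κ = heightᴵ-≥ γ e≤

    cases : Dec (suc (height β) < c) → Dec (suc (height β) < d) → Dec (heightᴵ γ < c) →
            Good c d γ ⊎ Occurrence (plotᴵ γ) c d →
            Good c d (nest β γ) ⊎ Occurrence (plotᴵ (nest β γ)) c d
    -- Both runs in the outer blocks: the last one is as high as the first, hence high enough for a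
    -- run of length `d ≤ c`.
    cases (no β≮c) _ _ _ = inj₂ record
      { x₀ = s ; y₀ = k + s
      ; upper = top (ℕ.≮⇒≥ β≮c)
      ; lower = chain-mono (λ (p , s+m≤x , y<s) →
          p , ℕ.≤-trans (ℕ.m≤m+n s k) s+m≤x , ℕ.<-≤-trans y<s (ℕ.m≤n+m s k))
          (bottom (ℕ.≤-trans d≤c (ℕ.≮⇒≥ β≮c))) }
    cases (yes β<c) (yes β<d) _ (inj₁ g) = inj₁ (β<c , inj₁ (β<d , g))
    cases (yes β<c) (yes β<d) _ (inj₂ o) = inj₂ record
      { x₀ = s + x₀ o ; y₀ = s + y₀ o
      ; upper = shift-chain (upper o) λ (p , x<x₀ , y₀≤y) →
          lo refl (hi refl p) , ℕ.+-monoʳ-< s x<x₀ , ℕ.+-monoʳ-≤ s y₀≤y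
      ; lower = shift-chain (lower o) λ (p , x₀≤x , y<y₀) →
          lo refl (hi refl p) , ℕ.+-monoʳ-≤ s x₀≤x , ℕ.+-monoʳ-< s y<y₀ }
      where
      shift-chain : ∀ {e} → Chain P e → (∀ {x y} → P x y → Q (s + x) (s + y)) → Chain Q e
      shift-chain κ f = record
        { xs = λ i → s + xs κ i ; ys = λ i → s + ys κ i ; on = f ∘ on κ
        ; x-mono = λ i<j → ℕ.+-monoʳ-< s (x-mono κ i<j)
        ; y-mono = λ i<j → ℕ.+-monoʳ-< s (y-mono κ i<j) }
    cases (yes β<c) (no β≮d) (yes γ<c) _ = inj₁ (β<c , inj₂ (ℕ.≮⇒≥ β≮d , γ<c))
    -- The longer run in `γ`, the shorter one in the last block.
    cases (yes β<c) (no β≮d) (no γ≮c) _ = inj₂ record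
      { x₀ = s + k ; y₀ = s
      ; upper = middle (ℕ.≮⇒≥ γ≮c) ; lower = bottom (ℕ.≮⇒≥ β≮d) }

  -- Avoidance of 132 by the plots.

  record Contains132 (P : Plot) : Set where
    field
      {x₁ x₂ x₃ y₁ y₂ y₃} : ℕ
      p₁ : P x₁ y₁
      p₂ : P x₂ y₂
      p₃ : P x₃ y₃
      x₁<x₂ : x₁ < x₂
      x₂<x₃ : x₂ < x₃
      y₁<y₃ : y₁ < y₃
      y₃<y₂ : y₃ < y₂

  contains132-mono : P ⊆ Q → Contains132 P → Contains132 Q
  contains132-mono f o = record
    { p₁ = f p₁ ; p₂ = f p₂ ; p₃ = f p₃
    ; x₁<x₂ = x₁<x₂ ; x₂<x₃ = x₂<x₃ ; y₁<y₃ = y₁<y₃ ; y₃<y₂ = y₃<y₂ }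
    where open Contains132 o

  -- 132 is an involution; transposing exchanges its last two points.
  contains132-flip : Contains132 (flip P) → Contains132 P
  contains132-flip o = record
    { p₁ = p₁ ; p₂ = p₃ ; p₃ = p₂
    ; x₁<x₂ = y₁<y₃ ; x₂<x₃ = y₃<y₂ ; y₁<y₃ = x₁<x₂ ; y₃<y₂ = x₂<x₃ }
    where open Contains132 o

  -- The new point is both the last and the highest, which no letter of 132 is.
  append-avoids132 : IsPermutation n P → ¬ Contains132 P → ¬ Contains132 (Append n P)
  append-avoids132 {n} {P} π avoids o = cases p₁ p₂ p₃
    where
    open Contains132 o
    π′ = append-permutation π
    cases : Append n P x₁ y₁ → Append n P x₂ y₂ → Append n P x₃ y₃ → ⊥
    cases (new refl _) _ _ = ℕ.<⇒≱ x₁<x₂ (ℕ.≤-pred (x<n π′ p₂))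
    cases (old _) (new refl _) _ = ℕ.<⇒≱ x₂<x₃ (ℕ.≤-pred (x<n π′ p₃))
    cases (old _) (old _) (new _ refl) = ℕ.<⇒≱ y₃<y₂ (ℕ.≤-pred (y<n π′ p₂))
    cases (old q₁) (old q₂) (old q₃) = avoids record
      { p₁ = q₁ ; p₂ = q₂ ; p₃ = q₃
      ; x₁<x₂ = x₁<x₂ ; x₂<x₃ = x₂<x₃ ; y₁<y₃ = y₁<y₃ ; y₃<y₂ = y₃<y₂ }

  -- The first letter of 132 is to the left of and below the others, so whichever summand contains
  -- it contains all three.
  skew-avoids132 : IsPermutation a P → IsPermutation b Q →
    ¬ Contains132 P → ¬ Contains132 Q → ¬ Contains132 (Skew a b P Q)
  skew-avoids132 {a} {P} {b} {Q} π ρ avoidsP avoidsQ o = cases p₁ p₂ p₃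
    where
    open Contains132 o
    cases : Skew a b P Q x₁ y₁ → Skew a b P Q x₂ y₂ → Skew a b P Q x₃ y₃ → ⊥
    cases (hi refl q₁) (hi refl q₂) (hi refl q₃) = avoidsP record
      { p₁ = q₁ ; p₂ = q₂ ; p₃ = q₃ ; x₁<x₂ = x₁<x₂ ; x₂<x₃ = x₂<x₃
      ; y₁<y₃ = ℕ.+-cancelˡ-< b _ _ y₁<y₃ ; y₃<y₂ = ℕ.+-cancelˡ-< b _ _ y₃<y₂ }
    cases (hi refl _) (lo _ q₂) _ = ℕ.m+n≮m b _
      (ℕ.<-trans (ℕ.<-trans y₁<y₃ y₃<y₂) (y<n ρ q₂))
    cases (hi refl _) (hi _ _) (lo _ q₃) = ℕ.m+n≮m b _ (ℕ.<-trans y₁<y₃ (y<n ρ q₃))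
    cases (lo refl q₁) (lo refl q₂) (lo refl q₃) = avoidsQ record
      { p₁ = q₁ ; p₂ = q₂ ; p₃ = q₃ ; y₁<y₃ = y₁<y₃ ; y₃<y₂ = y₃<y₂
      ; x₁<x₂ = ℕ.+-cancelˡ-< a _ _ x₁<x₂ ; x₂<x₃ = ℕ.+-cancelˡ-< a _ _ x₂<x₃ }
    cases (lo refl _) (hi _ q₂) _ = ℕ.m+n≮m a _ (ℕ.<-trans x₁<x₂ (x<n π q₂))
    cases (lo refl _) (lo _ _) (hi _ q₃) = ℕ.m+n≮m a _
      (ℕ.<-trans (ℕ.<-trans x₁<x₂ x₂<x₃) (x<n π q₃))

  plot-avoids132 : ∀ T → ¬ Contains132 (plot T)
  plot-avoids132 leaf o = Contains132.p₁ o
  plot-avoids132 (node l r) =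
    skew-avoids132 (append-permutation (plot-permutation l)) (plot-permutation r)
      (append-avoids132 (plot-permutation l) (plot-avoids132 l)) (plot-avoids132 r)

  plotᴵ-avoids132 : ∀ δ → ¬ Contains132 (plotᴵ δ)
  plotᴵ-avoids132 ε o = Contains132.p₁ o
  plotᴵ-avoids132 (fix γ) = append-avoids132 (plotᴵ-permutation γ) (plotᴵ-avoids132 γ)
  plotᴵ-avoids132 (nest β γ) = skew-avoids132 (append-permutation π)
    (skew-permutation (plotᴵ-permutation γ) (append-permutation (flip-permutation π)))
    (append-avoids132 π (plot-avoids132 β))
    (skew-avoids132 (plotᴵ-permutation γ) (append-permutation (flip-permutation π))
      (plotᴵ-avoids132 γ)
      (append-avoids132 (flip-permutation π) (plot-avoids132 β ∘ contains132-flip)))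
    where π = plot-permutation β

-- Existence and uniqueness of the code of an avoider.

module Decoding where
  open import Data.Nat using (_+_; _<_; _≤_; s≤s; z≤n)
  open import Data.Nat.Induction using (Acc; acc; <-wellFounded)
  open import Data.Fin as Fin using (Fin)
  import Data.Fin.Properties as Fin
  open import Data.Product using (∃; _×_; _,_; proj₁; proj₂)
  open import Data.Sum using (_⊎_; inj₁; inj₂)
  open import Function using (_∘_; flip)
  open import Relation.Binary using (tri<; tri≈; tri>)
  open import Relation.Nullary using (¬_; contradiction)
  open Trees
  open Plots
  open IsPermutation

  private
    variable
      P Q P′ Q′ : Plot
      a b a′ b′ n x y : ℕ

  append-cancel : IsPermutation n P → Append n P ⊆ Append n Q → P ⊆ Q
  append-cancel π f p with f (old p)
  ... | old q      = q
  ... | new refl _ = contradiction (x<n π p) (ℕ.n≮n _)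

  skew-cancel-hi : a ≡ a′ → b ≡ b′ → IsPermutation a P →
                   Skew a b P Q ⊆ Skew a′ b′ P′ Q′ → P ⊆ P′
  skew-cancel-hi {b = b} {P′ = P′} refl refl π f {x} p with f (hi refl p)
  ... | hi y≡ q   = subst (P′ x) (sym (ℕ.+-cancelˡ-≡ b _ _ y≡)) q
  ... | lo refl _ = contradiction (x<n π p) (ℕ.m+n≮m _ _)

  skew-cancel-lo : a ≡ a′ → IsPermutation a′ P′ →
                   Skew a b P Q ⊆ Skew a′ b′ P′ Q′ → Q ⊆ Q′
  skew-cancel-lo {a = a} {Q′ = Q′} refl π f {x} {y} q with f (lo refl q)
  ... | lo x≡ q′ = subst (λ x → Q′ x y) (sym (ℕ.+-cancelˡ-≡ a _ _ x≡)) q′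
  ... | hi _ p   = contradiction (x<n π p) (ℕ.m+n≮m _ _)

  -- `b + a` is the largest value of the skew sum. Its position reveals the size of the first block,
  -- from which the decomposition is recovered.
  top-of-skew : IsPermutation a P → IsPermutation b Q →
                Skew (suc a) b (Append a P) Q x (b + a) → x ≡ a
  top-of-skew {b = b} π ρ (hi y≡ (old p)) =
    contradiction (y<n π p) (ℕ.<⇒≱ (s≤s (ℕ.≤-reflexive (ℕ.+-cancelˡ-≡ b _ _ y≡))))
  top-of-skew π ρ (hi _ (new x≡ _)) = x≡
  top-of-skew π ρ (lo _ q)          = contradiction (y<n ρ q) (ℕ.m+n≮m _ _)

  skew-append-cancel : IsPermutation a P → IsPermutation a′ P′ → IsPermutation b′ Q′ →
    a + b ≡ a′ + b′ → Skew (suc a) b (Append a P) Q ⊆ Skew (suc a′) b′ (Append a′ P′) Q′ →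
    a ≡ a′ × b ≡ b′ × P ⊆ P′ × Q ⊆ Q′
  skew-append-cancel {a} {P} {a′} {P′} {b′} {Q′} {b} {Q} π π′ ρ′ sizes f =
    a≡ , b≡ , P⊆ a≡ (skew-cancel-hi (cong suc a≡) b≡ (append-permutation π) f) ,
    skew-cancel-lo (cong suc a≡) (append-permutation π′) f
    where
    a≡ : a ≡ a′
    a≡ = top-of-skew π′ ρ′ (subst (Skew (suc a′) b′ (Append a′ P′) Q′ a)
      (trans (ℕ.+-comm b a) (trans sizes (ℕ.+-comm a′ b′)))
      (f (hi refl (new refl refl))))

    b≡ : b ≡ b′
    b≡ = ℕ.+-cancelˡ-≡ a _ _ (trans sizes (cong (_+ b′) (sym a≡)))

    P⊆ : a ≡ a′ → Append a P ⊆ Append a′ P′ → P ⊆ P′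
    P⊆ refl g = append-cancel π g

  plot-injective : ∀ T T′ → size T ≡ size T′ → plot T ⊆ plot T′ → T ≡ T′
  plot-injective leaf       leaf         _     _ = refl
  plot-injective (node l r) (node l′ r′) sizes f =
    let l≡ , r≡ , l⊆ , r⊆ = skew-append-cancel (plot-permutation l) (plot-permutation l′)
                              (plot-permutation r′) (ℕ.suc-injective sizes) f
    in cong₂ node (plot-injective l l′ l≡ l⊆) (plot-injective r r′ r≡ r⊆)

  private
    -- In `fix γ` the maximum comes last. In `nest β′ γ′` it ends the first block, and a nonempty
    -- last block follows.
    fix≢nest : ∀ γ β′ γ′ → sizeᴵ (fix γ) ≡ sizeᴵ (nest β′ γ′) →
               ¬ plotᴵ (nest β′ γ′) (sizeᴵ γ) (sizeᴵ γ)
    fix≢nest γ β′ γ′ sizes p = ℕ.m+1+n≢m (size β′) (trans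
      (cong (size β′ +_) (sym (ℕ.+-suc (sizeᴵ γ′) (size β′))))
      (trans (sym (ℕ.suc-injective sizes)) (top-of-skew (plot-permutation β′)
        (skew-permutation (plotᴵ-permutation γ′)
          (append-permutation (flip-permutation (plot-permutation β′))))
        (subst (plotᴵ (nest β′ γ′) (sizeᴵ γ))
          (trans (ℕ.suc-injective sizes) (ℕ.+-comm (size β′) _)) p))))

  plotᴵ-injective : ∀ δ δ′ → sizeᴵ δ ≡ sizeᴵ δ′ → plotᴵ δ ⊆ plotᴵ δ′ → δ ≡ δ′
  plotᴵ-injective ε ε _ _ = refl
  plotᴵ-injective (fix γ) (fix γ′) sizes f = cong fix
    (plotᴵ-injective γ γ′ sizes′ (append-cancel (plotᴵ-permutation γ)
      (subst (λ n → plotᴵ (fix γ) ⊆ Append n (plotᴵ γ′)) (sym sizes′) f)))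
    where sizes′ = ℕ.suc-injective sizes
  plotᴵ-injective (fix γ) (nest β′ γ′) sizes f =
    contradiction (f (new refl refl)) (fix≢nest γ β′ γ′ sizes)
  plotᴵ-injective (nest β γ) (fix γ′) sizes f
    with column (plotᴵ-permutation (nest β γ)) {sizeᴵ γ′}
           (subst (sizeᴵ γ′ <_) (sym sizes) ℕ.≤-refl)
  ... | x , p with f p
  ...   | old q      = contradiction (y<n (plotᴵ-permutation γ′) q) (ℕ.n≮n _)
  ...   | new refl _ = contradiction p (fix≢nest γ′ β γ (sym sizes))
  plotᴵ-injective (nest β γ) (nest β′ γ′) sizes f =
    let πᵀ = append-permutation (flip-permutation (plot-permutation β′))
        β≡ , γβ≡ , β⊆ , γβ⊆ = skew-append-cancel (plot-permutation β) (plot-permutation β′)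
          (skew-permutation (plotᴵ-permutation γ′) πᵀ) (ℕ.suc-injective sizes) f
        γ≡ = ℕ.+-cancelʳ-≡ (suc (size β)) _ _
               (trans γβ≡ (cong (λ n → sizeᴵ γ′ + suc n) (sym β≡)))
    in cong₂ nest (plot-injective β β′ β≡ β⊆)
         (plotᴵ-injective γ γ′ γ≡ (skew-cancel-hi γ≡ (cong suc β≡) (plotᴵ-permutation γ) γβ⊆))

  -- The pigeonhole principle for a window of p columns and q rows.
  pigeonhole : ∀ {s p l q} → IsPermutation n P → s + p ≤ n →
    (∀ {x y} → s ≤ x → x < s + p → P x y → l ≤ y × y < l + q) → p ≤ q
  pigeonhole {n} {P} {s} {p} {l} {q} π s+p≤n window = Fin.injective⇒≤ {f = f} f-injective
    where
    value : (i : Fin p) → ∃ λ y → P (s + Fin.toℕ i) y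
    value i = row π (ℕ.<-≤-trans (ℕ.+-monoʳ-< s (Fin.toℕ<n i)) s+p≤n)

    bounds : ∀ i → l ≤ proj₁ (value i) × proj₁ (value i) < l + q
    bounds i = window (ℕ.m≤m+n s _) (ℕ.+-monoʳ-< s (Fin.toℕ<n i)) (proj₂ (value i))

    <q : ∀ i → proj₁ (value i) ∸ l < q
    -- Bounding the truncated difference requires `0 < q`; the value in the window itself provides
    -- this.
    <q i = ℕ.m<n+o⇒m∸n<o _ l {{ℕ.>-nonZero (≢0 (bounds i))}} (proj₂ (bounds i))
      where
      ≢0 : l ≤ proj₁ (value i) × proj₁ (value i) < l + q → 0 < q
      ≢0 (l≤y , y<l+q) = ℕ.+-cancelˡ-< l 0 q
        (subst (_< l + q) (sym (ℕ.+-identityʳ l)) (ℕ.≤-<-trans l≤y y<l+q))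

    f : Fin p → Fin q
    f i = Fin.fromℕ< (<q i)

    f-injective : ∀ {i j} → f i ≡ f j → i ≡ j
    f-injective {i} {j} eq = Fin.toℕ-injective (ℕ.+-cancelˡ-≡ s _ _ (injective π
      (proj₂ (value i)) (subst (P (s + Fin.toℕ j)) (sym y≡) (proj₂ (value j)))))
      where
      y≡ : proj₁ (value i) ≡ proj₁ (value j)
      y≡ = ℕ.∸-cancelʳ-≡ (proj₁ (bounds i)) (proj₁ (bounds j))
        (Fin.fromℕ<-injective _ _ (<q i) (<q j) eq)

  Left : (a b : ℕ) → Plot → Plot
  Left a b P x y = x < a × P x (b + y)

  module Split (π : IsPermutation (suc (a + b)) P) (avoids : ¬ Contains132 P)
               (top : P a (a + b)) where

    -- Otherwise the two points, with the maximum between them, would form 132.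
    left-above : ∀ {x y x′ y′} → x < a → a < x′ → P x y → P x′ y′ → y′ < y
    left-above {x} {y} {x′} {y′} x<a a<x′ p p′ with ℕ.<-cmp y′ y
    ... | tri< y′<y _ _ = y′<y
    ... | tri≈ _ refl _ = contradiction (injective π p p′) (ℕ.<⇒≢ (ℕ.<-trans x<a a<x′))
    ... | tri> _ _ y<y′ = contradiction record
      { p₁ = p ; p₂ = top ; p₃ = p′ ; x₁<x₂ = x<a ; x₂<x₃ = a<x′ ; y₁<y₃ = y<y′
      ; y₃<y₂ = ℕ.≤∧≢⇒< (ℕ.≤-pred (y<n π p′)) λ { refl → ℕ.<⇒≢ a<x′ (injective π top p′) } }
      avoids

    -- The `b` points to the right of the maximum all have values below `y`.
    left-high : x < a → P x y → b ≤ y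
    left-high x<a p = pigeonhole {s = suc a} {l = 0} π ℕ.≤-refl
      λ a<x′ _ p′ → z≤n , left-above x<a a<x′ p p′

    -- The `suc a` points up to and including the maximum have values above `y` and at most `a + b`.
    right-low : a < x → P x y → y < b
    right-low {x} {y} a<x p = ℕ.+-cancelˡ-≤ a _ _ (subst (_≤ a + b) (sym (ℕ.+-suc a y))
      (ℕ.m≤o∸n⇒m+n≤o (suc a) y≤ (pigeonhole {s = 0} {l = suc y} π (s≤s (ℕ.m≤m+n a b)) window)))
      where
      y≤ : y ≤ a + b
      y≤ = ℕ.≤-pred (y<n π p)

      window : ∀ {x′ y′} → 0 ≤ x′ → x′ < suc a → P x′ y′ →
               suc y ≤ y′ × y′ < suc y + (a + b ∸ y)
      window {x′} {y′} _ x′≤a p′ =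
        above (ℕ.m≤n⇒m<n∨m≡n (ℕ.≤-pred x′≤a)) ,
        subst (y′ <_) (cong suc (sym (ℕ.m+[n∸m]≡n y≤))) (y<n π p′)
        where
        above : x′ < a ⊎ x′ ≡ a → y < y′
        above (inj₁ x′<a) = left-above x′<a a<x p′ p
        above (inj₂ refl) = subst (y <_) (functional π top p′)
          (ℕ.≤∧≢⇒< y≤ λ { refl → ℕ.<⇒≢ a<x (injective π top p) })

    left-permutation : IsPermutation a (Left a b P)
    left-permutation = record
      { x<n = proj₁
      ; y<n = λ {x} {y} (x<a , p) → ℕ.≤∧≢⇒<
          (ℕ.+-cancelˡ-≤ b _ _ (subst (b + y ≤_) (ℕ.+-comm a b) (ℕ.≤-pred (y<n π p))))
          λ { refl → ℕ.<⇒≢ x<a (injective π p (subst (P a) (ℕ.+-comm a b) top)) }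
      ; row = row′
      ; column = column′
      ; functional = λ (_ , p) (_ , p′) → ℕ.+-cancelˡ-≡ b _ _ (functional π p p′)
      ; injective = λ (_ , p) (_ , p′) → injective π p p′
      }
      where
      row′ : ∀ {x} → x < a → ∃ λ y → Left a b P x y
      row′ x<a with y , p ← row π (ℕ.<-≤-trans x<a (ℕ.m≤n⇒m≤1+n (ℕ.m≤m+n a b)))
        with z , refl ← ℕ.m≤n⇒∃[o]m+o≡n (left-high x<a p) = z , x<a , p

      column′ : ∀ {y} → y < a → ∃ λ x → Left a b P x y
      column′ {y} y<a with x , p ← column π {b + y}
          (ℕ.<-≤-trans (ℕ.+-monoʳ-< b y<a)
            (ℕ.≤-trans (ℕ.≤-reflexive (ℕ.+-comm b a)) (ℕ.n≤1+n _)))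
        with ℕ.<-cmp x a
      ... | tri< x<a _ _  = x , x<a , p
      ... | tri≈ _ refl _ = contradiction
        (ℕ.+-cancelˡ-≡ b _ _ (trans (functional π p top) (ℕ.+-comm a b))) (ℕ.<⇒≢ y<a)
      ... | tri> _ _ a<x  = contradiction (right-low a<x p) (ℕ.m+n≮m b y)

    left-avoids132 : ¬ Contains132 (Left a b P)
    left-avoids132 o = avoids record
      { p₁ = proj₂ p₁ ; p₂ = proj₂ p₂ ; p₃ = proj₂ p₃ ; x₁<x₂ = x₁<x₂ ; x₂<x₃ = x₂<x₃
      ; y₁<y₃ = ℕ.+-monoʳ-< b y₁<y₃ ; y₃<y₂ = ℕ.+-monoʳ-< b y₃<y₂ }
      where open Contains132 o

    right-permutation : IsPermutation b (λ x y → P (suc a + x) y)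
    right-permutation = record
      { x<n = λ p → ℕ.+-cancelˡ-< (suc a) _ _ (x<n π p)
      ; y<n = right-low (s≤s (ℕ.m≤m+n a _))
      ; row = λ x<b → row π (ℕ.+-monoʳ-< (suc a) x<b)
      ; column = column′
      ; functional = functional π
      ; injective = λ p p′ → ℕ.+-cancelˡ-≡ (suc a) _ _ (injective π p p′)
      }
      where
      column′ : ∀ {y} → y < b → ∃ λ x → P (suc a + x) y
      column′ {y} y<b with x , p ← column π {y} (ℕ.<-≤-trans y<b (ℕ.m≤n+m b (suc a)))
        with ℕ.<-cmp x a
      ... | tri< x<a _ _  = contradiction (left-high x<a p) (ℕ.<⇒≱ y<b)
      ... | tri≈ _ refl _ = contradiction
        (subst (_< b) (functional π p top) y<b) (ℕ.m+n≮n a b)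
      ... | tri> _ _ a<x with z , refl ← ℕ.m≤n⇒∃[o]m+o≡n a<x = z , p

    right-avoids132 : ¬ Contains132 (λ x y → P (suc a + x) y)
    right-avoids132 o = avoids record
      { p₁ = p₁ ; p₂ = p₂ ; p₃ = p₃ ; y₁<y₃ = y₁<y₃ ; y₃<y₂ = y₃<y₂
      ; x₁<x₂ = ℕ.+-monoʳ-< (suc a) x₁<x₂ ; x₂<x₃ = ℕ.+-monoʳ-< (suc a) x₂<x₃ }
      where open Contains132 o

    split-⊆ : P ⊆ Skew (suc a) b (Append a (Left a b P)) (λ x y → P (suc a + x) y)
    split-⊆ {x} {y} p with ℕ.<-cmp x a
    ... | tri≈ _ refl _ = hi (trans (functional π p top) (ℕ.+-comm a b)) (new refl refl)
    ... | tri< x<a _ _ with z , refl ← ℕ.m≤n⇒∃[o]m+o≡n (left-high x<a p) =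
      hi refl (old (x<a , p))
    ... | tri> _ _ a<x with z , refl ← ℕ.m≤n⇒∃[o]m+o≡n a<x = lo refl p

  -- Well-founded recursion, as the blocks are plots and not subterms. An inclusion is all that is
  -- claimed; between permutations of equal size it is an equality.
  ∃tree : Acc _<_ n → IsPermutation n P → ¬ Contains132 P →
          ∃ λ T → size T ≡ n × P ⊆ plot T
  ∃tree {zero} _ π avoids = leaf , refl , λ p → contradiction (x<n π p) λ ()
  ∃tree {suc n} {P} (acc rec) π avoids with a , top ← column π {n} ℕ.≤-refl
    with b , refl ← ℕ.m≤n⇒∃[o]m+o≡n (ℕ.≤-pred (x<n π top)) =
    let open Split π avoids top
        l , l≡ , l⊆ = ∃tree (rec (s≤s (ℕ.m≤m+n a b))) left-permutation left-avoids132
        r , r≡ , r⊆ = ∃tree (rec (s≤s (ℕ.m≤n+m b a))) right-permutation right-avoids132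
    in node l r , cong suc (cong₂ _+_ l≡ r≡) ,
       λ p → subst₂ (λ m n → Skew (suc m) n (Append m (plot l)) (plot r) _ _)
         (sym l≡) (sym r≡) (skew-mono (append-mono l⊆) r⊆ (split-⊆ p))

  -- The size is written as two outer blocks of size `suc a` around a middle one of size `m`. By
  -- symmetry the last position, the mirror image of the maximum, has value `a`.
  module SymmetricSplit {a m : ℕ} (π : IsPermutation (suc (a + (m + suc a))) P)
    (avoids : ¬ Contains132 P) (symmetric : ∀ {x y} → P x y → P y x)
    (top : P a (a + (m + suc a))) where

    open Split π avoids top

    Middle : Plot
    Middle x y = x < m × P (suc a + x) (suc a + y)

    middle-bound : P (suc a + x) (suc a + y) → y < m
    middle-bound {x} {y} p = ℕ.+-cancelˡ-< (suc a) y m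
      (subst (suc a + y <_) (ℕ.+-comm m (suc a)) (right-low (s≤s (ℕ.m≤m+n a x)) p))

    -- The value cannot be below `a`: its mirror image would be a point of the left block with too
    -- small a value. Nor can it be `a`, which is taken at the last position.
    middle-row : x < m → ∃ λ y → Middle x y
    middle-row {x} x<m with y , p ← row π {suc a + x}
        (ℕ.+-monoʳ-< (suc a) (ℕ.<-≤-trans x<m (ℕ.m≤m+n m (suc a))))
      with ℕ.<-cmp y a
    ... | tri< y<a _ _  = contradiction (left-high y<a (symmetric p))
      (ℕ.<⇒≱ (subst (suc a + x <_) (ℕ.+-comm (suc a) m) (ℕ.+-monoʳ-< (suc a) x<m)))
    ... | tri≈ _ refl _ = contradiction
      (ℕ.+-cancelˡ-≡ a _ _ (trans (ℕ.+-suc a x) (functional π (symmetric p) top)))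
      (ℕ.<⇒≢ (ℕ.≤-<-trans x<m (ℕ.m<m+n m (s≤s z≤n))))
    ... | tri> _ _ a<y with z , refl ← ℕ.m≤n⇒∃[o]m+o≡n a<y = z , x<m , p

    middle-symmetric : Middle x y → Middle y x
    middle-symmetric (_ , p) = middle-bound p , symmetric p

    middle-permutation : IsPermutation m Middle
    middle-permutation = record
      { x<n = proj₁
      ; y<n = middle-bound ∘ proj₂
      ; row = middle-row
      ; column = λ y<m → let x , μ = middle-row y<m in x , middle-symmetric μ
      ; functional = λ (_ , p) (_ , p′) → ℕ.+-cancelˡ-≡ (suc a) _ _ (functional π p p′)
      ; injective = λ (_ , p) (_ , p′) → ℕ.+-cancelˡ-≡ (suc a) _ _ (injective π p p′)
      }

    middle-avoids132 : ¬ Contains132 Middle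
    middle-avoids132 o = right-avoids132 record
      { p₁ = proj₂ p₁ ; p₂ = proj₂ p₂ ; p₃ = proj₂ p₃ ; x₁<x₂ = x₁<x₂ ; x₂<x₃ = x₂<x₃
      ; y₁<y₃ = ℕ.+-monoʳ-< (suc a) y₁<y₃ ; y₃<y₂ = ℕ.+-monoʳ-< (suc a) y₃<y₂ }
      where open Contains132 o

    -- Among the points right of the maximum, those with value below `a` are the mirror images of
    -- the left block, and the one with value `a` is that of the maximum.
    symmetric-split-⊆ : P ⊆ Skew (suc a) (m + suc a) (Append a (Left a (m + suc a) P))
      (Skew m (suc a) Middle (Append a (flip (Left a (m + suc a) P))))
    symmetric-split-⊆ p with split-⊆ p
    ... | hi y≡ q = hi y≡ q
    ... | lo {x′} refl q = lo refl (inner q)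
      where
      inner : ∀ {x y} → P (suc a + x) y →
              Skew m (suc a) Middle (Append a (flip (Left a (m + suc a) P))) x y
      inner {x} {y} q with ℕ.<-cmp y a
      ... | tri< y<a _ _ with z , b+z≡ ← ℕ.m≤n⇒∃[o]m+o≡n (left-high y<a (symmetric q)) =
        lo (ℕ.+-cancelˡ-≡ (suc a) _ _ (trans (sym b+z≡) (trans
             (cong (_+ z) (ℕ.+-comm m (suc a))) (ℕ.+-assoc (suc a) m z))))
           (old (y<a , subst (P y) (sym b+z≡) (symmetric q)))
      ... | tri≈ _ refl _ = lo (ℕ.+-cancelˡ-≡ (suc a) _ _ (trans
             (functional π (symmetric q) top)
             (trans (cong (a +_) (ℕ.+-suc m a)) (ℕ.+-suc a (m + a)))))
           (new refl refl)
      ... | tri> _ _ a<y with z , refl ← ℕ.m≤n⇒∃[o]m+o≡n a<y =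
        hi refl (middle-bound (symmetric q) , q)

  ∃involution : Acc _<_ n → IsPermutation n P → ¬ Contains132 P →
    (∀ {x y} → P x y → P y x) → ∃ λ δ → sizeᴵ δ ≡ n × P ⊆ plotᴵ δ
  ∃involution {zero} _ π avoids _ = ε , refl , λ p → contradiction (x<n π p) λ ()
  ∃involution {suc n} {P} (acc rec) π avoids symmetric with a , top ← column π {n} ℕ.≤-refl
    with ℕ.m≤n⇒∃[o]m+o≡n (ℕ.≤-pred (x<n π top))
  -- The maximum is in the last position, hence a fixed point; removing it gives the argument of
  -- `fix`.
  ... | zero , a+0≡n =
    let γ , γ≡ , γ⊆ = ∃involution (rec ℕ.≤-refl) π′ avoids′
          λ (x<n , p) → <n p x<n , symmetric p
    in fix γ , cong suc γ≡ , λ p → subst (λ m → Append m (plotᴵ γ) _ _) (sym γ≡)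
         (append-mono γ⊆ (split p))
    where
    R : Plot
    R x y = x < n × P x y

    a≡n : a ≡ n
    a≡n = trans (sym (ℕ.+-identityʳ a)) a+0≡n

    corner : P n n
    corner = subst (λ a → P a n) a≡n top

    <n : P x y → x < n → y < n
    <n p x<n = ℕ.≤∧≢⇒< (ℕ.≤-pred (y<n π p)) λ { refl → ℕ.<⇒≢ x<n (injective π p corner) }

    π′ : IsPermutation n R
    π′ = record
      { x<n = proj₁
      ; y<n = λ (x<n , p) → <n p x<n
      ; row = λ x<n → let y , p = row π (ℕ.m<n⇒m<1+n x<n) in y , x<n , p
      ; column = λ y<n → let x , p = column π (ℕ.m<n⇒m<1+n y<n) in x , <n (symmetric p) y<n , p
      ; functional = λ (_ , p) (_ , p′) → functional π p p′
      ; injective = λ (_ , p) (_ , p′) → injective π p p′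
      }

    avoids′ : ¬ Contains132 R
    avoids′ o = avoids record
      { p₁ = proj₂ p₁ ; p₂ = proj₂ p₂ ; p₃ = proj₂ p₃ ; x₁<x₂ = x₁<x₂ ; x₂<x₃ = x₂<x₃
      ; y₁<y₃ = y₁<y₃ ; y₃<y₂ = y₃<y₂ }
      where open Contains132 o

    split : P ⊆ Append n R
    split p with ℕ.m≤n⇒m<n∨m≡n (ℕ.≤-pred (x<n π p))
    ... | inj₁ x<n  = old (x<n , p)
    ... | inj₂ refl = new refl (functional π p corner)
  -- The mirror image of the maximum lies to its right and has value `a`, so `right-low` yields
  -- `a < suc b`: the right part has room for the transposed block, and `m` is what remains.
  ... | suc b , refl with m , a+1+m≡ ← ℕ.m≤n⇒∃[o]m+o≡n
      (Split.right-low π avoids top (ℕ.m<m+n a (s≤s z≤n)) (symmetric top)) =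
    assemble (trans (sym a+1+m≡) (ℕ.+-comm (suc a) m))
    where
    assemble : ∀ {m} → suc b ≡ m + suc a → ∃ λ δ → sizeᴵ δ ≡ suc (a + suc b) × P ⊆ plotᴵ δ
    assemble {m} b≡ rewrite b≡ =
      let open Split π avoids top
          open SymmetricSplit {m = m} π avoids symmetric top
          β , β≡ , β⊆ = ∃tree (<-wellFounded a) left-permutation left-avoids132
          γ , γ≡ , γ⊆ = ∃involution
            (rec {m} (s≤s (ℕ.≤-trans (ℕ.m≤m+n m (suc a)) (ℕ.m≤n+m _ a))))
            middle-permutation middle-avoids132 middle-symmetric
      in nest β γ , cong₂ (λ a m → suc a + (m + suc a)) β≡ γ≡ ,
         λ p → subst₂ (λ a m → Skew (suc a) (m + suc a) (Append a (plot β))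
                        (Skew m (suc a) (plotᴵ γ) (Append a (flip (plot β)))) _ _)
           (sym β≡) (sym γ≡)
           (skew-mono (append-mono β⊆) (skew-mono γ⊆ (append-mono β⊆)) (symmetric-split-⊆ p))

-- Words in one-line notation and their codes.

module Words where
  open import Defs using (IsInvolution; Contains; ⟨132⟩; [_,_]; Counted; counted?; words; I)
  open import Data.Nat using (_+_; _<_; _≤_; s≤s; z≤n)
  open import Data.Nat.Induction using (<-wellFounded)
  open import Data.Fin as Fin using (Fin; zero; suc; toℕ; fromℕ<; _↑ˡ_; _↑ʳ_; #_)
  import Data.Fin.Properties as Fin
  open import Data.List as List using (List; length; filter)
  open import Data.List.Membership.Propositional using (_∈_)
  open import Data.List.Membership.Propositional.Properties
    using (∈-cartesianProductWith⁺; ∈-allFin; ∈-filter⁺; ∈-filter⁻)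
  open import Data.List.Relation.Unary.All using ([])
  open import Data.List.Relation.Unary.AllPairs using ([]; _∷_)
  open import Data.List.Relation.Unary.Any using (here)
  open import Data.List.Relation.Unary.Unique.Propositional using (Unique)
  import Data.List.Relation.Unary.Unique.Propositional.Properties as Unique
  open import Data.Product using (∃; _×_; _,_; proj₁; proj₂)
  open import Data.Sum using (_⊎_; inj₁; inj₂)
  open import Data.Unit using (tt)
  open import Data.Vec as Vec using (Vec; []; _∷_; lookup; tabulate)
  open import Data.Vec.Properties
    using (lookup-++ˡ; lookup-++ʳ; lookup∘tabulate; tabulate∘lookup; tabulate-cong; ∷-injective)
  open import Function using (_∘_; _⇔_; mk⇔; Equivalence)
  open import Relation.Binary using (tri<; tri≈; tri>)
  open import Relation.Nullary using (contradiction)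
  open Counting
  open Trees
  open Plots
  open Decoding
  open IsPermutation
  open Chain
  open Occurrence

  private
    variable
      n : ℕ

  Graph : Vec (Fin n) n → Plot
  Graph α x y = ∃ λ i → toℕ i ≡ x × toℕ (lookup α i) ≡ y

  graph-symmetric : {α : Vec (Fin n) n} → IsInvolution α →
                    ∀ {x y} → Graph α x y → Graph α y x
  graph-symmetric {α = α} inv (i , x≡ , y≡) =
    lookup α i , y≡ , trans (cong toℕ (inv i)) x≡

  -- The graph of an involution is symmetric, so `row` also yields `column`, and functionality also
  -- yields injectivity.
  graph-permutation : {α : Vec (Fin n) n} → IsInvolution α → IsPermutation n (Graph α)
  graph-permutation {n} {α} inv = record
    { x<n = λ { (i , refl , _) → Fin.toℕ<n i }
    ; y<n = λ { (i , _ , refl) → Fin.toℕ<n (lookup α i) }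
    ; row = row′
    ; column = λ y<n → let x , p = row′ y<n in x , graph-symmetric {α = α} inv p
    ; functional = functional′
    ; injective = λ p p′ →
        functional′ (graph-symmetric {α = α} inv p) (graph-symmetric {α = α} inv p′)
    }
    where
    row′ : ∀ {x} → x < n → ∃ λ y → Graph α x y
    row′ x<n = toℕ (lookup α (fromℕ< x<n)) , fromℕ< x<n , Fin.toℕ-fromℕ< x<n , refl

    functional′ : ∀ {x y y′} → Graph α x y → Graph α x y′ → y ≡ y′
    functional′ (i , refl , y≡) (j , j≡i , y′≡) = trans (sym y≡)
      (trans (cong (toℕ ∘ lookup α) (Fin.toℕ-injective (sym j≡i))) y′≡)

  -- As τ has distinct letters, one direction of the order isomorphism suffices.
  orderIsomorphic : ∀ {k} (τ : Vec ℕ k) (v : Fin k → ℕ) →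
    (∀ a b → lookup τ a < lookup τ b → v a < v b) →
    (∀ a b → lookup τ a ≡ lookup τ b → a ≡ b) →
    ∀ a b → v a < v b ⇔ lookup τ a < lookup τ b
  orderIsomorphic τ v mono distinct a b = mk⇔ reflect (mono a b)
    where
    reflect : v a < v b → lookup τ a < lookup τ b
    reflect va<vb with ℕ.<-cmp (lookup τ a) (lookup τ b)
    ... | tri< τa<τb _ _ = τa<τb
    ... | tri≈ _ τa≡τb _ =
      contradiction (cong v (distinct a b τa≡τb)) (ℕ.<⇒≢ va<vb)
    ... | tri> _ _ τb<τa = contradiction (mono b a τb<τa) (ℕ.<⇒≯ va<vb)

  contains⇒132 : {α : Vec (Fin n) n} → Contains α ⟨132⟩ → Contains132 (Graph α)
  contains⇒132 (i , increasing , iso) = record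
    { p₁ = lookup i (# 0) , refl , refl
    ; p₂ = lookup i (# 1) , refl , refl
    ; p₃ = lookup i (# 2) , refl , refl
    ; x₁<x₂ = increasing (# 0) (# 1) (s≤s z≤n)
    ; x₂<x₃ = increasing (# 1) (# 2) (s≤s (s≤s z≤n))
    ; y₁<y₃ = Equivalence.from (iso (# 0) (# 2)) (s≤s (s≤s z≤n))
    ; y₃<y₂ = Equivalence.from (iso (# 2) (# 1)) (s≤s (s≤s (s≤s z≤n)))
    }

  132⇒contains : {α : Vec (Fin n) n} → Contains132 (Graph α) → Contains α ⟨132⟩
  132⇒contains {n} {α} record
    { p₁ = i₁ , refl , refl ; p₂ = i₂ , refl , refl ; p₃ = i₃ , refl , refl
    ; x₁<x₂ = x₁<x₂ ; x₂<x₃ = x₂<x₃ ; y₁<y₃ = y₁<y₃ ; y₃<y₂ = y₃<y₂ } =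
    i , increasing , orderIsomorphic ⟨132⟩ (λ a → toℕ (lookup α (lookup i a))) mono distinct
    where
    i : Vec (Fin n) 3
    i = i₁ ∷ i₂ ∷ i₃ ∷ []

    increasing : ∀ a b → a Fin.< b → lookup i a Fin.< lookup i b
    increasing zero             (suc zero)       _ = x₁<x₂
    increasing zero             (suc (suc zero)) _ = ℕ.<-trans x₁<x₂ x₂<x₃
    increasing (suc zero)       (suc zero)       (s≤s ())
    increasing (suc zero)       (suc (suc zero)) _ = x₂<x₃
    increasing (suc (suc zero)) (suc zero)       (s≤s ())
    increasing (suc (suc zero)) (suc (suc zero)) (s≤s (s≤s ()))

    mono : ∀ a b → lookup ⟨132⟩ a < lookup ⟨132⟩ b →
           toℕ (lookup α (lookup i a)) < toℕ (lookup α (lookup i b))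
    mono zero             zero             (s≤s ())
    mono zero             (suc zero)       _ = ℕ.<-trans y₁<y₃ y₃<y₂
    mono zero             (suc (suc zero)) _ = y₁<y₃
    mono (suc zero)       zero             (s≤s ())
    mono (suc zero)       (suc zero)       (s≤s (s≤s (s≤s ())))
    mono (suc zero)       (suc (suc zero)) (s≤s (s≤s ()))
    mono (suc (suc zero)) zero             (s≤s ())
    mono (suc (suc zero)) (suc zero)       _ = y₃<y₂
    mono (suc (suc zero)) (suc (suc zero)) (s≤s (s≤s ()))

    distinct : ∀ a b → lookup ⟨132⟩ a ≡ lookup ⟨132⟩ b → a ≡ b
    distinct zero             zero             _ = refl
    distinct zero             (suc zero)       ()
    distinct zero             (suc (suc zero)) ()
    distinct (suc zero)       (suc (suc zero)) ()
    distinct (suc zero)       (suc zero)       _ = refl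
    distinct (suc (suc zero)) (suc (suc zero)) _ = refl

  module _ (k d : ℕ) where
    private c = k ∸ d

    lookup-upper : ∀ a → lookup [ k , d ] (a ↑ˡ d) ≡ d + suc (toℕ a)
    lookup-upper a = trans
      (lookup-++ˡ (tabulate {n = c} λ i → d + suc (toℕ i)) (tabulate {n = d} (suc ∘ toℕ)) a)
      (lookup∘tabulate _ a)

    lookup-lower : ∀ b → lookup [ k , d ] (c ↑ʳ b) ≡ suc (toℕ b)
    lookup-lower b = trans
      (lookup-++ʳ (tabulate {n = c} λ i → d + suc (toℕ i)) (tabulate {n = d} (suc ∘ toℕ)) b)
      (lookup∘tabulate _ b)

    ↑ˡ-mono : ∀ {a a′ : Fin c} → a Fin.< a′ → (a ↑ˡ d) Fin.< (a′ ↑ˡ d)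
    ↑ˡ-mono {a} {a′} = subst₂ _<_ (sym (Fin.toℕ-↑ˡ a d)) (sym (Fin.toℕ-↑ˡ a′ d))

    ↑ʳ-mono : ∀ {b b′ : Fin d} → b Fin.< b′ → (c ↑ʳ b) Fin.< (c ↑ʳ b′)
    ↑ʳ-mono {b} {b′} b<b′ = subst₂ _<_ (sym (Fin.toℕ-↑ʳ c b)) (sym (Fin.toℕ-↑ʳ c b′))
      (ℕ.+-monoʳ-< c b<b′)

    ↑ˡ<↑ʳ : ∀ (a : Fin c) (b : Fin d) → (a ↑ˡ d) Fin.< (c ↑ʳ b)
    ↑ˡ<↑ʳ a b = subst₂ _<_ (sym (Fin.toℕ-↑ˡ a d)) (sym (Fin.toℕ-↑ʳ c b))
      (ℕ.<-≤-trans (Fin.toℕ<n a) (ℕ.m≤m+n c (toℕ b)))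

    upper-mono : ∀ {a a′ : Fin c} → a Fin.< a′ →
                 lookup [ k , d ] (a ↑ˡ d) < lookup [ k , d ] (a′ ↑ˡ d)
    upper-mono {a} {a′} a<a′ = subst₂ _<_ (sym (lookup-upper a)) (sym (lookup-upper a′))
      (ℕ.+-monoʳ-< d (s≤s a<a′))

    lower-mono : ∀ {b b′ : Fin d} → b Fin.< b′ →
                 lookup [ k , d ] (c ↑ʳ b) < lookup [ k , d ] (c ↑ʳ b′)
    lower-mono {b} {b′} b<b′ = subst₂ _<_
      (sym (lookup-lower b)) (sym (lookup-lower b′)) (s≤s b<b′)

    lower<upper : ∀ (a : Fin c) (b : Fin d) →
                  lookup [ k , d ] (c ↑ʳ b) < lookup [ k , d ] (a ↑ˡ d)
    lower<upper a b = subst₂ _<_ (sym (lookup-lower b)) (sym (lookup-upper a))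
      (ℕ.<-≤-trans (s≤s (Fin.toℕ<n b)) (ℕ.≤-trans
        (s≤s (ℕ.m≤m+n d (toℕ a))) (ℕ.≤-reflexive (sym (ℕ.+-suc d (toℕ a))))))

    -- A view of the positions in the pattern by run; matching on it turns a position into a form
    -- whose letter is known.
    data Side : Fin (c + d) → Set where
      upperSide : ∀ a → Side (a ↑ˡ d)
      lowerSide : ∀ b → Side (c ↑ʳ b)

    side : ∀ p → Side p
    side p with Fin.splitAt c p in eq
    ... | inj₁ a = subst Side (Fin.splitAt⁻¹-↑ˡ eq) (upperSide a)
    ... | inj₂ b = subst Side (Fin.splitAt⁻¹-↑ʳ eq) (lowerSide b)

    contains⇒occurrence : {α : Vec (Fin n) n} → 1 ≤ d → 1 ≤ c →
                          Contains α [ k , d ] → Occurrence (Graph α) c d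
    contains⇒occurrence {n} {α} 1≤d 1≤c (i , increasing , iso) = record
      -- The corner combines the position of the first letter of the lower run with the value of the
      -- first letter of the upper run. Both exist because `d` and `c` are positive.
      { x₀ = x (c ↑ʳ d₀) ; y₀ = y (c₀ ↑ˡ d)
      ; upper = record
        { xs = λ a → x (a ↑ˡ d) ; ys = λ a → y (a ↑ˡ d)
        ; on = λ a → (lookup i (a ↑ˡ d) , refl , refl) ,
            increasing _ _ (↑ˡ<↑ʳ a d₀) ,
            weaken (λ a → y (a ↑ˡ d)) y-upper c₀
              (ℕ.≤-trans (ℕ.≤-reflexive (Fin.toℕ-fromℕ< 1≤c)) z≤n)
        ; x-mono = λ a<a′ → increasing _ _ (↑ˡ-mono a<a′)
        ; y-mono = y-upper
        }
      ; lower = record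
        { xs = λ b → x (c ↑ʳ b) ; ys = λ b → y (c ↑ʳ b)
        ; on = λ b → (lookup i (c ↑ʳ b) , refl , refl) ,
            weaken (λ b → x (c ↑ʳ b)) x-lower d₀
              (ℕ.≤-trans (ℕ.≤-reflexive (Fin.toℕ-fromℕ< 1≤d)) z≤n) ,
            Equivalence.from (iso _ _) (lower<upper c₀ b)
        ; x-mono = x-lower
        ; y-mono = λ b<b′ → Equivalence.from (iso _ _) (lower-mono b<b′)
        }
      }
      where
      x y : Fin (c + d) → ℕ
      x p = toℕ (lookup i p)
      y p = toℕ (lookup α (lookup i p))

      c₀ : Fin c
      c₀ = fromℕ< 1≤c
      d₀ : Fin d
      d₀ = fromℕ< 1≤d

      y-upper : ∀ {a a′} → a Fin.< a′ → y (a ↑ˡ d) < y (a′ ↑ˡ d)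
      y-upper a<a′ = Equivalence.from (iso _ _) (upper-mono a<a′)

      x-lower : ∀ {b b′} → b Fin.< b′ → x (c ↑ʳ b) < x (c ↑ʳ b′)
      x-lower b<b′ = increasing _ _ (↑ʳ-mono b<b′)

      weaken : ∀ {m} (f : Fin m → ℕ) → (∀ {a b} → a Fin.< b → f a < f b) →
               ∀ a {b} → a Fin.≤ b → f a ≤ f b
      weaken f f-mono a {b} a≤b with ℕ.m≤n⇒m<n∨m≡n a≤b
      ... | inj₁ a<b = ℕ.<⇒≤ (f-mono a<b)
      ... | inj₂ a≡b = ℕ.≤-reflexive (cong f (Fin.toℕ-injective a≡b))

    occurrence⇒contains : {α : Vec (Fin n) n} → Occurrence (Graph α) c d → Contains α [ k , d ]
    occurrence⇒contains {n} {α} o =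
      i , (λ p q → increasing (side p) (side q)) ,
      orderIsomorphic [ k , d ] (λ p → toℕ (lookup α (lookup i p)))
        (λ p q → mono (side p) (side q)) (λ p q → distinct (side p) (side q))
      where
      upper-point : ∀ a → Graph α (xs (upper o) a) (ys (upper o) a)
      upper-point a = proj₁ (on (upper o) a)

      lower-point : ∀ b → Graph α (xs (lower o) b) (ys (lower o) b)
      lower-point b = proj₁ (on (lower o) b)

      i : Vec (Fin n) (c + d)
      i = tabulate (proj₁ ∘ upper-point) Vec.++ tabulate (proj₁ ∘ lower-point)

      i-upper : ∀ a → lookup i (a ↑ˡ d) ≡ proj₁ (upper-point a)
      i-upper a = trans (lookup-++ˡ (tabulate _) _ a) (lookup∘tabulate _ a)

      i-lower : ∀ b → lookup i (c ↑ʳ b) ≡ proj₁ (lower-point b)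
      i-lower b = trans (lookup-++ʳ (tabulate (proj₁ ∘ upper-point)) _ b)
                        (lookup∘tabulate _ b)

      x y : ∀ {p} → Side p → ℕ
      x (upperSide a) = xs (upper o) a
      x (lowerSide b) = xs (lower o) b
      y (upperSide a) = ys (upper o) a
      y (lowerSide b) = ys (lower o) b

      x≡ : ∀ {p} (σ : Side p) → x σ ≡ toℕ (lookup i p)
      x≡ (upperSide a) = trans (sym (proj₁ (proj₂ (upper-point a))))
                               (cong toℕ (sym (i-upper a)))
      x≡ (lowerSide b) = trans (sym (proj₁ (proj₂ (lower-point b))))
                               (cong toℕ (sym (i-lower b)))

      y≡ : ∀ {p} (σ : Side p) → y σ ≡ toℕ (lookup α (lookup i p))
      y≡ (upperSide a) = trans (sym (proj₂ (proj₂ (upper-point a))))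
                               (cong (toℕ ∘ lookup α) (sym (i-upper a)))
      y≡ (lowerSide b) = trans (sym (proj₂ (proj₂ (lower-point b))))
                               (cong (toℕ ∘ lookup α) (sym (i-lower b)))

      x-increasing : ∀ {p q} (σ : Side p) (ρ : Side q) → p Fin.< q → x σ < x ρ
      x-increasing (upperSide a) (upperSide a′) p<q =
        x-mono (upper o) (subst₂ _<_ (Fin.toℕ-↑ˡ a d) (Fin.toℕ-↑ˡ a′ d) p<q)
      x-increasing (upperSide a) (lowerSide b) _ =
        ℕ.<-≤-trans (proj₁ (proj₂ (on (upper o) a))) (proj₁ (proj₂ (on (lower o) b)))
      x-increasing (lowerSide b) (upperSide a) p<q = contradiction p<q (ℕ.<⇒≯ (↑ˡ<↑ʳ a b))
      x-increasing (lowerSide b) (lowerSide b′) p<q = x-mono (lower o)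
        (ℕ.+-cancelˡ-< c _ _ (subst₂ _<_ (Fin.toℕ-↑ʳ c b) (Fin.toℕ-↑ʳ c b′) p<q))

      increasing : ∀ {p q} → Side p → Side q → p Fin.< q → lookup i p Fin.< lookup i q
      increasing σ ρ p<q = subst₂ _<_ (x≡ σ) (x≡ ρ) (x-increasing σ ρ p<q)

      y-mono′ : ∀ {p q} (σ : Side p) (ρ : Side q) →
                lookup [ k , d ] p < lookup [ k , d ] q → y σ < y ρ
      y-mono′ (upperSide a) (upperSide a′) τ< = y-mono (upper o)
        (ℕ.≤-pred (ℕ.+-cancelˡ-< d _ _ (subst₂ _<_ (lookup-upper a) (lookup-upper a′) τ<)))
      y-mono′ (upperSide a) (lowerSide b) τ< = contradiction τ< (ℕ.<⇒≯ (lower<upper a b))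
      y-mono′ (lowerSide b) (upperSide a) _ =
        ℕ.<-≤-trans (proj₂ (proj₂ (on (lower o) b))) (proj₂ (proj₂ (on (upper o) a)))
      y-mono′ (lowerSide b) (lowerSide b′) τ< = y-mono (lower o)
        (ℕ.≤-pred (subst₂ _<_ (lookup-lower b) (lookup-lower b′) τ<))

      mono : ∀ {p q} → Side p → Side q → lookup [ k , d ] p < lookup [ k , d ] q →
             toℕ (lookup α (lookup i p)) < toℕ (lookup α (lookup i q))
      mono σ ρ τ< = subst₂ _<_ (y≡ σ) (y≡ ρ) (y-mono′ σ ρ τ<)

      distinct : ∀ {p q} → Side p → Side q → lookup [ k , d ] p ≡ lookup [ k , d ] q → p ≡ q
      distinct (upperSide a) (upperSide a′) τ≡ = cong (_↑ˡ d) (Fin.toℕ-injective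
        (ℕ.suc-injective (ℕ.+-cancelˡ-≡ d _ _
          (trans (sym (lookup-upper a)) (trans τ≡ (lookup-upper a′))))))
      distinct (upperSide a) (lowerSide b) τ≡ = contradiction (sym τ≡) (ℕ.<⇒≢ (lower<upper a b))
      distinct (lowerSide b) (upperSide a) τ≡ = contradiction τ≡ (ℕ.<⇒≢ (lower<upper a b))
      distinct (lowerSide b) (lowerSide b′) τ≡ = cong (c ↑ʳ_) (Fin.toℕ-injective
        (ℕ.suc-injective (trans (sym (lookup-lower b)) (trans τ≡ (lookup-lower b′)))))

  words-unique : ∀ n m → Unique (words n m)
  words-unique n zero    = [] ∷ []
  words-unique n (suc m) =
    Unique.cartesianProductWith⁺ _∷_ ∷-injective (Unique.allFin⁺ n) (words-unique n m)

  ∈-words : ∀ {n m} (α : Vec (Fin n) m) → α ∈ words n m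
  ∈-words []      = here refl
  ∈-words (i ∷ α) = ∈-cartesianProductWith⁺ _∷_ (∈-allFin i) (∈-words α)

  -- One inclusion is enough: a word has a letter in every position and the plot of a code is
  -- functional, which gives the other inclusion in `encodes-⊇`.
  record Encodes {n} (α : Vec (Fin n) n) (δ : Involution) : Set where
    constructor encodes
    field
      size≡  : sizeᴵ δ ≡ n
      graph⊆ : Graph α ⊆ plotᴵ δ

  encodes-⊇ : {α : Vec (Fin n) n} {δ : Involution} → Encodes α δ → plotᴵ δ ⊆ Graph α
  encodes-⊇ {α = α} {δ} (encodes refl f) {x} p =
    let i = fromℕ< (x<n π p)
        q = i , Fin.toℕ-fromℕ< (x<n π p) , refl
    in subst (Graph α x) (functional π (f q) p) q
    where π = plotᴵ-permutation δ

  encodes-injectiveˡ : {α α′ : Vec (Fin n) n} {δ : Involution} →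
                       Encodes α δ → Encodes α′ δ → α ≡ α′
  encodes-injectiveˡ {α = α} {α′} {δ} (encodes _ f) (encodes _ f′) =
    trans (sym (tabulate∘lookup α)) (trans
      (tabulate-cong λ i → Fin.toℕ-injective (functional (plotᴵ-permutation δ)
        (f (i , refl , refl)) (f′ (i , refl , refl))))
      (tabulate∘lookup α′))

  encodes-injectiveʳ : {α : Vec (Fin n) n} {δ δ′ : Involution} →
                       Encodes α δ → Encodes α δ′ → δ ≡ δ′
  encodes-injectiveʳ {δ = δ} {δ′} e@(encodes n≡ _) (encodes n≡′ f′) =
    plotᴵ-injective δ δ′ (trans n≡ (sym n≡′)) (f′ ∘ encodes-⊇ e)

  module _ (k d : ℕ) (1≤d : 1 ≤ d) (d≤c : d ≤ k ∸ d) where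
    private
      c = k ∸ d
      τ = [ k , d ]

    decode : (α : Vec (Fin n) n) → Counted τ n α → ∃ λ δ → Encodes α δ × Good c d δ
    decode {n} α (inv , avoids132 , avoidsτ) =
      let δ , n≡ , f = ∃involution (<-wellFounded n) (graph-permutation {α = α} inv)
                    (avoids132 ∘ 132⇒contains {α = α}) (graph-symmetric {α = α} inv)
          e = encodes n≡ f
      in δ , e , good δ e (good-or-occurrence d≤c δ)
      where
      good : ∀ δ → Encodes α δ → Good c d δ ⊎ Occurrence (plotᴵ δ) c d → Good c d δ
      good δ e (inj₁ g) = g
      good δ e (inj₂ o) = contradiction
        (occurrence⇒contains k d {α = α} (occurrence-mono (encodes-⊇ e) o)) avoidsτ

    -- The word is read off the rows of the plot; it is an involution because the plot is symmetric
    -- and functional.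
    encode : ∀ δ → Good c d δ → ∃ λ α → Encodes α δ × Counted τ (sizeᴵ δ) α
    encode δ g = α , encodes refl graph-⊆ , inv ,
      plotᴵ-avoids132 δ ∘ contains132-mono graph-⊆ ∘ contains⇒132 {α = α} ,
      good-avoids 1≤d d≤c δ g ∘ occurrence-mono graph-⊆ ∘
        contains⇒occurrence k d {α = α} 1≤d (ℕ.≤-trans 1≤d d≤c)
      where
      π = plotᴵ-permutation δ

      value : (i : Fin (sizeᴵ δ)) → ∃ λ y → plotᴵ δ (toℕ i) y
      value i = row π (Fin.toℕ<n i)

      α : Vec (Fin (sizeᴵ δ)) (sizeᴵ δ)
      α = tabulate λ i → fromℕ< (y<n π (proj₂ (value i)))

      graph-⊆ : Graph α ⊆ plotᴵ δ
      graph-⊆ (i , refl , refl) = subst (plotᴵ δ (toℕ i))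
        (sym (trans (cong toℕ (lookup∘tabulate _ i)) (Fin.toℕ-fromℕ< _)))
        (proj₂ (value i))

      inv : IsInvolution α
      inv i = Fin.toℕ-injective (functional π (graph-⊆ (lookup α i , refl , refl))
        (plotᴵ-symmetric δ (graph-⊆ (i , refl , refl))))

    -- `Encodes` is injective in each argument. With `decode` it bounds the number of words by that
    -- of the codes, with `encode` the converse.
    I≡ : ∀ n → I τ n ≡ length (list (goodInvolutions c d) n)
    I≡ n = ℕ.≤-antisym
      (length-≤ Encodes unique-words
        (λ {α} α∈ → let _ , counted = ∈-filter⁻ (counted? τ n) {xs = words n n} α∈
                        δ , encodes n≡ f , g = decode α counted
                    in δ , subst (λ n → δ ∈ list good n) n≡ (complete good (tt , g)) ,
                       encodes n≡ f)
        encodes-injectiveˡ)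
      (length-≤ (λ δ α → Encodes α δ) (unique good n)
        (λ {δ} δ∈ → word δ (sound good δ∈))
        encodes-injectiveʳ)
      where
      good = goodInvolutions c d
      unique-words = Unique.filter⁺ (counted? τ n) (words-unique n n)

      word : ∀ δ → _ × sizeᴵ δ ≡ n → ∃ λ α → α ∈ filter (counted? τ n) (words n n) × Encodes α δ
      word δ ((_ , g) , refl) = let α , e , counted = encode δ g in
        α , ∈-filter⁺ (counted? τ n) (∈-words α) counted , e

-- The series of the theorem in closed form.

module Assembly where
  open import Data.Integer using (+_)
  open import Algebra.Bundles using (CommutativeRing)
  open import Data.List using (length)
  open import Defs using (I; [_,_]; generatingFunction)
  open Counting using (list)
  open PowerSeries
  open CommutativeRing commutativeRing using (*-congˡ; semiring) renaming (trans to ≈-trans)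
  open import Algebra.Properties.Semiring.Exp semiring using (_^_)
  open ReducedChebyshev
  open Trees
  open Words

  left-hand-side : ∀ k d e {c} → k ∸ suc d ≡ c → c ≡ suc (d ℕ.+ e) →
    p c * p (suc c) * (p (2 ℕ.+ d) + - (X * p (suc d)))
      * generatingFunction (I [ k , suc d ]) ≈
    p (suc d) * p c * p (suc c) + X ^ suc d * X ^ suc d * p e * s c
  left-hand-side k d e {c} refl c≡ = subst Claim (sym c≡) (≈-trans
    (*-congˡ (pointwise λ n → cong +_ (trans
      (I≡ k (suc d) (ℕ.s≤s ℕ.z≤n) (subst (suc d ≤_) (sym c≡) (ℕ.s≤s d≤d+e)) n)
      (cong (λ c → length (list (goodInvolutions c (suc d)) n)) c≡))))
    (closed-form treesBelow-0 treesBelow-suc involutionsBelow-0 involutionsBelow-suc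
      d e (treesBelow-Between d≤d+e) (goodInvolutions-suc d≤d+e)))
    where
    d≤d+e = ℕ.m≤m+n d e
    Claim : ℕ → Set
    Claim c = p c * p (suc c) * (p (2 ℕ.+ d) + - (X * p (suc d)))
                * generatingFunction (I [ k , suc d ]) ≈
              p (suc d) * p c * p (suc c) + X ^ suc d * X ^ suc d * p e * s c

open import Defs
open import Data.Integer using (+_)

theorem2p13 : ∀ k d → 2 ≤ k → 1 ≤ d → 2 ℕ.* d ≤ k →
    generatingFunction (I [ k , d ]) IsExpansionOf
    (1# / (x * (U (+ d) t - U (+ d ℤ.- 1ℤ) t))
    * (U (+ d ℤ.- 1ℤ) t
    + U (+ k ℤ.- + (2 ℕ.* d) ℤ.- 1ℤ) t
    / (U (+ (k ∸ d)) t * U (+ (k ∸ d ∸ 1)) t)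
    * Σ[ k ∸ d ] (λ j → U (+ j) t)))
theorem2p13 k (suc d) _ _ 2d≤k =
  expansion (cancellable-denominator d c≡) (right-hand-side d e c≡ z≡)
            (left-hand-side k d e refl c≡)
  where
  open Fractions
  open Assembly

  e = k ∸ 2 ℕ.* suc d

  2d+e≡k : 2 ℕ.* suc d ℕ.+ e ≡ k
  2d+e≡k = ℕ.m+[n∸m]≡n 2d≤k

  c≡ : k ∸ suc d ≡ suc (d ℕ.+ e)
  c≡ = trans (cong (_∸ suc d) (trans (sym 2d+e≡k) (ℕ.+-assoc (suc d) (suc d ℕ.+ 0) e)))
    (trans (ℕ.m+n∸m≡n (suc d) (suc d ℕ.+ 0 ℕ.+ e))
           (cong (λ m → suc (m ℕ.+ e)) (ℕ.+-identityʳ d)))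

  z≡ : + k ℤ.- + (2 ℕ.* suc d) ℤ.- 1ℤ ≡ + e ℤ.- 1ℤ
  z≡ = cong (ℤ._- 1ℤ) (trans (ℤ.m-n≡m⊖n k (2 ℕ.* suc d)) (ℤ.⊖-≥ 2d≤k))
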